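{- Let $k,\ell$ be integers with $2\le \ell<k/2$ and put $p=\max\{\ell,\;k-2\ell-1,\;\lceil k/2\rceil-\ell\}$. Then there exist constants $C>0$ and $n_0$ such that for every $n\ge n_0$ divisible by $k-\ell$, $$\mathrm{sat}(n,k,\ell)\le C\,n^{p}.$$ In other words, $\mathrm{sat}(n,k,\ell)=O(n^p)$ as $n\to\infty$ over integers $n$ divisible by $k-\ell$.
   Context: A $k$-graph is a family of $k$-element subsets (edges) of a finite vertex set. For integers $1\le \ell<k$, an $(\ell,k)$-cycle is a $k$-graph which, for some $s$ divisible by $k-\ell$, consists of distinct vertices $v_1,\dots,v_s$ (cyclically ordered) and the $s/(k-\ell)$ edges $\{v_1,\dots,v_k\},\{v_{k-\ell+1},\dots,v_{2k-\ell}\},\dots,\{v_{s-(k-\ell)+1},\dots,v_s,v_1,\dots,v_\ell\}$ (consecutive edges share exactly $\ell$ vertices). An $(\ell,k)$-cycle in an $n$-vertex $k$-graph $H$ is hamiltonian if it contains all $n$ vertices; $H$ is $\ell$-hamiltonian if it contains a hamiltonian $(\ell,k)$-cycle. A $k$-graph $H$ on $n$ vertices is $\ell$-hamiltonian saturated if $H$ is not $\ell$-hamiltonian, but for every $k$-subset $e$ of the vertex set that is not an edge of $H$, the $k$-graph $H+e$ is $\ell$-hamiltonian. $\mathrm{sat}(n,k,\ell)$ denotes the minimum number of edges of an $\ell$-hamiltonian saturated $k$-graph on $n$ vertices (considered for $n$ divisible by $k-\ell$). -}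

module Defs where

open import Data.Nat using (ℕ; _+_; _*_; _∸_; _≤_; _⊔_; ⌈_/2⌉; NonZero)
open import Data.Nat.Divisibility using (_∣_; quotient)
open import Data.Nat.DivMod using (_mod_)
open import Data.Fin using (Fin; toℕ)
open import Data.Fin.Subset using (Subset; ⁅_⁆; ⋃; ∣_∣)
open import Data.List using (List; _∷_; length; map; upTo)
open import Data.List.Membership.Propositional using (_∈_; _∉_)
open import Data.List.Relation.Unary.All using (All; _∷_)
open import Data.List.Relation.Unary.All.Properties using (¬Any⇒All¬)
open import Data.List.Relation.Unary.AllPairs using (_∷_)
open import Data.List.Relation.Unary.Unique.Propositional using (Unique)
open import Data.Product using (Σ; ∃; _×_)
open import Function.Definitions using (Injective)
open import Relation.Binary.PropositionalEquality using (_≡_)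
open import Relation.Nullary using (¬_)

-- A k-graph on the vertex set Fin n. The edge set is a duplicate-free list, so
-- that its length is the number of edges; the order of the list is irrelevant
-- to everything below.
record KGraph (n k : ℕ) : Set where
  field
    edges   : List (Subset n)
    uniform : All (λ e → ∣ e ∣ ≡ k) edges
    simple  : Unique edges

open KGraph public

size : ∀ {n k} → KGraph n k → ℕ
size H = length (edges H)

addEdge : ∀ {n k} (H : KGraph n k) (e : Subset n) →
          ∣ e ∣ ≡ k → e ∉ edges H → KGraph n k
addEdge H e ∣e∣≡k e∉H = record
  { edges   = e ∷ edges H
  ; uniform = ∣e∣≡k ∷ uniform H
  ; simple  = ¬Any⇒All¬ (edges H) e∉H ∷ simple H
  }

-- An (ℓ,k)-cycle with vertices in Fin n. Positions on the cycle are numbered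
-- from 0, so that v i is the vertex usually written v_{i+1}.
record Cycle (n k ℓ : ℕ) : Set where
  field
    s           : ℕ
    {{nonZero}} : NonZero s
    k≤s         : k ≤ s
    k∸ℓ∣s       : (k ∸ ℓ) ∣ s
    v           : Fin s → Fin n
    distinct    : Injective _≡_ _≡_ v

  -- s / (k - ℓ)
  edgeCount : ℕ
  edgeCount = quotient k∸ℓ∣s

  -- The t-th edge occupies the k cyclically consecutive positions starting at
  -- t (k - ℓ).
  edge : Fin edgeCount → Subset n
  edge t = ⋃ (map (λ i → ⁅ v ((toℕ t * (k ∸ ℓ) + i) mod s) ⁆) (upTo k))

_ContainedIn_ : ∀ {n k ℓ} → Cycle n k ℓ → KGraph n k → Set
c ContainedIn H = ∀ t → Cycle.edge c t ∈ edges H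

Spanning : ∀ {n k ℓ} → Cycle n k ℓ → Set
Spanning {n} c = ∀ (x : Fin n) → ∃ λ i → Cycle.v c i ≡ x

Hamiltonian : ∀ {n k} → ℕ → KGraph n k → Set
Hamiltonian {n} {k} ℓ H = Σ (Cycle n k ℓ) λ c → c ContainedIn H × Spanning c

HamiltonianSaturated : ∀ {n k} → ℕ → KGraph n k → Set
HamiltonianSaturated {n} {k} ℓ H =
  ¬ Hamiltonian ℓ H ×
  (∀ (e : Subset n) (∣e∣≡k : ∣ e ∣ ≡ k) (e∉H : e ∉ edges H) →
     Hamiltonian ℓ (addEdge H e ∣e∣≡k e∉H))

-- sat(n,k,ℓ) = m, as a relation: the minimum is attained, and is a lower bound.
IsSat : (n k ℓ m : ℕ) → Set
IsSat n k ℓ m =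
  (Σ (KGraph n k) λ H → HamiltonianSaturated ℓ H × size H ≡ m) ×
  (∀ (H : KGraph n k) → HamiltonianSaturated ℓ H → m ≤ size H)

-- Under 2ℓ < k both truncated subtractions agree with subtraction in ℤ.
exponent : (k ℓ : ℕ) → ℕ
exponent k ℓ = ℓ ⊔ (k ∸ 2 * ℓ ∸ 1) ⊔ (⌈ k /2⌉ ∸ ℓ)

{-# OPTIONS --safe #-}
{-
Since ℓ ≤ p, a bound O(n^ℓ) suffices. The vertices other than one vertex, the apex, are cut into bags of bounded size. Each bag
consists of a white part U i and of a gadget, a grid whose rows and columns have almost k vertices; the gadget D i of U i lies in
the bag following U i on a ring of bags. White edges only see a white part, the next one and a few vertices of the gadget, so
that white edges can sweep up any set of leftover vertices, all around the ring. A gadget D i is linked to the white part by two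
kinds of edges: a full row with one vertex of U i, and a full column with one vertex of U i and the apex. Finally an ℓ-set that is
not local is coloured by the gadget of its first bag, and the remaining edges are the k-sets all of whose ℓ-subsets have the
colour of one gadget.

A row and a column meet in one vertex, and edges through distinct columns meet only in the apex, but edges of an ℓ-cycle meet in
0 or ℓ ≥ 2 vertices. So a cycle covering the apex uses exactly one column edge, say of D i, and no row edge of D i: it can never
leave the colour of D i, and misses most of U i. Hence this graph has no hamiltonian cycle.

Let e be a further k-set, and order its vertices by bags. Unless e is concentrated on few bags, disjoint ℓ-subsets at its two
ends have different colours. Then e can be followed inside one gadget to a row and inside the other to a column and the apex,
and the white edges close the cycle; a white end of e, or the apex in e, only makes this easier. Concentrated k-sets, all edges
of the graph included, number O(n^ℓ), so adding them greedily as long as no hamiltonian cycle arises gives a saturated k-graph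
with O(n^ℓ) edges.
-}
module Submission where

open import Data.Nat using (ℕ; zero; suc; _+_; _*_; _∸_; _^_; _≤_; _<_; _⊔_; z≤n; s≤s; s≤s⁻¹; NonZero; nonZero; _≤?_; _<?_; _≟_; _⊓_; >-nonZero; >-nonZero⁻¹)
open import Data.Nat.Properties hiding (_≟_; _≤?_; _<?_)
open import Data.Nat.Divisibility using (_∣_; divides; quotient)
open import Data.Nat.DivMod using (_/_; _%_; _mod_; m%n<n; m≡m%n+[m/n]*n; m<n⇒m%n≡m; [m+kn]%n≡m%n; m/n*n≤m; m<n*o⇒m/o<n; m*n%n≡0; m≥n⇒m/n>0; /-monoˡ-≤)
open import Data.Nat.Tactic.RingSolver using (solve-∀)
open import Data.Fin using (Fin; zero; suc; toℕ; fromℕ<) renaming (_≟_ to _≟ᶠ_)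
open import Data.Fin.Properties using (toℕ<n; toℕ-injective; toℕ-fromℕ<; injective⇒≤; any?; all?)
open import Data.Fin.Subset using (Subset; ⁅_⁆; ⋃; ∣_∣; inside; outside) renaming (_∈_ to _∈ₛ_; _∉_ to _∉ₛ_)
open import Data.Fin.Subset.Properties using (x∈⁅x⁆; x∈⁅y⁆⇒x≡y; ∉⊥; x∈p∪q⁻; x∈p∪q⁺; ⊆-antisym; anySubset?)
open import Data.Vec using (Vec; []; _∷_; here; there)
import Data.Bool as Bool
import Data.Vec as Vec
import Data.Vec.Properties as Vecₚ
open import Data.List using (List; []; _∷_; _++_; length; map; filter; upTo; allFin; concatMap; take; drop; applyUpTo)
open import Data.List.Properties using (length-map; length-++; length-take; length-drop; length-filter; take++drop≡id; filter-all; filter-none; filter-accept; filter-reject; filter-++; ++-assoc; ++-identityʳ; map-∘; map-cong; length-upTo; length-tabulate; take-all)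
import Data.List.Properties as Listₚ
open import Data.List.Relation.Unary.Any using (Any; here; there)
import Data.List.Relation.Unary.Any as Any
import Data.List.Relation.Unary.Any.Properties as Anyₚ
open import Data.List.Relation.Unary.All using (All; []; _∷_)
import Data.List.Relation.Unary.All as All
import Data.List.Relation.Unary.All.Properties as Allₚ
open import Data.List.Relation.Unary.AllPairs using (AllPairs; []; _∷_)
import Data.List.Relation.Unary.AllPairs as AllPairs
import Data.List.Relation.Unary.AllPairs.Properties as AllPairsₚ
open import Data.List.Relation.Unary.Unique.Propositional using (Unique)
import Data.List.Relation.Unary.Unique.Propositional.Properties as Uniqueₚ
open import Data.List.Membership.Propositional using (_∈_; _∉_; find; lose)
open import Data.List.Membership.Propositional.Properties using (∈-map⁺; ∈-map⁻; ∈-++⁺ˡ; ∈-++⁺ʳ; ∈-++⁻; ∈-∃++; ∈-filter⁺; ∈-filter⁻; ∈-upTo⁺; ∈-upTo⁻; ∈-allFin; ∈-concatMap⁺; ∈-concatMap⁻)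
open import Data.List.Membership.Propositional.Properties.WithK using (unique∧set⇒bag)
open import Data.List.Relation.Binary.BagAndSetEquality using (∼bag⇒↭)
open import Data.List.Relation.Binary.Permutation.Propositional using (_↭_; ↭-refl; ↭-sym; ↭-trans; ↭-reflexive; prep; swap; module PermutationReasoning)
import Data.List.Relation.Binary.Permutation.Propositional.Properties as ↭ₚ
open import Data.Product using (Σ; ∃; _×_; _,_; proj₁; proj₂)
open import Data.Sum using (_⊎_; inj₁; inj₂; [_,_]′)
open import Data.Empty using (⊥; ⊥-elim)
open import Data.Unit using (⊤; tt)
open import Function using (_∘_; id; mk⇔)
open import Function.Definitions using (Injective)
open import Relation.Nullary using (¬_; Dec; yes; no; contradiction)
open import Relation.Nullary.Decidable using (_×-dec_; _⊎-dec_; ¬?; map′; decidable-stable; _→-dec_)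
open import Relation.Unary using (Decidable)
open import Relation.Binary.PropositionalEquality using (_≡_; _≢_; refl; sym; trans; cong; cong₂; subst; subst₂; module ≡-Reasoning)
open import Relation.Binary using (tri<; tri≈; tri>)
open import Defs

-- Lists and subsets

-- Consecutive edges of a cycle communicate only through their common `ℓ`-set, so the clauses of an
-- edge are chosen to let no `ℓ`-subset of a gadget edge lie in a white edge. Hence a white edge
-- that meets `D i` has fewer than `ℓ` vertices outside `U i`, and a gadget edge with exactly `ℓ`
-- vertices outside its gadget has one in `U (nxt i)` and one far from it. Bags form a ring, but
-- colours use their linear order; the seam between the last bag and bag 0 causes the extra clauses
-- in `Ok` and `NearTwo`. The ports dictate `h = k - 2`: a row has `k - 1` vertices and takes one
-- white vertex, a column has `k - 2` and takes a white vertex and the apex. One case needs care: if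
-- both ends of `e` are white and the apex is outside `e`, no column is at hand to cover the apex.
-- Then a vertex from the middle of `e` is exchanged into the first end and makes it a gadget end.
-- Where no such vertex exists, `e` lies in boundedly many bags fixed by two parameters, which gives
-- O(n^2) sets, at most O(n^ℓ). The other exceptional sets have more than `k - ℓ` vertices in two
-- consecutive bags and the apex: O(n) places times O(n^(ℓ-1)) choices for the rest.

private variable
  A B : Set
  n : ℕ

Unique-resp-↭ : {xs ys : List A} → xs ↭ ys → Unique xs → Unique ys
Unique-resp-↭ _↭_.refl         u                         = u
Unique-resp-↭ (prep x p)       (x∉ ∷ u)                  = ↭ₚ.All-resp-↭ p x∉ ∷ Unique-resp-↭ p u
Unique-resp-↭ (swap x y p)     ((x≢y ∷ x∉) ∷ (y∉ ∷ u))   =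
  ((x≢y ∘ sym) ∷ ↭ₚ.All-resp-↭ p y∉) ∷ (↭ₚ.All-resp-↭ p x∉ ∷ Unique-resp-↭ p u)
Unique-resp-↭ (_↭_.trans p q)  u                         = Unique-resp-↭ q (Unique-resp-↭ p u)

unique-⊆⇒length≤ : {xs ys : List A} → Unique xs → (∀ {x} → x ∈ xs → x ∈ ys) → length xs ≤ length ys
unique-⊆⇒length≤ {xs = []} u s = z≤n
unique-⊆⇒length≤ {xs = x ∷ xs} {ys} (x∉ ∷ u) s with ∈-∃++ (s (here refl))
... | as , bs , refl = subst (suc (length xs) ≤_) (sym (↭ₚ.↭-length (↭ₚ.shift x as bs)))
        (s≤s (unique-⊆⇒length≤ u λ y∈ → drop-head (All.lookup x∉ y∈) (↭ₚ.∈-resp-↭ (↭ₚ.shift x as bs) (s (there y∈)))))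
  where
  drop-head : ∀ {y} {zs : List _} → x ≢ y → y ∈ x ∷ zs → y ∈ zs
  drop-head x≢y (here eq) = contradiction (sym eq) x≢y
  drop-head x≢y (there p) = p

unique-set⇒↭ : {xs ys : List A} → Unique xs → Unique ys →
               (∀ {x} → x ∈ xs → x ∈ ys) → (∀ {x} → x ∈ ys → x ∈ xs) → xs ↭ ys
unique-set⇒↭ u v s t = ∼bag⇒↭ (unique∧set⇒bag u v (mk⇔ s t))

++-flip : (xs ys zs : List A) → xs ++ ys ++ zs ↭ zs ++ ys ++ xs
++-flip xs ys zs = begin
  xs ++ ys ++ zs     ↭⟨ ↭ₚ.++-comm xs (ys ++ zs) ⟩
  (ys ++ zs) ++ xs   ↭⟨ ↭ₚ.++⁺ʳ xs (↭ₚ.++-comm ys zs) ⟩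
  (zs ++ ys) ++ xs   ≡⟨ ++-assoc zs ys xs ⟩
  zs ++ ys ++ xs     ∎
  where open PermutationReasoning

unique-map : (f : A → B) {xs : List A} → (∀ {x y} → x ∈ xs → y ∈ xs → f x ≡ f y → x ≡ y) → Unique xs → Unique (map f xs)
unique-map f inj []       = []
unique-map f inj (x∉ ∷ u) = Allₚ.map⁺ (All.tabulate λ y∈ eq → All.lookup x∉ y∈ (inj (here refl) (there y∈) eq))
                            ∷ unique-map f (λ p q → inj (there p) (there q)) u

elements : Subset n → List (Fin n)
elements []            = []
elements (inside  ∷ p) = zero ∷ map suc (elements p)
elements (outside ∷ p) = map suc (elements p)

∈-elements⁺ : {e : Subset n} {x : Fin n} → x ∈ₛ e → x ∈ elements e
∈-elements⁺ {e = inside  ∷ e} here        = here refl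
∈-elements⁺ {e = inside  ∷ e} (there x∈e) = there (∈-map⁺ suc (∈-elements⁺ x∈e))
∈-elements⁺ {e = outside ∷ e} (there x∈e) = ∈-map⁺ suc (∈-elements⁺ x∈e)

∈-elements⁻ : {e : Subset n} {x : Fin n} → x ∈ elements e → x ∈ₛ e
∈-elements⁻ {e = inside  ∷ e} (here refl) = here
∈-elements⁻ {e = inside  ∷ e} (there x∈) with ∈-map⁻ suc x∈
... | y , y∈ , refl = there (∈-elements⁻ y∈)
∈-elements⁻ {e = outside ∷ e} x∈ with ∈-map⁻ suc x∈
... | y , y∈ , refl = there (∈-elements⁻ y∈)

elements-sorted : (e : Subset n) → AllPairs (λ x y → toℕ x < toℕ y) (elements e)
elements-sorted []            = []
elements-sorted (inside  ∷ e) =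
  Allₚ.map⁺ (All.universal (λ _ → s≤s z≤n) _) ∷ AllPairsₚ.map⁺ (AllPairs.map s≤s (elements-sorted e))
elements-sorted (outside ∷ e) = AllPairsₚ.map⁺ (AllPairs.map s≤s (elements-sorted e))

elements-unique : (e : Subset n) → Unique (elements e)
elements-unique e = AllPairs.map (λ { x<y refl → <-irrefl refl x<y }) (elements-sorted e)

length-elements : (e : Subset n) → length (elements e) ≡ ∣ e ∣
length-elements []            = refl
length-elements (inside  ∷ e) = cong suc (trans (length-map suc (elements e)) (length-elements e))
length-elements (outside ∷ e) = trans (length-map suc (elements e)) (length-elements e)

setOf : List (Fin n) → Subset n
setOf xs = ⋃ (map ⁅_⁆ xs)

∈-setOf⁺ : {xs : List (Fin n)} {x : Fin n} → x ∈ xs → x ∈ₛ setOf xs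
∈-setOf⁺ (here refl) = x∈p∪q⁺ (inj₁ (x∈⁅x⁆ _))
∈-setOf⁺ (there x∈)  = x∈p∪q⁺ (inj₂ (∈-setOf⁺ x∈))

∈-setOf⁻ : (xs : List (Fin n)) {x : Fin n} → x ∈ₛ setOf xs → x ∈ xs
∈-setOf⁻ []       x∈ = contradiction x∈ ∉⊥
∈-setOf⁻ (y ∷ xs) x∈ with x∈p∪q⁻ ⁅ y ⁆ (setOf xs) x∈
... | inj₁ x∈y  = here (x∈⁅y⁆⇒x≡y y x∈y)
... | inj₂ x∈xs = there (∈-setOf⁻ xs x∈xs)

elements-setOf : (xs : List (Fin n)) → Unique xs → elements (setOf xs) ↭ xs
elements-setOf xs u = unique-set⇒↭ (elements-unique (setOf xs)) u (∈-setOf⁻ xs ∘ ∈-elements⁻) (∈-elements⁺ ∘ ∈-setOf⁺)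

setOf-cong : {xs ys : List (Fin n)} → (∀ {x} → x ∈ xs → x ∈ ys) → (∀ {x} → x ∈ ys → x ∈ xs) → setOf xs ≡ setOf ys
setOf-cong {xs = xs} {ys} s t = ⊆-antisym (∈-setOf⁺ ∘ s ∘ ∈-setOf⁻ xs) (∈-setOf⁺ ∘ t ∘ ∈-setOf⁻ ys)

setOf-resp-↭ : {xs ys : List (Fin n)} → xs ↭ ys → setOf xs ≡ setOf ys
setOf-resp-↭ p = setOf-cong (↭ₚ.∈-resp-↭ p) (↭ₚ.∈-resp-↭ (↭-sym p))

setOf-elements : (e : Subset n) → setOf (elements e) ≡ e
setOf-elements e = ⊆-antisym (∈-elements⁻ ∘ ∈-setOf⁻ (elements e)) (∈-setOf⁺ ∘ ∈-elements⁺)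

∣setOf∣ : (xs : List (Fin n)) → Unique xs → ∣ setOf xs ∣ ≡ length xs
∣setOf∣ xs u = trans (sym (length-elements (setOf xs))) (↭ₚ.↭-length (elements-setOf xs u))

allSubsets : ∀ n → List (Subset n)
allSubsets zero    = [] ∷ []
allSubsets (suc n) = map (inside ∷_) (allSubsets n) ++ map (outside ∷_) (allSubsets n)

∈-allSubsets : (e : Subset n) → e ∈ allSubsets n
∈-allSubsets []            = here refl
∈-allSubsets (inside  ∷ e) = ∈-++⁺ˡ (∈-map⁺ _ (∈-allSubsets e))
∈-allSubsets (outside ∷ e) = ∈-++⁺ʳ _ (∈-map⁺ _ (∈-allSubsets e))

allSubsets-unique : ∀ n → Unique (allSubsets n)
allSubsets-unique zero    = [] ∷ []
allSubsets-unique (suc n) = Uniqueₚ.++⁺ (Uniqueₚ.map⁺ (cong Vec.tail) (allSubsets-unique n))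
                                        (Uniqueₚ.map⁺ (cong Vec.tail) (allSubsets-unique n)) disjoint
  where
  disjoint : ∀ {e} → ¬ (e ∈ map (inside ∷_) (allSubsets n) × e ∈ map (outside ∷_) (allSubsets n))
  disjoint (p , q) with ∈-map⁻ _ p | ∈-map⁻ _ q
  ... | _ , _ , refl | _ , _ , ()

_≟ₛ_ : (e f : Subset n) → Dec (e ≡ f)
_≟ₛ_ = Vecₚ.≡-dec Bool._≟_

_∈ₗ?_ : (e : Subset n) (es : List (Subset n)) → Dec (e ∈ es)
e ∈ₗ? es = Any.any? (e ≟ₛ_) es

count : {P : A → Set} → Decidable P → List A → ℕ
count P? xs = length (filter P? xs)

count-↭ : {P : A → Set} (P? : Decidable P) {xs ys : List A} → xs ↭ ys → count P? xs ≡ count P? ys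
count-↭ P? p = ↭ₚ.↭-length (↭ₚ.filter-↭ P? p)

count-++ : {P : A → Set} (P? : Decidable P) (xs ys : List A) → count P? (xs ++ ys) ≡ count P? xs + count P? ys
count-++ P? xs ys = trans (cong length (filter-++ P? xs ys)) (length-++ (filter P? xs))

count-none : {P : A → Set} (P? : Decidable P) {xs : List A} → All (¬_ ∘ P) xs → count P? xs ≡ 0
count-none P? ps = cong length (filter-none P? ps)

count-take : {P : A → Set} (P? : Decidable P) (m : ℕ) (xs : List A) → count P? (take m xs) ≤ count P? xs
count-take P? m xs = ≤-trans (m≤m+n _ _) (≤-reflexive (trans (sym (count-++ P? (take m xs) (drop m xs)))
                                                          (cong (count P?) (take++drop≡id m xs))))

count-not-all : {P : A → Set} (P? : Decidable P) {xs : List A} → Any (¬_ ∘ P) xs → count P? xs < length xs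
count-not-all P? {xs} p = Listₚ.filter-notAll P? xs p

unique-⊆⇒escape : {P : A → Set} (P? : Decidable P) {xs ys : List A} → Unique ys → (∀ {x} → x ∈ ys → x ∈ xs) →
                  count P? xs < length ys → Any (¬_ ∘ P) ys
unique-⊆⇒escape P? {xs} {ys} u s lt with Any.any? (¬? ∘ P?) ys
... | yes p = p
... | no ¬p = contradiction (unique-⊆⇒length≤ u λ {x} x∈ → ∈-filter⁺ P? (s x∈)
                (decidable-stable (P? x) λ ¬px → ¬p (lose x∈ ¬px))) (<⇒≱ lt)

-- A missing `x` could be added to `ys`, giving more distinct `P`-elements of `xs` than `count`
-- permits. This serves the critical gadget edges with exactly `ℓ` vertices outside the gadget.
unique-⊆⇒exhaust : {P : A → Set} (P? : Decidable P) (_≟_ : (x y : A) → Dec (x ≡ y)) {xs ys : List A} → Unique xs → Unique ys →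
                   (∀ {x} → x ∈ ys → x ∈ xs) → All P ys → count P? xs ≤ length ys → ∀ {x} → x ∈ xs → P x → x ∈ ys
unique-⊆⇒exhaust P? _≟_ {xs} {ys} uxs uys s all le {x} x∈ px with Any.any? (x ≟_) ys
... | yes p = p
... | no x∉ = contradiction (unique-⊆⇒length≤ {xs = x ∷ ys} (Allₚ.¬Any⇒All¬ ys x∉ ∷ uys)
                (λ { (here refl) → ∈-filter⁺ P? x∈ px ; (there y∈) → ∈-filter⁺ P? (s y∈) (All.lookup all y∈) })) (<⇒≱ (s≤s le))

∈-take : ∀ m {xs : List A} {x} → x ∈ take m xs → x ∈ xs
∈-take m {xs} x∈ = subst (_ ∈_) (take++drop≡id m xs) (∈-++⁺ˡ x∈)

take-++-≤ : ∀ m (xs ys : List A) → m ≤ length xs → take m (xs ++ ys) ≡ take m xs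
take-++-≤ zero    xs       ys le       = refl
take-++-≤ (suc m) (x ∷ xs) ys (s≤s le) = cong (x ∷_) (take-++-≤ m xs ys le)

drop-++-≤ : ∀ m (xs ys : List A) → m ≤ length xs → drop m (xs ++ ys) ≡ drop m xs ++ ys
drop-++-≤ zero    xs       ys le       = refl
drop-++-≤ (suc m) (x ∷ xs) ys (s≤s le) = drop-++-≤ m xs ys le

drop-length-++ : (xs ys : List A) → drop (length xs) (xs ++ ys) ≡ ys
drop-length-++ []       ys = refl
drop-length-++ (x ∷ xs) ys = drop-length-++ xs ys

take-length-++ : (xs ys : List A) → take (length xs) (xs ++ ys) ≡ xs
take-length-++ []       ys = refl
take-length-++ (x ∷ xs) ys = cong (x ∷_) (take-length-++ xs ys)

length-take-≤ : ∀ m (xs : List A) → m ≤ length xs → length (take m xs) ≡ m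
length-take-≤ m xs le = trans (length-take m xs) (m≤n⇒m⊓n≡m le)

pick-outside : (_≟_ : (x y : A) → Dec (x ≡ y)) {xs : List A} (ys : List A) → Unique xs → ∀ m → m + length ys ≤ length xs →
               ∃ λ zs → length zs ≡ m × Unique zs × (∀ {z} → z ∈ zs → z ∈ xs × z ∉ ys)
pick-outside _≟_ {xs} ys u m le = take m free , length-take-≤ m free enough , Uniqueₚ.take⁺ m (Uniqueₚ.filter⁺ free? u) , λ z∈ →
    ∈-filter⁻ free? {xs = xs} (∈-take m z∈)
  where
  free? : Decidable (_∉ ys)
  free? x = ¬? (Any.any? (x ≟_) ys)
  free = filter free? xs
  place : ∀ {x} → x ∈ xs → x ∈ free ++ ys
  place {x} x∈ with Any.any? (x ≟_) ys
  ... | yes p = ∈-++⁺ʳ free p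
  ... | no ¬p = ∈-++⁺ˡ (∈-filter⁺ free? x∈ ¬p)
  enough : m ≤ length free
  enough = +-cancelʳ-≤ (length ys) m _ (≤-trans le (≤-trans (unique-⊆⇒length≤ u place) (≤-reflexive (length-++ free))))

-- Pigeonhole. It finds a row or a column of a gadget that the new edge avoids.
fresh-key : {P : A → Set} (P? : Decidable P) (f : A → ℕ) (es : List A) (m : ℕ) → length (filter P? es) < m →
            ∃ λ j → j < m × (∀ {x} → x ∈ es → P x → f x ≢ j)
fresh-key {P = P} P? f es m lt with anyUpTo? (λ j → All.all? (λ x → P? x →-dec ¬? (f x ≟ j)) es) m
... | yes (j , j< , all) = j , j< , λ x∈ → All.lookup all x∈
... | no none = contradiction (subst₂ _≤_ (length-upTo m) (length-map f (filter P? es)) (unique-⊆⇒length≤ (Uniqueₚ.upTo⁺ m) taken)) (<⇒≱ lt)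
  where
  taken : ∀ {j} → j ∈ upTo m → j ∈ map f (filter P? es)
  taken {j} j∈ with Allₚ.¬All⇒Any¬ (λ x → P? x →-dec ¬? (f x ≟ j)) es (λ all → none (j , ∈-upTo⁻ j∈ , all))
  ... | p with find p
  ...   | x , x∈ , ¬imp with P? x | f x ≟ j
  ...     | no ¬px | _      = contradiction (λ px → contradiction px ¬px) ¬imp
  ...     | yes _  | no ≢j  = contradiction (λ _ → ≢j) ¬imp
  ...     | yes px | yes refl = ∈-map⁺ f (∈-filter⁺ P? x∈ px)

-- Decidability and greedy saturation

injective⇒surjective : ∀ {n} (f : Fin n → Fin n) → Injective _≡_ _≡_ f → ∀ y → ∃ λ x → f x ≡ y
injective⇒surjective {n} f inj y with any? (λ x → f x ≟ᶠ y)
... | yes p = p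
... | no ¬p = contradiction
        (unique-⊆⇒length≤ {xs = y ∷ map f (allFin n)} {allFin n}
          (Allₚ.¬Any⇒All¬ _ (λ y∈ → let (x , _ , eq) = ∈-map⁻ f y∈ in ¬p (x , sym eq)) ∷ Uniqueₚ.map⁺ inj (Uniqueₚ.allFin⁺ n))
          (λ {x} _ → ∈-allFin x))
        (<⇒≱ (s≤s (≤-reflexive (sym (length-map f (allFin n))))))

anyVec? : ∀ {A : Set} → (∀ {P : A → Set} → Decidable P → Dec (∃ P)) →
          ∀ m {P : Vec A m → Set} → Decidable P → Dec (∃ P)
anyVec? any zero    P? = map′ (λ p → [] , p) (λ { ([] , p) → p }) (P? [])
anyVec? any (suc m) P? = map′ (λ { (x , xs , p) → x ∷ xs , p }) (λ { (x ∷ xs , p) → x , xs , p })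
                              (any λ x → anyVec? any m λ xs → P? (x ∷ xs))

allSubset? : ∀ {n} {P : Subset n → Set} → Decidable P → Dec (∀ e → P e)
allSubset? P? with anySubset? (¬? ∘ P?)
... | yes (e , ¬p) = no λ all → ¬p (all e)
... | no ¬∃        = yes λ e → decidable-stable (P? e) λ ¬p → ¬∃ (e , ¬p)

least : {P : ℕ → Set} → Decidable P → ∀ m → P m → ∃ λ l → P l × l ≤ m × (∀ {i} → P i → l ≤ i)
least {P} P? m pm = go m 0 (λ _ → z≤n) (subst P (sym (+-identityʳ m)) pm)
  where
  go : ∀ j i → (∀ {x} → P x → i ≤ x) → P (j + i) → ∃ λ l → P l × l ≤ m × (∀ {x} → P x → l ≤ x)
  go j i lower p with P? i
  ... | yes pi = i , pi , lower pm , lower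
  go zero    i lower p | no ¬pi = contradiction p ¬pi
  go (suc j) i lower p | no ¬pi =
    go j (suc i) (λ px → ≤∧≢⇒< (lower px) λ { refl → ¬pi px }) (subst P (sym (+-suc j i)) p)

-- Hamiltonian cycles as finite data, minimal size, greedy addition of edges

cycleEdge : ∀ {n} (k d : ℕ) {s : ℕ} .{{_ : NonZero s}} → (Fin s → Fin n) → ℕ → Subset n
cycleEdge k d {s} v t = ⋃ (map (λ i → ⁅ v ((t * d + i) mod s) ⁆) (upTo k))

cycleEdge-cong : ∀ {n} (k d : ℕ) {s : ℕ} .{{_ : NonZero s}} {v w : Fin s → Fin n} → (∀ i → v i ≡ w i) →
                 ∀ t → cycleEdge k d v t ≡ cycleEdge k d w t
cycleEdge-cong k d eq t = cong ⋃ (map-cong (λ i → cong ⁅_⁆ (eq _)) (upTo k))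

module Saturation (n k ℓ q : ℕ) {{_ : NonZero n}} {{_ : NonZero (k ∸ ℓ)}} (k≤n : k ≤ n) (n≡ : n ≡ q * (k ∸ ℓ)) where

  -- A hamiltonian cycle with `s` fixed to `n` and the function `v` stored as a vector, so that its
  -- existence is decided by a finite search.
  HamiltonianOrder : List (Subset n) → Vec (Fin n) n → Set
  HamiltonianOrder es w = Injective _≡_ _≡_ (Vec.lookup w) × (∀ (t : Fin q) → cycleEdge k (k ∸ ℓ) (Vec.lookup w) (toℕ t) ∈ es)

  toOrder : (H : KGraph n k) → Hamiltonian ℓ H → ∃ (HamiltonianOrder (edges H))
  toOrder H (c , contained , spanning) = fromSpanning s≡n (Cycle.nonZero c) (Cycle.k∸ℓ∣s c) (Cycle.v c) (Cycle.distinct c) contained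
    where
    s≡n : Cycle.s c ≡ n
    s≡n = ≤-antisym (injective⇒≤ (Cycle.distinct c))
            (injective⇒≤ {f = λ x → proj₁ (spanning x)} λ {x} {y} eq →
              trans (sym (proj₂ (spanning x))) (trans (cong (Cycle.v c) eq) (proj₂ (spanning y))))
    -- The length `s` is generalised together with everything that depends on it, so that the
    -- equation with `n` can be matched with `refl`.
    fromSpanning : ∀ {s} → s ≡ n → (nz : NonZero s) (div : (k ∸ ℓ) ∣ s) (v : Fin s → Fin n) → Injective _≡_ _≡_ v →
             (∀ (t : Fin (quotient div)) → cycleEdge k (k ∸ ℓ) {{nz}} v (toℕ t) ∈ edges H) → ∃ (HamiltonianOrder (edges H))
    fromSpanning refl nz (divides q′ eq) v inj cont = Vec.tabulate v ,
      (λ {x} {y} e → inj (trans (sym (Vecₚ.lookup∘tabulate v x)) (trans e (Vecₚ.lookup∘tabulate v y)))) ,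
      λ t → subst (_∈ edges H)
              (trans (cong (cycleEdge k (k ∸ ℓ) {{nz}} v) (toℕ-fromℕ< (t<q′ t)))
                     (cycleEdge-cong k (k ∸ ℓ) {{nz}} (λ i → sym (Vecₚ.lookup∘tabulate v i)) (toℕ t)))
              (cont (fromℕ< (t<q′ t)))
      where
      t<q′ : ∀ (t : Fin q) → toℕ t < q′
      t<q′ t = subst (toℕ t <_) (*-cancelʳ-≡ q q′ (k ∸ ℓ) (trans (sym n≡) eq)) (toℕ<n t)

  fromOrder : (H : KGraph n k) → ∃ (HamiltonianOrder (edges H)) → Hamiltonian ℓ H
  fromOrder H (w , inj , cont) =
    record { s = n ; k≤s = k≤n ; k∸ℓ∣s = divides q n≡ ; v = Vec.lookup w ; distinct = inj } ,
    cont , injective⇒surjective (Vec.lookup w) inj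

  hamiltonian? : (H : KGraph n k) → Dec (Hamiltonian ℓ H)
  hamiltonian? H = map′ (fromOrder H) (toOrder H) (anyVec? any? n λ w →
    map′ (λ p {x} {y} → p x y) (λ p x y → p) (all? λ x → all? λ y → (Vec.lookup w x ≟ᶠ Vec.lookup w y) →-dec (x ≟ᶠ y))
    ×-dec all? λ t → cycleEdge k (k ∸ ℓ) (Vec.lookup w) (toℕ t) ∈ₗ? edges H)

  hamiltonian-mono : (G H : KGraph n k) → (∀ {e} → e ∈ edges G → e ∈ edges H) → Hamiltonian ℓ G → Hamiltonian ℓ H
  hamiltonian-mono G H sub (c , cont , span) = c , sub ∘ cont , span

  saturated? : (H : KGraph n k) → Dec (HamiltonianSaturated ℓ H)
  saturated? H = ¬? (hamiltonian? H) ×-dec allSubset? addable?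
    where
    addable? : ∀ e → Dec (∀ (∣e∣≡k : ∣ e ∣ ≡ k) (e∉H : e ∉ edges H) → Hamiltonian ℓ (addEdge H e ∣e∣≡k e∉H))
    addable? e with ∣ e ∣ ≟ k | e ∈ₗ? edges H
    ... | no ≢k | _     = yes λ eq → contradiction eq ≢k
    ... | yes _ | yes p = yes λ _ e∉ → contradiction p e∉
    ... | yes p | no e∉ = map′ (λ h p′ e∉′ → hamiltonian-mono (addEdge H e p e∉) (addEdge H e p′ e∉′) id h) (λ f → f p e∉)
                            (hamiltonian? (addEdge H e p e∉))

  saturatedOfSize? : ∀ m → Dec (Σ (KGraph n k) λ H → HamiltonianSaturated ℓ H × size H ≡ m)
  saturatedOfSize? m = map′ to from (anyVec? anySubset? m λ es →
                         graph? (Vec.toList es))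
    where
    IsGraph : List (Subset n) → Set
    IsGraph es = Σ (All (λ e → ∣ e ∣ ≡ k) es) λ u → Σ (Unique es) λ s →
                   HamiltonianSaturated ℓ (record { edges = es ; uniform = u ; simple = s })
    -- Hamiltonicity looks at `edges` only, so the proofs of uniformity and simplicity may be
    -- exchanged.
    saturated-irr : (G H : KGraph n k) → edges G ≡ edges H → HamiltonianSaturated ℓ G → HamiltonianSaturated ℓ H
    saturated-irr G H refl (¬ham , add) =
      (¬ham ∘ hamiltonian-mono H G id) ,
      λ e p e∉ → hamiltonian-mono (addEdge G e p e∉) (addEdge H e p e∉) id (add e p e∉)
    unique? : (es : List (Subset n)) → Dec (Unique es)
    unique? = AllPairs.allPairs? λ e f → ¬? (e ≟ₛ f)
    graph? : ∀ es → Dec (IsGraph es)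
    graph? es with All.all? (λ e → ∣ e ∣ ≟ k) es | unique? es
    ... | no ¬u | _     = no (¬u ∘ proj₁)
    ... | yes _ | no ¬s = no (¬s ∘ proj₁ ∘ proj₂)
    ... | yes u | yes s = map′ (λ h → u , s , h)
      (λ (u′ , s′ , h) → saturated-irr (record { edges = es ; uniform = u′ ; simple = s′ }) (record { edges = es ; uniform = u ; simple = s }) refl h)
      (saturated? (record { edges = es ; uniform = u ; simple = s }))
    to : ∃ (λ es → IsGraph (Vec.toList {n = m} es)) → Σ (KGraph n k) λ H → HamiltonianSaturated ℓ H × size H ≡ m
    to (es , u , s , h) = record { edges = Vec.toList es ; uniform = u ; simple = s } , h , Vecₚ.length-toList es
    from : (Σ (KGraph n k) λ H → HamiltonianSaturated ℓ H × size H ≡ m) → ∃ (λ es → IsGraph (Vec.toList {n = m} es))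
    from (H , h , refl) = Vec.fromList (edges H) , subst IsGraph (sym (Vecₚ.toList∘fromList (edges H)))
      (uniform H , simple H , h)

  -- `IsSat` asks for an attained minimum. It exists constructively because it is decidable whether
  -- a saturated graph of a given size exists.
  isSat-≤ : (H : KGraph n k) → HamiltonianSaturated ℓ H → ∃ λ m → IsSat n k ℓ m × m ≤ size H
  isSat-≤ H h with least saturatedOfSize? (size H) (H , h , refl)
  ... | m , (G , g , eq) , m≤ , min = m , ((G , g , eq) , λ F f → min (F , f , refl)) , m≤

  -- Only bad edges need to be added greedily: every other missing edge already closes a cycle in G.
  saturate : {Bad : Subset n → Set} → Decidable Bad → (G : KGraph n k) → ¬ Hamiltonian ℓ G → All Bad (edges G) →
             (∀ e (∣e∣≡k : ∣ e ∣ ≡ k) (e∉G : e ∉ edges G) → ¬ Bad e → Hamiltonian ℓ (addEdge G e ∣e∣≡k e∉G)) →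
             Σ (KGraph n k) λ H → HamiltonianSaturated ℓ H × All Bad (edges H)
  saturate {Bad} bad? G ¬hamG badG good = H , (¬hamH , addable) , badH
    where
    -- The invariant of the greedy process after the sets in `es` were examined. Its last clause
    -- survives later additions, since hamiltonicity is monotone in the edges.
    Extension : List (Subset n) → Set
    Extension es = Σ (KGraph n k) λ H → (¬ Hamiltonian ℓ H) × All Bad (edges H) × (∀ {e} → e ∈ edges G → e ∈ edges H) ×
      (∀ {e} → e ∈ es → Bad e → ∀ (p : ∣ e ∣ ≡ k) (e∉ : e ∉ edges H) → Hamiltonian ℓ (addEdge H e p e∉))
    extend : ∀ es → Extension es
    extend [] = G , ¬hamG , badG , id , λ ()
    extend (e ∷ es) with extend es
    ... | H , ¬ham , badH , sub , done with bad? e | ∣ e ∣ ≟ k | e ∈ₗ? edges H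
    ...   | no ¬b | _     | _      = H , ¬ham , badH , sub , λ { (here refl) b → contradiction b ¬b ; (there e∈) → done e∈ }
    ...   | yes _ | no ≢k | _      = H , ¬ham , badH , sub , λ { (here refl) _ p → contradiction p ≢k ; (there e∈) → done e∈ }
    ...   | yes _ | yes _ | yes e∈ = H , ¬ham , badH , sub , λ { (here refl) _ _ e∉ → contradiction e∈ e∉ ; (there f∈) → done f∈ }
    ...   | yes b | yes p | no e∉ with hamiltonian? (addEdge H e p e∉)
    ...     | yes ham = H , ¬ham , badH , sub ,
                λ { (here refl) _ p′ e∉′ → hamiltonian-mono (addEdge H e p e∉) (addEdge H e p′ e∉′) id ham ; (there f∈) → done f∈ }
    ...     | no ¬ham′ = addEdge H e p e∉ , ¬ham′ , b ∷ badH , there ∘ sub ,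
                λ { (here refl) _ _ e∉′ → contradiction (here refl) e∉′
                  ; {f} (there f∈) bf p′ f∉ → hamiltonian-mono (addEdge H f p′ (f∉ ∘ there)) (addEdge (addEdge H e p e∉) f p′ f∉)
                      (λ { (here refl) → here refl ; (there g∈) → there (there g∈) }) (done f∈ bf p′ (f∉ ∘ there)) }
    ext = extend (allSubsets n)
    H = proj₁ ext
    ¬hamH = proj₁ (proj₂ ext)
    badH = proj₁ (proj₂ (proj₂ ext))
    addable : ∀ e (p : ∣ e ∣ ≡ k) (e∉ : e ∉ edges H) → Hamiltonian ℓ (addEdge H e p e∉)
    addable e p e∉ with bad? e
    ... | yes b = proj₂ (proj₂ (proj₂ (proj₂ ext))) (∈-allSubsets e) b p e∉
    ... | no ¬b = hamiltonian-mono (addEdge G e p e∉G) (addEdge H e p e∉)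
                    (λ { (here refl) → here refl ; (there f∈) → there (sub f∈) }) (good e p e∉G ¬b)
      where
      sub : ∀ {f} → f ∈ edges G → f ∈ edges H
      sub = proj₁ (proj₂ (proj₂ (proj₂ ext)))
      e∉G : e ∉ edges G
      e∉G = e∉ ∘ sub

-- The edges of a cycle

digits-unique : ∀ d {t t′ o o′} → o < d → o′ < d → t * d + o ≡ t′ * d + o′ → t ≡ t′ × o ≡ o′
digits-unique d {zero}  {zero}   o< o<′ eq = refl , eq
digits-unique d {zero}  {suc t′} {o} o< o<′ eq = contradiction (subst (d ≤_) (sym eq) (≤-trans (m≤m+n d (t′ * d)) (m≤m+n _ _))) (<⇒≱ o<)
digits-unique d {suc t} {zero}   {o} {o′} o< o<′ eq = contradiction (subst (d ≤_) eq (≤-trans (m≤m+n d (t * d)) (m≤m+n _ _))) (<⇒≱ o<′)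
digits-unique d {suc t} {suc t′} {o} {o′} o< o<′ eq with digits-unique d {t} {t′} o< o<′
    (+-cancelˡ-≡ d _ _ (trans (sym (+-assoc d (t * d) o)) (trans eq (+-assoc d (t′ * d) o′))))
... | refl , eq′ = refl , eq′

digits-< : ∀ d {q t o} → t < q → o < d → t * d + o < q * d
digits-< d {q} {t} {o} t<q o<d = <-≤-trans (+-monoʳ-< (t * d) o<d)
  (≤-trans (≤-reflexive (+-comm (t * d) d)) (*-monoˡ-≤ d t<q))

next : ℕ → ℕ → ℕ
next q t with suc t ≟ q
... | yes _ = 0
... | no  _ = suc t

next-< : ∀ {q t} → t < q → next q t < q
next-< {q} {t} t<q with suc t ≟ q
... | yes _ = ≤-trans (s≤s z≤n) t<q
... | no ≢q = ≤∧≢⇒< t<q ≢q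

next-injective : ∀ q {t t′} → next q t ≡ next q t′ → t ≡ t′
next-injective q {t} {t′} eq with suc t ≟ q | suc t′ ≟ q
... | yes p | yes p′ = suc-injective (trans p (sym p′))
... | no _  | no _   = suc-injective eq

next≢ : ∀ {q} → 2 ≤ q → ∀ t → next q t ≢ t
next≢ {q} 2≤q t with suc t ≟ q
... | yes refl = λ { refl → contradiction 2≤q λ { (s≤s ()) } }
... | no _     = 1+n≢n

next-last : ∀ {q t} → suc t ≡ q → next q t ≡ 0
next-last {q} {t} eq with suc t ≟ q
... | yes _ = refl
... | no ≢q = contradiction eq ≢q

next≡0⇒last : ∀ {q t} → next q t ≡ 0 → q ≡ suc t
next≡0⇒last {q} {t} eq with suc t ≟ q
... | yes p = sym p

next-suc : ∀ {q t} → suc t < q → next q t ≡ suc t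
next-suc {q} {t} lt with suc t ≟ q
... | yes refl = contradiction lt (<-irrefl refl)
... | no _     = refl

previous : ∀ {q t} → t < q → ∃ λ t′ → t′ < q × next q t′ ≡ t
previous {suc q} {zero}  _  = q , ≤-refl , next-last refl
previous {q}     {suc t} lt = t , <-trans (n<1+n t) lt , next-suc lt

module Windows {n : ℕ} (ℓ d : ℕ) (2≤ℓ : 2 ≤ ℓ) (ℓ<d : ℓ < d) (q s : ℕ) {{_ : NonZero s}} (s≡ : s ≡ q * d) (2≤q : 2 ≤ q)
               (v : Fin s → Fin n) (inj : Injective _≡_ _≡_ v) where

  at : ℕ → ℕ → Fin n
  at t o = v ((t * d + o) mod s)

  E : ℕ → Subset n
  E = cycleEdge (d + ℓ) d v

  toℕ-mod : ∀ p → toℕ (p mod s) ≡ p % s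
  toℕ-mod p = toℕ-fromℕ< (m%n<n p s)

  at-suc : ∀ t o → at (suc t) o ≡ at (next q t) o
  at-suc t o with suc t ≟ q
  ... | no _ = refl
  ... | yes refl = cong v (toℕ-injective (trans (toℕ-mod _) (trans wrap (sym (toℕ-mod _)))))
    where
    wrap : (suc t * d + o) % s ≡ (0 * d + o) % s
    wrap = trans (cong (_% s) (trans (cong (_+ o) (trans (sym s≡) (sym (*-identityˡ s)))) (+-comm (1 * s) o))) ([m+kn]%n≡m%n o 1 s)

  at-injective : ∀ t t′ {o o′} → t < q → t′ < q → o < d → o′ < d → at t o ≡ at t′ o′ → t ≡ t′ × o ≡ o′
  at-injective t t′ {o} {o′} t< t<′ o< o<′ eq = digits-unique d o< o<′
    (trans (sym (small t< o<)) (trans (trans (sym (toℕ-mod _)) (trans (cong toℕ (inj eq)) (toℕ-mod _))) (small t<′ o<′)))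
    where
    small : ∀ {t o} → t < q → o < d → (t * d + o) % s ≡ t * d + o
    small t< o< = m<n⇒m%n≡m (subst (_ <_) (sym s≡) (digits-< d t< o<))

  window : ℕ → List (Fin n)
  window t = map (λ i → v ((t * d + i) mod s)) (upTo (d + ℓ))

  E≡ : ∀ t → E t ≡ setOf (window t)
  E≡ t = cong ⋃ (map-∘ {g = ⁅_⁆} (upTo (d + ℓ)))

  -- The vertices are cut into `q` blocks of length `d`. An edge is its own block followed by the
  -- first `ℓ < d` vertices of the next block.
  data InWindow (t : ℕ) (x : Fin n) : Set where
    left  : ∀ o → o < d → at t o ≡ x → InWindow t x
    right : ∀ o → o < ℓ → at (suc t) o ≡ x → InWindow t x

  shift : ∀ t o → t * d + (d + o) ≡ suc t * d + o
  shift t o = trans (sym (+-assoc (t * d) d o)) (cong (_+ o) (+-comm (t * d) d))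

  E⁻ : ∀ t {x} → x ∈ₛ E t → InWindow t x
  E⁻ t {x} x∈ with ∈-map⁻ _ (∈-setOf⁻ (window t) (subst (x ∈ₛ_) (E≡ t) x∈))
  ... | i , i∈ , refl with i <? d
  ...   | yes i<d = left i i<d refl
  ...   | no i≮d = right (i ∸ d) (subst (i ∸ d <_) (m+n∸m≡n d ℓ) (∸-monoˡ-< (∈-upTo⁻ i∈) (≮⇒≥ i≮d)))
                     (cong (λ p → v (p mod s)) (trans (sym (shift t (i ∸ d))) (cong (t * d +_) (m+[n∸m]≡n (≮⇒≥ i≮d)))))

  E⁺ : ∀ t {x} → InWindow t x → x ∈ₛ E t
  E⁺ t (left o o<d refl) = subst (_ ∈ₛ_) (sym (E≡ t)) (∈-setOf⁺ (∈-map⁺ _ (∈-upTo⁺ (≤-trans o<d (m≤m+n d ℓ)))))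
  E⁺ t (right o o<ℓ refl) = subst (_ ∈ₛ_) (sym (E≡ t)) (∈-setOf⁺
    (subst (_∈ window t) (cong (λ p → v (p mod s)) (shift t o)) (∈-map⁺ _ (∈-upTo⁺ (+-monoʳ-< d o<ℓ)))))

  ℓ⇒d : ∀ {o} → o < ℓ → o < d
  ℓ⇒d o< = <-trans o< ℓ<d

  other : ∀ o → ∃ λ o′ → o′ < ℓ × o′ ≢ o
  other zero    = 1 , 2≤ℓ , λ ()
  other (suc o) = 0 , ≤-trans (s≤s z≤n) 2≤ℓ , λ ()

  -- Edges of the cycle that meet share ℓ ≥ 2 consecutive vertices.
  meet-twice : ∀ {t t′ x} → t < q → t′ < q → t ≢ t′ → x ∈ₛ E t → x ∈ₛ E t′ → ∃ λ y → y ≢ x × y ∈ₛ E t × y ∈ₛ E t′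
  meet-twice {t} {t′} t< t<′ ≢ x∈ x∈′ with E⁻ t x∈ | E⁻ t′ x∈′
  ... | left o o< eq | left o′ o<′ eq′ = contradiction (proj₁ (at-injective t t′ t< t<′ o< o<′ (trans eq (sym eq′)))) ≢
  ... | right o o< eq | right o′ o<′ eq′ = contradiction (next-injective q (proj₁ (at-injective (next q t) (next q t′) (next-< t<) (next-< t<′) (ℓ⇒d o<) (ℓ⇒d o<′)
          (trans (sym (at-suc t o)) (trans (trans eq (sym eq′)) (at-suc t′ o′)))))) ≢
  ... | left o o< eq | right o′ o<′ eq′ with at-injective t (next q t′) t< (next-< t<′) o< (ℓ⇒d o<′) (trans (trans eq (sym eq′)) (at-suc t′ o′))
  ...   | refl , refl = let (r , r< , r≢) = other o in at t r ,
          (λ e → r≢ (proj₂ (at-injective t t t< t< (ℓ⇒d r<) o< (trans e (sym eq))))) , E⁺ t (left r (ℓ⇒d r<) refl) , E⁺ t′ (right r r< (at-suc t′ r))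
  meet-twice {t} {t′} t< t<′ ≢ x∈ x∈′ | right o o< eq | left o′ o<′ eq′ with at-injective (next q t) t′ (next-< t<) t<′ (ℓ⇒d o<) o<′ (trans (sym (at-suc t o)) (trans eq (sym eq′)))
  ...   | refl , refl = let (r , r< , r≢) = other o in at t′ r ,
          (λ e → r≢ (proj₂ (at-injective t′ t′ t<′ t<′ (ℓ⇒d r<) o<′ (trans e (sym eq′))))) , E⁺ t (right r r< (at-suc t r)) , E⁺ t′ (left r (ℓ⇒d r<) refl)

  -- The vertex at offset `ℓ` of block `t` comes after the `ℓ` vertices shared with the preceding
  -- edge, and by `ℓ < d` it is still in block `t`, so it belongs to edge `t` alone.
  private-vertex : ∀ {t t′} → t < q → t′ < q → t ≢ t′ → ∃ λ x → x ∈ₛ E t × x ∉ₛ E t′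
  private-vertex {t} {t′} t< t<′ ≢ = at t ℓ , E⁺ t (left ℓ ℓ<d refl) , λ x∈ → notIn (E⁻ t′ x∈)
    where
    notIn : ¬ InWindow t′ (at t ℓ)
    notIn (left o o< eq)  = ≢ (sym (proj₁ (at-injective t′ t t<′ t< o< ℓ<d eq)))
    notIn (right o o< eq) = <-irrefl (proj₂ (at-injective (next q t′) t (next-< t<′) t< (ℓ⇒d o<) ℓ<d (trans (sym (at-suc t′ o)) eq))) o<

  -- The overlap of edge `t` with the edge before it.
  shared : ℕ → List (Fin n)
  shared t = map (at t) (upTo ℓ)

  length-shared : ∀ t → length (shared t) ≡ ℓ
  length-shared t = trans (length-map (at t) (upTo ℓ)) (length-upTo ℓ)

  shared-unique : ∀ {t} → t < q → Unique (shared t)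
  shared-unique {t} t< = unique-map (at t) (λ o∈ o∈′ eq → proj₂ (at-injective t t t< t< (ℓ⇒d (∈-upTo⁻ o∈)) (ℓ⇒d (∈-upTo⁻ o∈′)) eq)) (Uniqueₚ.upTo⁺ ℓ)

  shared⊆right : ∀ t {x} → x ∈ shared t → x ∈ₛ E t
  shared⊆right t x∈ with ∈-map⁻ (at t) x∈
  ... | o , o∈ , refl = E⁺ t (left o (ℓ⇒d (∈-upTo⁻ o∈)) refl)

  shared⊆left : ∀ t {x} → x ∈ shared (next q t) → x ∈ₛ E t
  shared⊆left t x∈ with ∈-map⁻ (at (next q t)) x∈
  ... | o , o∈ , refl = E⁺ t (right o (∈-upTo⁻ o∈) (at-suc t o))

  shared-disjoint : ∀ t t′ {x} → t < q → t′ < q → t ≢ t′ → x ∈ shared t → x ∉ shared t′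
  shared-disjoint t t′ t< t<′ ≢ x∈ x∈′ with ∈-map⁻ (at t) x∈ | ∈-map⁻ (at t′) x∈′
  ... | o , o∈ , refl | o′ , o∈′ , eq = ≢ (proj₁ (at-injective t t′ t< t<′ (ℓ⇒d (∈-upTo⁻ o∈)) (ℓ⇒d (∈-upTo⁻ o∈′)) eq))

  covered : {{_ : NonZero d}} → ∀ i → ∃ λ t → t < q × v i ∈ₛ E t
  covered i = toℕ i / d , m<n*o⇒m/o<n (subst (toℕ i <_) s≡ (toℕ<n i)) , E⁺ (toℕ i / d) (left (toℕ i % d) (m%n<n (toℕ i) d)
    (cong v (toℕ-injective (trans (toℕ-mod _) (trans (cong (_% s) (trans (+-comm (toℕ i / d * d) _) (sym (m≡m%n+[m/n]*n (toℕ i) d)))) (m<n⇒m%n≡m (toℕ<n i)))))))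

-- Cycles from paths

module _ {A : Set} where

  applyUpTo-+ : (g : ℕ → A) (a b : ℕ) → applyUpTo g (a + b) ≡ applyUpTo g a ++ applyUpTo (g ∘ (a +_)) b
  applyUpTo-+ g zero    b = refl
  applyUpTo-+ g (suc a) b = cong (g 0 ∷_) (applyUpTo-+ (g ∘ suc) a b)

  applyUpTo-cong : {f g : ℕ → A} → (∀ i → f i ≡ g i) → ∀ m → applyUpTo f m ≡ applyUpTo g m
  applyUpTo-cong eq zero    = refl
  applyUpTo-cong eq (suc m) = cong₂ _∷_ (eq 0) (applyUpTo-cong (eq ∘ suc) m)

  drop-applyUpTo : (g : ℕ → A) (p m : ℕ) → drop p (applyUpTo g (p + m)) ≡ applyUpTo (g ∘ (p +_)) m
  drop-applyUpTo g zero    m = refl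
  drop-applyUpTo g (suc p) m = drop-applyUpTo (g ∘ suc) p m

  take-applyUpTo : (g : ℕ → A) (k m : ℕ) → take k (applyUpTo g (k + m)) ≡ applyUpTo g k
  take-applyUpTo g zero    m = refl
  take-applyUpTo g (suc k) m = cong (g 0 ∷_) (take-applyUpTo (g ∘ suc) k m)

  toList-applyUpTo : ∀ {n} (g : ℕ → A) (w : Vec A n) → (∀ i → g (toℕ i) ≡ Vec.lookup w i) → Vec.toList w ≡ applyUpTo g n
  toList-applyUpTo g []      eq = refl
  toList-applyUpTo g (x ∷ w) eq = cong₂ _∷_ (sym (eq zero)) (toList-applyUpTo (g ∘ suc) w (eq ∘ suc))

  lookup∈toList : ∀ {n} (w : Vec A n) j → Vec.lookup w j ∈ Vec.toList w
  lookup∈toList (x ∷ w) zero    = here refl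
  lookup∈toList (x ∷ w) (suc j) = there (lookup∈toList w j)

  lookup-injective : ∀ {n} (w : Vec A n) → Unique (Vec.toList w) → Injective _≡_ _≡_ (Vec.lookup w)
  lookup-injective (x ∷ w) (p ∷ u) {zero}  {zero}  eq = refl
  lookup-injective (x ∷ w) (p ∷ u) {zero}  {suc j} eq = contradiction eq (All.lookup p (lookup∈toList w j))
  lookup-injective (x ∷ w) (p ∷ u) {suc i} {zero}  eq = contradiction (sym eq) (All.lookup p (lookup∈toList w i))
  lookup-injective (x ∷ w) (p ∷ u) {suc i} {suc j} eq = cong suc (lookup-injective w u eq)

-- ℓ is the overlap of consecutive edges and c the number of private vertices of an edge.
module Paths {A : Set} (ℓ c : ℕ) (1≤ℓ : 1 ≤ ℓ) (E : List A → Set) where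

  d k : ℕ
  d = ℓ + c
  k = d + ℓ

  -- The middle list omits the initial `S`, so that composing paths concatenates these lists without
  -- repeating the common `ℓ` vertices.
  data Path : List A → List A → List A → Set where
    done : ∀ {S} → length S ≡ ℓ → Path S [] S
    step : ∀ {S I T xs U} → length S ≡ ℓ → length I ≡ c → E (S ++ I ++ T) → Path T xs U → Path S (I ++ T ++ xs) U

  start-length : ∀ {S xs U} → Path S xs U → length S ≡ ℓ
  start-length (done eq)         = eq
  start-length (step eq _ _ _)   = eq

  end-length : ∀ {S xs U} → Path S xs U → length U ≡ ℓ
  end-length (done eq)         = eq
  end-length (step _ _ _ p)    = end-length p

  ++-reassoc : (S I T xs : List A) → S ++ I ++ T ++ xs ≡ (S ++ I ++ T) ++ xs
  ++-reassoc S I T xs = sym (trans (++-assoc S (I ++ T) xs) (cong (S ++_) (++-assoc I T xs)))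

  length-edge : (S I T : List A) → length S ≡ ℓ → length I ≡ c → length T ≡ ℓ → length (S ++ I ++ T) ≡ k
  length-edge S I T s i t = trans (length-++ S) (trans (cong₂ _+_ s (trans (length-++ I) (cong₂ _+_ i t))) (sym (+-assoc ℓ c ℓ)))

  path-windows : ∀ {S xs U} → Path S xs U → ∀ t → suc t * d ≤ length xs → E (take k (drop (t * d) (S ++ xs)))
  path-windows (done _) t le = contradiction (≤-trans (≤-trans 1≤ℓ (m≤m+n ℓ c)) (≤-trans (m≤m+n d (t * d)) le)) λ ()
  path-windows (step {S} {I} {T} {xs} s i e p) zero le =
    subst E (sym (trans (cong (take k) (++-reassoc S I T xs))
      (trans (cong (λ m → take m ((S ++ I ++ T) ++ xs)) (sym (length-edge S I T s i (start-length p)))) (take-length-++ (S ++ I ++ T) xs)))) e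
  path-windows (step {S} {I} {T} {xs} s i e p) (suc t) le =
    subst E (cong (take k) (sym shifted)) (path-windows p t (+-cancelˡ-≤ d _ _ (≤-trans le (≤-reflexive len))))
    where
    ∣SI∣ : length (S ++ I) ≡ d
    ∣SI∣ = trans (length-++ S) (cong₂ _+_ s i)
    shifted : drop (suc t * d) (S ++ I ++ T ++ xs) ≡ drop (t * d) (T ++ xs)
    shifted = trans (cong₂ drop (+-comm d (t * d)) (sym (++-assoc S I (T ++ xs))))
              (trans (sym (drop-drop′ (t * d) d ((S ++ I) ++ T ++ xs)))
                     (cong (drop (t * d)) (trans (cong (λ m → drop m ((S ++ I) ++ T ++ xs)) (sym ∣SI∣)) (drop-length-++ (S ++ I) (T ++ xs)))))
      where
      drop-drop′ : ∀ a b (ys : List A) → drop a (drop b ys) ≡ drop (a + b) ys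
      drop-drop′ a b ys = trans (Listₚ.drop-drop b a ys) (cong (λ m → drop m ys) (+-comm b a))
    len : length (I ++ T ++ xs) ≡ d + length xs
    len = trans (length-++ I) (trans (cong₂ _+_ i (trans (length-++ T) (cong (_+ length xs) (start-length p))))
                (trans (sym (+-assoc c ℓ (length xs))) (cong (_+ length xs) (+-comm c ℓ))))

  _++ₚ_ : ∀ {S xs T ys U} → Path S xs T → Path T ys U → Path S (xs ++ ys) U
  done _ ++ₚ q = q
  _++ₚ_ {ys = ys} {U = U} (step {S} {I} {T} {xs} s i e p) q =
    subst (λ zs → Path S zs U) (sym (trans (++-assoc I (T ++ xs) ys) (cong (I ++_) (++-assoc T xs ys)))) (step s i e (p ++ₚ q))

  path-end : ∀ {S xs U} → Path S xs U → ∃ λ ws → S ++ xs ≡ ws ++ U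
  path-end {S} (done _) = [] , ++-identityʳ S
  path-end (step {S} {I} {T} s i e p) = let (ws , eq) = path-end p in
    (S ++ I) ++ ws , trans (sym (++-assoc S I _)) (trans (cong ((S ++ I) ++_) eq) (sym (++-assoc (S ++ I) ws _)))

  path-length : ∀ {S xs U} → Path S xs U → ∃ λ m → length xs ≡ m * d
  path-length (done _) = 0 , refl
  path-length (step {S} {I} {T} {xs} s i e p) = let (m , eq) = path-length p in suc m ,
    trans (length-++ I) (trans (cong₂ _+_ i (trans (length-++ T) (cong₂ _+_ (start-length p) eq)))
      (trans (sym (+-assoc c ℓ (m * d))) (cong (_+ m * d) (+-comm c ℓ))))

  module Reversal (E-↭ : ∀ {xs ys} → xs ↭ ys → E xs → E ys) where

    path-reverse : ∀ {S xs U} → Path S xs U → ∃ λ ys → Path U ys S × S ++ xs ↭ U ++ ys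
    path-reverse {S} (done s) = [] , done s , ↭-refl
    path-reverse (step {S} {I} {T} {xs} {U} s i e p) = let (ys , q , perm) = path-reverse p in
      ys ++ I ++ S ++ [] , q ++ₚ step (end-length q) i (E-↭ (++-flip S I T) e) (done s) , (begin
        S ++ I ++ T ++ xs          ↭⟨ ↭ₚ.++⁺ˡ S (↭ₚ.++⁺ˡ I perm) ⟩
        S ++ I ++ U ++ ys          ↭⟨ ↭ₚ.++⁺ˡ S (↭ₚ.++-comm I (U ++ ys)) ⟩
        S ++ (U ++ ys) ++ I        ↭⟨ ↭ₚ.++-comm S ((U ++ ys) ++ I) ⟩
        ((U ++ ys) ++ I) ++ S      ≡⟨ trans (++-assoc (U ++ ys) I S) (trans (++-assoc U ys (I ++ S)) (cong (λ zs → U ++ ys ++ I ++ zs) (sym (++-identityʳ S)))) ⟩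
        U ++ ys ++ I ++ S ++ []    ∎)
      where
      open PermutationReasoning

  -- In contrast to Path, windows at all offsets are considered, so that dense lists of any length can be glued together.
  Dense : List A → Set
  Dense []       = ⊤
  Dense (x ∷ xs) = (k ≤ suc (length xs) → E (take k (x ∷ xs))) × Dense xs

  dense-drop : ∀ m xs → Dense xs → Dense (drop m xs)
  dense-drop zero    xs       w       = w
  dense-drop (suc m) []       w       = w
  dense-drop (suc m) (x ∷ xs) (_ , w) = dense-drop m xs w

  dense-head : ∀ xs → k ≤ length xs → Dense xs → E (take k xs)
  dense-head []       le w       = contradiction (≤-trans 1≤ℓ (≤-trans (m≤n+m ℓ d) le)) λ ()
  dense-head (x ∷ xs) le (e , _) = e le

  -- A window of `k` vertices that starts in `xs` ends within `ys`, by the length of `ys`; all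
  -- others lie in `ys ++ zs`.
  dense-glue : ∀ xs ys zs → k ≤ length ys → Dense (xs ++ ys) → Dense (ys ++ zs) → Dense (xs ++ ys ++ zs)
  dense-glue []       ys zs le w w′ = w′
  dense-glue (x ∷ xs) ys zs le (e , w) w′ =
    (λ _ → subst E (trans (sym (take-++-≤ k (x ∷ xs ++ ys) zs fits)) (cong (λ us → take k (x ∷ us)) (++-assoc xs ys zs))) (e fits)) ,
    dense-glue xs ys zs le w w′
    where
    fits : k ≤ suc (length (xs ++ ys))
    fits = m≤n⇒m≤1+n (≤-trans le (≤-trans (m≤n+m _ (length xs)) (≤-reflexive (sym (length-++ xs)))))

  dense-all : (∀ xs → length xs ≡ k → E xs) → ∀ xs → Dense xs
  dense-all f []       = tt
  dense-all f (x ∷ xs) = (λ le → f (take k (x ∷ xs)) (length-take-≤ k (x ∷ xs) le)) , dense-all f xs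

  -- Among all windows only those at multiples of `d` are used: each step cuts `c` private and `ℓ`
  -- shared vertices off `ys`, until `ys` is the private part of the last edge.
  dense⇒path : ∀ m S ys U → length S ≡ ℓ → length U ≡ ℓ → length (ys ++ U) ≡ m * d → Dense (S ++ ys ++ U) → Path S (ys ++ U) U
  dense⇒path zero S ys U s u len w = contradiction (subst (1 ≤_) len (≤-trans 1≤ℓ (≤-trans (≤-reflexive (sym u))
                                       (≤-trans (m≤n+m (length U) (length ys)) (≤-reflexive (sym (length-++ ys))))))) λ ()
  dense⇒path (suc zero) S ys U s u len w =
    subst (λ zs → Path S zs U) (cong (ys ++_) (++-identityʳ U)) (step s ∣ys∣ (subst E all (dense-head _ (≤-reflexive (sym ∣all∣)) w)) (done u))
    where
    ∣ys∣ : length ys ≡ c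
    ∣ys∣ = +-cancelʳ-≡ ℓ (length ys) c (trans (cong (length ys +_) (sym u)) (trans (sym (length-++ ys)) (trans len (trans (+-identityʳ d) (+-comm ℓ c)))))
    ∣all∣ : length (S ++ ys ++ U) ≡ k
    ∣all∣ = length-edge S ys U s ∣ys∣ u
    all : take k (S ++ ys ++ U) ≡ S ++ ys ++ U
    all = take-all k _ (≤-reflexive ∣all∣)
  dense⇒path (suc (suc m)) S ys U s u len w =
    subst (λ zs → Path S zs U) split (step s ∣I∣ (subst E window (dense-head _ k≤ w)) (dense⇒path (suc m) T zs U ∣T∣ u len′ w′))
    where
    I = take c ys
    ys′ = drop c ys
    T = take ℓ ys′
    zs = drop ℓ ys′
    ∣ys∣≥ : d ≤ length ys
    ∣ys∣≥ = +-cancelʳ-≤ ℓ d (length ys) (begin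
      d + ℓ             ≤⟨ +-monoʳ-≤ d (≤-trans (m≤m+n ℓ c) (m≤m+n d (m * d))) ⟩
      d + (d + m * d)   ≡⟨ sym len ⟩
      length (ys ++ U)  ≡⟨ trans (length-++ ys) (cong (length ys +_) u) ⟩
      length ys + ℓ     ∎)
      where open ≤-Reasoning
    ∣I∣ : length I ≡ c
    ∣I∣ = length-take-≤ c ys (≤-trans (m≤n+m c ℓ) ∣ys∣≥)
    ∣ys′∣≥ : ℓ ≤ length ys′
    ∣ys′∣≥ = subst (ℓ ≤_) (sym (length-drop c ys)) (≤-trans (≤-reflexive (sym (m+n∸n≡m ℓ c))) (∸-monoˡ-≤ c ∣ys∣≥))
    ∣T∣ : length T ≡ ℓ
    ∣T∣ = length-take-≤ ℓ ys′ ∣ys′∣≥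
    ys≡ : I ++ T ++ zs ≡ ys
    ys≡ = trans (cong (I ++_) (take++drop≡id ℓ ys′)) (take++drop≡id c ys)
    split : I ++ T ++ zs ++ U ≡ ys ++ U
    split = trans (cong (I ++_) (sym (++-assoc T zs U))) (trans (sym (++-assoc I (T ++ zs) U)) (cong (_++ U) ys≡))
    whole : S ++ ys ++ U ≡ (S ++ I ++ T) ++ zs ++ U
    whole = trans (cong (S ++_) (sym split)) (++-reassoc S I T (zs ++ U))
    k≤ : k ≤ length (S ++ ys ++ U)
    k≤ = subst (λ us → k ≤ length us) (sym whole) (subst (k ≤_) (sym (length-++ (S ++ I ++ T)))
           (≤-trans (≤-reflexive (sym (length-edge S I T s ∣I∣ ∣T∣))) (m≤m+n _ _)))
    window : take k (S ++ ys ++ U) ≡ S ++ I ++ T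
    window = trans (cong₂ take (sym (length-edge S I T s ∣I∣ ∣T∣)) whole) (take-length-++ (S ++ I ++ T) (zs ++ U))
    w′ : Dense (T ++ zs ++ U)
    w′ = subst Dense (trans (cong₂ drop (sym ∣SI∣) whole′) (drop-length-++ (S ++ I) (T ++ zs ++ U))) (dense-drop d _ w)
      where
      ∣SI∣ : length (S ++ I) ≡ d
      ∣SI∣ = trans (length-++ S) (cong₂ _+_ s ∣I∣)
      whole′ : S ++ ys ++ U ≡ (S ++ I) ++ T ++ zs ++ U
      whole′ = trans (cong (S ++_) (sym split)) (sym (++-assoc S I (T ++ zs ++ U)))
    len′ : length (zs ++ U) ≡ suc m * d
    len′ = +-cancelˡ-≡ d _ _ (trans (sym (trans (cong length (sym split)) (trans (length-++ I) (cong₂ _+_ ∣I∣ (trans (length-++ T) (cong (_+ length (zs ++ U)) ∣T∣))) ■ reorder))) len)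
      where
      _■_ = trans
      reorder : c + (ℓ + length (zs ++ U)) ≡ d + length (zs ++ U)
      reorder = trans (sym (+-assoc c ℓ _)) (cong (_+ length (zs ++ U)) (+-comm c ℓ))

module CyclesFromPaths {n : ℕ} (ℓ c : ℕ) (1≤ℓ : 1 ≤ ℓ) (E : List (Fin n) → Set) (es : List (Subset n))
                       (E⇒∈ : ∀ {f} → Unique f → length f ≡ ℓ + c + ℓ → E f → setOf f ∈ es) where
  open Paths {Fin n} ℓ c 1≤ℓ E

  -- The list `S ++ xs` is `ws` followed by its own first `ℓ` vertices. Hence its windows at
  -- multiples of `d` are the windows of the cyclic order `ws`, the last one wrapping around.
  closedPath⇒order : {{_ : NonZero n}} (q : ℕ) → n ≡ q * d → k ≤ n → ∀ {S xs ws} → Path S xs S → S ++ xs ≡ ws ++ S → length ws ≡ n → Unique ws →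
    ∃ λ (w : Vec (Fin n) n) → Injective _≡_ _≡_ (Vec.lookup w) × (∀ (t : Fin q) → cycleEdge k d (Vec.lookup w) (toℕ t) ∈ es)
  closedPath⇒order q n≡ k≤n {S} {xs} {ws} path eq ∣ws∣ uws = w , inj , λ t → subst (_∈ es) (sym (edge≡ t)) (E⇒∈ (windowUnique t) (windowLength t) (path-windows path (toℕ t) (fits t)))
    where
    w : Vec (Fin n) n
    w = subst (Vec (Fin n)) ∣ws∣ (Vec.fromList ws)
    toList-subst : ∀ {m m′} (e : m ≡ m′) (u : Vec (Fin n) m) → Vec.toList (subst (Vec (Fin n)) e u) ≡ Vec.toList u
    toList-subst refl u = refl
    toList-w : Vec.toList w ≡ ws
    toList-w = trans (toList-subst ∣ws∣ (Vec.fromList ws)) (Vecₚ.toList∘fromList ws)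
    inj : Injective _≡_ _≡_ (Vec.lookup w)
    inj = lookup-injective w (subst Unique (sym toList-w) uws)
    g : ℕ → Fin n
    g p = Vec.lookup w (p mod n)
    toℕ-mod : ∀ p → toℕ (p mod n) ≡ p % n
    toℕ-mod p = toℕ-fromℕ< (m%n<n p n)
    ws≡ : ws ≡ applyUpTo g n
    ws≡ = trans (sym toList-w) (toList-applyUpTo g w λ i → cong (Vec.lookup w) (toℕ-injective (trans (toℕ-mod _) (m<n⇒m%n≡m (toℕ<n i)))))
    periodic : ∀ i → g (n + i) ≡ g i
    periodic i = cong (Vec.lookup w) (toℕ-injective (trans (toℕ-mod _) (trans
      (trans (cong (_% n) (trans (+-comm n i) (cong (i +_) (sym (*-identityˡ n))))) ([m+kn]%n≡m%n i 1 n)) (sym (toℕ-mod i)))))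
    ∣xs∣ : length xs ≡ n
    ∣xs∣ = +-cancelˡ-≡ (length S) _ _ (trans (sym (length-++ S)) (trans (cong length eq) (trans (length-++ ws) (trans (+-comm (length ws) (length S)) (cong (length S +_) ∣ws∣)))))
    1≤q : 1 ≤ q
    1≤q = n≢0⇒n>0 λ { refl → contradiction (subst (1 ≤_) n≡ (>-nonZero⁻¹ n)) λ () }
    ℓ≤n : ℓ ≤ n
    ℓ≤n = ≤-trans (m≤m+n ℓ c) (≤-trans (≤-reflexive (sym (*-identityˡ d))) (≤-trans (*-monoˡ-≤ d 1≤q) (≤-reflexive (sym n≡))))
    S≡ : S ≡ applyUpTo (g ∘ (n +_)) ℓ
    S≡ = trans (sym (take-length-++ S xs)) (trans (cong (take (length S)) eq) (trans (cong (λ m → take m (ws ++ S)) (start-length path))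
         (trans (take-++-≤ ℓ ws S (subst (ℓ ≤_) (sym ∣ws∣) ℓ≤n)) (trans (cong (take ℓ) ws≡)
         (trans (cong (λ m → take ℓ (applyUpTo g m)) (sym (m+[n∸m]≡n ℓ≤n))) (trans (take-applyUpTo g ℓ (n ∸ ℓ)) (applyUpTo-cong (sym ∘ periodic) ℓ)))))))
    whole : S ++ xs ≡ applyUpTo g (n + ℓ)
    whole = trans eq (trans (cong₂ _++_ ws≡ S≡) (sym (applyUpTo-+ g n ℓ)))
    fits : ∀ (t : Fin q) → suc (toℕ t) * d ≤ length xs
    fits t = ≤-trans (*-monoˡ-≤ d (toℕ<n t)) (≤-reflexive (trans (sym n≡) (sym ∣xs∣)))
    window≡ : ∀ (t : Fin q) → take k (drop (toℕ t * d) (S ++ xs)) ≡ map (λ i → g (toℕ t * d + i)) (upTo k)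
    window≡ t = trans (begin
        take k (drop p (S ++ xs))                    ≡⟨ cong (take k ∘ drop p) whole ⟩
        take k (drop p (applyUpTo g (n + ℓ)))        ≡⟨ cong (λ m → take k (drop p (applyUpTo g m))) size≡ ⟩
        take k (drop p (applyUpTo g (p + (k + r))))  ≡⟨ cong (take k) (drop-applyUpTo g p (k + r)) ⟩
        take k (applyUpTo (g ∘ (p +_)) (k + r))      ≡⟨ take-applyUpTo (g ∘ (p +_)) k r ⟩
        applyUpTo (g ∘ (p +_)) k                     ∎) (sym (Listₚ.map-upTo (λ i → g (p + i)) k))
      where
      open ≡-Reasoning
      p = toℕ t * d
      p+d≤n : p + d ≤ n
      p+d≤n = ≤-trans (≤-reflexive (+-comm p d)) (≤-trans (fits t) (≤-reflexive ∣xs∣))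
      r = n ∸ (p + d)
      size≡ : n + ℓ ≡ p + (k + r)
      size≡ = trans (cong (_+ ℓ) (sym (m+[n∸m]≡n p+d≤n))) (solver p d ℓ r)
        where
        solver : ∀ p d ℓ r → p + d + r + ℓ ≡ p + (d + ℓ + r)
        solver = solve-∀
    edge≡ : ∀ (t : Fin q) → cycleEdge k d (Vec.lookup w) (toℕ t) ≡ setOf (take k (drop (toℕ t * d) (S ++ xs)))
    edge≡ t = trans (cong ⋃ (map-∘ (upTo k))) (cong setOf (sym (window≡ t)))
    windowLength : ∀ (t : Fin q) → length (take k (drop (toℕ t * d) (S ++ xs))) ≡ k
    windowLength t = trans (cong length (window≡ t)) (trans (length-map _ (upTo k)) (length-upTo k))
    windowUnique : ∀ (t : Fin q) → Unique (take k (drop (toℕ t * d) (S ++ xs)))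
    windowUnique t = subst Unique (sym (window≡ t)) (unique-map _ (λ i∈ j∈ → either (∈-upTo⁻ i∈) (∈-upTo⁻ j∈)) (Uniqueₚ.upTo⁺ k))
      where
      p = toℕ t * d
      -- Equal vertices have positions congruent modulo `n`; the positions differ by less than
      -- `k ≤ n`, so they agree.
      same : ∀ {i j} → i ≤ j → j < k → g (p + i) ≡ g (p + j) → i ≡ j
      same {i} {j} i≤j j<k e = ≤-antisym i≤j (m∸n≡0⇒m≤n (trans (sym (m<n⇒m%n≡m (≤-<-trans (m∸n≤m j i) (<-≤-trans j<k k≤n)))) zero%))
        where
        residue : (p + i) % n ≡ (p + j) % n
        residue = trans (sym (toℕ-mod (p + i))) (trans (cong toℕ (inj e)) (toℕ-mod (p + j)))
        zero% : (j ∸ i) % n ≡ 0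
        zero% = trans (cong (_% n) (trans (sym ([m+n]∸[m+o]≡n∸o p j i)) refl)) (%-diff (p + i) (p + j) (+-monoʳ-≤ p i≤j) residue)
          where
          %-diff : ∀ a b → a ≤ b → a % n ≡ b % n → (b ∸ a) % n ≡ 0
          %-diff a b a≤b eq = trans (cong (_% n) diff) (m*n%n≡0 (b / n ∸ a / n) n)
            where
            diff : b ∸ a ≡ (b / n ∸ a / n) * n
            diff = trans (cong₂ _∸_ (m≡m%n+[m/n]*n b n) (m≡m%n+[m/n]*n a n))
                   (trans (cong (λ r → b % n + b / n * n ∸ (r + a / n * n)) eq)
                   (trans ([m+n]∸[m+o]≡n∸o (b % n) (b / n * n) (a / n * n)) (sym (*-distribʳ-∸ n (b / n) (a / n)))))
      either : ∀ {i j} → i < k → j < k → g (p + i) ≡ g (p + j) → i ≡ j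
      either {i} {j} i< j< e with ≤-total i j
      ... | inj₁ le = same le j< e
      ... | inj₂ le = sym (same le i< (sym e))

-- The graph

-- Without `t₀` the ring of positions is a path, along which `Q` travels in both directions.
module Spread (q : ℕ) (Q : ℕ → Set) (t₀ : ℕ)
              (forth : ∀ {t} → t < q → t ≢ t₀ → next q t ≢ t₀ → Q t → Q (next q t))
              (back  : ∀ {t} → t < q → t ≢ t₀ → next q t ≢ t₀ → Q (next q t) → Q t) where

  up : ∀ {a} m → a + m < q → (∀ {j} → a ≤ j → j ≤ a + m → j ≢ t₀) → Q a → Q (a + m)
  up {a} zero    lt avoid qa = subst Q (sym (+-identityʳ a)) qa
  up {a} (suc m) lt avoid qa = subst Q (trans nxt (sym (+-suc a m)))
      (forth (<-trans (n<1+n _) lt′) (avoid (m≤m+n a m) (+-monoʳ-≤ a (n≤1+n m)))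
             (subst (_≢ t₀) (sym nxt) (avoid (≤-trans (m≤m+n a m) (n≤1+n _)) (≤-reflexive (sym (+-suc a m)))))
             (up m (<-trans (n<1+n _) lt′) (λ a≤ j≤ → avoid a≤ (≤-trans j≤ (+-monoʳ-≤ a (n≤1+n m)))) qa))
    where
    lt′ : suc (a + m) < q
    lt′ = subst (_< q) (+-suc a m) lt
    nxt : next q (a + m) ≡ suc (a + m)
    nxt = next-suc lt′

  down : ∀ {a} m → a + m < q → (∀ {j} → a ≤ j → j ≤ a + m → j ≢ t₀) → Q (a + m) → Q a
  down {a} zero    lt avoid qb = subst Q (+-identityʳ a) qb
  down {a} (suc m) lt avoid qb = down m (<-trans (n<1+n _) lt′) (λ a≤ j≤ → avoid a≤ (≤-trans j≤ (+-monoʳ-≤ a (n≤1+n m))))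
      (back (<-trans (n<1+n _) lt′) (avoid (m≤m+n a m) (+-monoʳ-≤ a (n≤1+n m)))
            (subst (_≢ t₀) (sym nxt) (avoid (≤-trans (m≤m+n a m) (n≤1+n _)) (≤-reflexive (sym (+-suc a m)))))
            (subst Q (trans (+-suc a m) (sym nxt)) qb))
    where
    lt′ : suc (a + m) < q
    lt′ = subst (_< q) (+-suc a m) lt
    nxt : next q (a + m) ≡ suc (a + m)
    nxt = next-suc lt′

  between : ∀ {a b} → a < q → b < q → (∀ {j} → a ≤ j → j ≤ b → j ≢ t₀) → (∀ {j} → b ≤ j → j ≤ a → j ≢ t₀) → Q a → Q b
  between {a} {b} a<q b<q avoid avoid′ qa with ≤-total a b
  ... | inj₁ a≤b = subst Q b≡ (up (b ∸ a) (subst (_< q) (sym b≡) b<q) (λ p r → avoid p (≤-trans r (≤-reflexive b≡))) qa)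
    where
    b≡ : a + (b ∸ a) ≡ b
    b≡ = m+[n∸m]≡n a≤b
  ... | inj₂ b≤a = down (a ∸ b) (subst (_< q) (sym a≡) a<q) (λ p r → avoid′ p (≤-trans r (≤-reflexive a≡))) (subst Q (sym a≡) qa)
    where
    a≡ : b + (a ∸ b) ≡ a
    a≡ = m+[n∸m]≡n b≤a

  spread : ∀ {s t} → s < q → s ≢ t₀ → t < q → t ≢ t₀ → Q s → Q t
  spread {s} {t} s<q s≢ t<q t≢ qs with <-cmp s t₀ | <-cmp t t₀
  ... | tri≈ _ eq _ | _ = contradiction eq s≢
  ... | _ | tri≈ _ eq _ = contradiction eq t≢
  ... | tri< s< _ _ | tri< t< _ _ = between s<q t<q (λ _ j≤ → <⇒≢ (≤-<-trans j≤ t<)) (λ _ j≤ → <⇒≢ (≤-<-trans j≤ s<)) qs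
  ... | tri> _ _ s> | tri> _ _ t> = between s<q t<q (λ s≤ _ → >⇒≢ (<-≤-trans s> s≤)) (λ t≤ _ → >⇒≢ (<-≤-trans t> t≤)) qs
  -- The positions are separated by `t₀`, so the route goes down to 0, across the seam to the last
  -- position `l`, and on to `t`.
  spread {s} {t} s<q s≢ t<q t≢ qs | tri< s< _ _ | tri> _ _ t> with previous {q} {0} (≤-<-trans z≤n s<q)
  ... | l , l<q , nl = between l<q t<q (λ l≤ _ → >⇒≢ (<-≤-trans l> l≤)) (λ t≤ _ → >⇒≢ (<-≤-trans t> t≤))
        (back l<q (>⇒≢ l>) (subst (_≢ t₀) (sym nl) (<⇒≢ 0<)) (subst Q (sym nl)
          (between s<q (≤-<-trans z≤n s<q) (λ _ j≤ → <⇒≢ (≤-<-trans j≤ 0<)) (λ _ j≤ → <⇒≢ (≤-<-trans j≤ s<)) qs)))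
    where
    0< : 0 < t₀
    0< = ≤-<-trans z≤n s<
    l> : t₀ < l
    l> = <-≤-trans t> (s≤s⁻¹ (subst (t <_) (next≡0⇒last nl) t<q))
  spread {s} {t} s<q s≢ t<q t≢ qs | tri> _ _ s> | tri< t< _ _ with previous {q} {0} (≤-<-trans z≤n s<q)
  ... | l , l<q , nl = between (≤-<-trans z≤n s<q) t<q (λ _ j≤ → <⇒≢ (≤-<-trans j≤ t<)) (λ _ j≤ → <⇒≢ (≤-<-trans j≤ 0<))
        (subst Q nl (forth l<q (>⇒≢ l>) (subst (_≢ t₀) (sym nl) (<⇒≢ 0<))
          (between s<q l<q (λ s≤ _ → >⇒≢ (<-≤-trans s> s≤)) (λ l≤ _ → >⇒≢ (<-≤-trans l> l≤)) qs)))
    where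
    0< : 0 < t₀
    0< = ≤-<-trans z≤n t<
    l> : t₀ < l
    l> = <-≤-trans s> (s≤s⁻¹ (subst (s <_) (next≡0⇒last nl) s<q))

-- Each of the N bags is a grid with h + 1 columns and at least R complete rows; bag apex = N is not the index of a bag.
record Layout (n N h R : ℕ) : Set where
  field
    apex        : Fin n
    bag row col : Fin n → ℕ
    bag-apex    : bag apex ≡ N
    bag≢apex    : ∀ {x} → x ≢ apex → bag x < N
    col<        : ∀ {x} → bag x < N → col x < suc h
    coords      : ∀ {x y} → bag x < N → bag x ≡ bag y → row x ≡ row y → col x ≡ col y → x ≡ y
    vertex      : ∀ {j r c} → j < N → r < R → c < suc h → ∃ λ x → bag x ≡ j × row x ≡ r × col x ≡ c
    -- The order of `Fin n` puts the apex first and then runs through the bags, so that `elements`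
    -- lists a set sorted by bags.
    apex-first  : ∀ x → x ≢ apex → toℕ apex < toℕ x
    bag-mono    : ∀ {x y} → x ≢ apex → toℕ x < toℕ y → bag x ≤ bag y

  bag≮⇒apex : ∀ {x} → ¬ (bag x < N) → x ≡ apex
  bag≮⇒apex {x} ≮ = decidable-stable (x ≟ᶠ apex) (≮ ∘ bag≢apex)

  bag≡N⇒apex : ∀ {x} → bag x ≡ N → x ≡ apex
  bag≡N⇒apex eq = bag≮⇒apex (<-irrefl eq)

module Construction {n N h R : ℕ} (L : Layout n N h R) (ℓ : ℕ) where
  open Layout L public

  V : Set
  V = Fin n

  nxt : ℕ → ℕ
  nxt = next N

  -- U i is the white part of bag i. D i, the gadget attached to U i, sits in the following bag.
  U D Plain Far Ok : ℕ → V → Set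
  U i x     = bag x ≡ i × h ≤ row x
  D i x     = bag x ≡ nxt i × row x < h
  -- Row `h` is kept for the ports of columns, so that a row edge and a column edge of one gadget
  -- never meet in the white part.
  Plain i x = bag x ≡ i × h < row x
  Far i x   = bag x ≢ nxt i × bag x ≢ nxt (nxt i)
  -- For the last bag `i`, `nxt i` is 0 and the bound on bags does not exclude `U i`; the last
  -- clause does.
  Ok i x    = nxt i ≤ bag x × bag x < N × ¬ U i x

  At : ℕ → ℕ → ℕ → V → Set
  At j r c x = bag x ≡ j × row x ≡ r × col x ≡ c

  Col : ℕ → ℕ → V → Set
  Col i c x = col x ≡ c × (D i x ⊎ (bag x ≡ i × row x ≡ h))

  U? : ∀ i → Decidable (U i)
  U? i x = (bag x ≟ i) ×-dec (h ≤? row x)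

  D? : ∀ i → Decidable (D i)
  D? i x = (bag x ≟ nxt i) ×-dec (row x <? h)

  Far? : ∀ i → Decidable (Far i)
  Far? i x = ¬? (bag x ≟ nxt i) ×-dec ¬? (bag x ≟ nxt (nxt i))

  Ok? : ∀ i → Decidable (Ok i)
  Ok? i x = (nxt i ≤? bag x) ×-dec ((bag x <? N) ×-dec ¬? (U? i x))

  At? : ∀ j r c → Decidable (At j r c)
  At? j r c x = (bag x ≟ j) ×-dec ((row x ≟ r) ×-dec (col x ≟ c))

  WhiteVertex : ℕ → V → Set
  WhiteVertex i x = U i x ⊎ U (nxt i) x ⊎ D i x

  RowVertex ColVertex : ℕ → ℕ → V → Set
  RowVertex i r x = Plain i x ⊎ (bag x ≡ nxt i × row x ≡ r)
  ColVertex i c x = bag x ≡ N ⊎ Col i c x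

  -- All ℓ-subsets of a white edge are white, all those of a gadget edge have the colour of gadget i; ports have ℓ-subsets of both kinds.
  White Gadget : ℕ → List V → Set
  White i f  = All (WhiteVertex i) f × (All (¬_ ∘ D i) f ⊎ count (¬? ∘ U? i) f < ℓ)
  Gadget i f = All (Ok i) f × count (¬? ∘ D? i) f ≤ ℓ ×
               (count (¬? ∘ D? i) f < ℓ ⊎ (Any (U (nxt i)) f × Any (Far i) f))

  RowPort ColPort : ℕ → ℕ → List V → Set
  RowPort i r f = All (RowVertex i r) f × All (λ c → Any (At (nxt i) r c) f) (upTo (suc h))
  ColPort i c f = All (ColVertex i c) f × Any (λ x → bag x ≡ N) f ×
                  All (λ r → Any (At (nxt i) r c) f) (upTo h) × Any (At i h c) f

  U∌D : ∀ {i j x} → U i x → ¬ D j x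
  U∌D (_ , h≤) (_ , <h) = <⇒≱ <h h≤

  -- What a set of `ℓ` vertices must satisfy in order that adding vertices of `U α`, respectively of
  -- `D i`, yields a white or a gadget edge.
  WhiteEnd GadgetEnd : ℕ → List V → Set
  WhiteEnd α T  = All (WhiteVertex α) T × Any (U α) T
  GadgetEnd i S = All (Ok i) S × (Any (D i) S ⊎ (Any (U (nxt i)) S × Any (Far i) S))

  -- A total form of `vertex`; outside the grid the value is the apex, which no use relies on.
  vtx : ℕ → ℕ → ℕ → V
  vtx j r s with j <? N | r <? R | s <? suc h
  ... | yes j< | yes r< | yes s< = proj₁ (vertex j< r< s<)
  ... | _ | _ | _ = apex

  vtx-At : ∀ {j r s} → j < N → r < R → s < suc h → At j r s (vtx j r s)
  vtx-At {j} {r} {s} j< r< s< with j <? N | r <? R | s <? suc h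
  ... | yes j<′ | yes r<′ | yes s<′ = proj₂ (vertex j<′ r<′ s<′)
  ... | no ≮ | _ | _ = contradiction j< ≮
  ... | yes _ | no ≮ | _ = contradiction r< ≮
  ... | yes _ | yes _ | no ≮ = contradiction s< ≮

  data EdgeAt (i : ℕ) (f : List V) : Set where
    white   : White i f → EdgeAt i f
    gadget  : Gadget i f → EdgeAt i f
    rowPort : ∀ {r} → r < h → RowPort i r f → EdgeAt i f
    colPort : ∀ {c} → c < suc h → ColPort i c f → EdgeAt i f

  Edge : List V → Set
  Edge f = ∃ λ i → i < N × EdgeAt i f

  white? : ∀ i f → Dec (White i f)
  white? i f = All.all? (λ x → U? i x ⊎-dec (U? (nxt i) x ⊎-dec D? i x)) f ×-dec
               (All.all? (¬? ∘ D? i) f ⊎-dec (count (¬? ∘ U? i) f <? ℓ))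

  gadget? : ∀ i f → Dec (Gadget i f)
  gadget? i f = All.all? (Ok? i) f ×-dec ((count (¬? ∘ D? i) f ≤? ℓ) ×-dec
                ((count (¬? ∘ D? i) f <? ℓ) ⊎-dec (Any.any? (U? (nxt i)) f ×-dec Any.any? (Far? i) f)))

  rowPort? : ∀ i r f → Dec (RowPort i r f)
  rowPort? i r f = All.all? (λ x → ((bag x ≟ i) ×-dec (h <? row x)) ⊎-dec ((bag x ≟ nxt i) ×-dec (row x ≟ r))) f ×-dec
                   All.all? (λ c → Any.any? (At? (nxt i) r c) f) (upTo (suc h))

  colPort? : ∀ i c f → Dec (ColPort i c f)
  colPort? i c f = All.all? (λ x → (bag x ≟ N) ⊎-dec ((col x ≟ c) ×-dec (D? i x ⊎-dec ((bag x ≟ i) ×-dec (row x ≟ h))))) f ×-dec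
                   (Any.any? (λ x → bag x ≟ N) f ×-dec
                   (All.all? (λ r → Any.any? (At? (nxt i) r c) f) (upTo h) ×-dec Any.any? (At? i h c) f))

  edgeAt? : ∀ i f → Dec (EdgeAt i f)
  edgeAt? i f = map′ to from (white? i f ⊎-dec (gadget? i f ⊎-dec
      (anyUpTo? (λ r → rowPort? i r f) h ⊎-dec anyUpTo? (λ c → colPort? i c f) (suc h))))
    where
    Cases : Set
    Cases = White i f ⊎ Gadget i f ⊎ (∃ λ r → r < h × RowPort i r f) ⊎ (∃ λ c → c < suc h × ColPort i c f)
    to : Cases → EdgeAt i f
    to (inj₁ w)                             = white w
    to (inj₂ (inj₁ g))                      = gadget g
    to (inj₂ (inj₂ (inj₁ (r , r< , p))))    = rowPort r< p
    to (inj₂ (inj₂ (inj₂ (c , c< , p))))    = colPort c< p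
    from : EdgeAt i f → Cases
    from (white w)      = inj₁ w
    from (gadget g)     = inj₂ (inj₁ g)
    from (rowPort r< p) = inj₂ (inj₂ (inj₁ (_ , r< , p)))
    from (colPort c< p) = inj₂ (inj₂ (inj₂ (_ , c< , p)))

  edge? : ∀ f → Dec (Edge f)
  edge? f = anyUpTo? (λ i → edgeAt? i f) N

  module _ {f g : List V} (p : f ↭ g) where
    private
      all⁺ : ∀ {P : V → Set} → All P f → All P g
      all⁺ = ↭ₚ.All-resp-↭ p
      any⁺ : ∀ {P : V → Set} → Any P f → Any P g
      any⁺ = ↭ₚ.Any-resp-↭ p
      count≡ : ∀ {P : V → Set} (P? : Decidable P) → count P? f ≡ count P? g
      count≡ P? = count-↭ P? p

    edgeAt-↭ : ∀ {i} → EdgeAt i f → EdgeAt i g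
    edgeAt-↭ {i} (white (w , inj₁ d))   = white (all⁺ w , inj₁ (all⁺ d))
    edgeAt-↭ {i} (white (w , inj₂ lt))  = white (all⁺ w , inj₂ (subst (_< ℓ) (count≡ (¬? ∘ U? i)) lt))
    edgeAt-↭ {i} (gadget (a , le , inj₁ lt)) = gadget (all⁺ a , subst (_≤ ℓ) (count≡ (¬? ∘ D? i)) le , inj₁ (subst (_< ℓ) (count≡ (¬? ∘ D? i)) lt))
    edgeAt-↭ {i} (gadget (a , le , inj₂ (u , v))) = gadget (all⁺ a , subst (_≤ ℓ) (count≡ (¬? ∘ D? i)) le , inj₂ (any⁺ u , any⁺ v))
    edgeAt-↭ (rowPort r< (a , b))         = rowPort r< (all⁺ a , All.map any⁺ b)
    edgeAt-↭ (colPort c< (a , b , e , z)) = colPort c< (all⁺ a , any⁺ b , All.map any⁺ e , any⁺ z)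

    edge-↭ : Edge f → Edge g
    edge-↭ (i , i< , e) = i , i< , edgeAt-↭ e

  graph : ∀ k → KGraph n k
  graph k = record
    { edges   = filter (λ e → (∣ e ∣ ≟ k) ×-dec edge? (elements e)) (allSubsets n)
    ; uniform = All.tabulate λ e∈ → proj₁ (proj₂ (∈-filter⁻ isEdge? {xs = allSubsets n} e∈))
    ; simple  = Uniqueₚ.filter⁺ isEdge? (allSubsets-unique n)
    }
    where
    isEdge? : (e : Subset n) → Dec (∣ e ∣ ≡ k × Edge (elements e))
    isEdge? e = (∣ e ∣ ≟ k) ×-dec edge? (elements e)

  ∈-graph⁻ : ∀ {k e} → e ∈ edges (graph k) → ∣ e ∣ ≡ k × Edge (elements e)
  ∈-graph⁻ {k} e∈ = proj₂ (∈-filter⁻ (λ e → (∣ e ∣ ≟ k) ×-dec edge? (elements e)) {xs = allSubsets n} e∈)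

  ∈-graph⁺ : ∀ {k xs} → Unique xs → length xs ≡ k → Edge xs → setOf xs ∈ edges (graph k)
  ∈-graph⁺ {k} {xs} u len e = ∈-filter⁺ (λ e → (∣ e ∣ ≟ k) ×-dec edge? (elements e)) (∈-allSubsets (setOf xs))
    (trans (∣setOf∣ xs u) len , edge-↭ (↭-sym (elements-setOf xs u)) e)

-- Absence of hamiltonian cycles

module NonHamiltonian {n N h R : ℕ} (L : Layout n N h R) (ℓ d : ℕ) (2≤ℓ : 2 ≤ ℓ) (ℓ<d : ℓ < d) (2≤N : 2 ≤ N) (R> : suc h < R) where
  open Construction L ℓ

  nxt-< : ∀ {i} → i < N → nxt i < N
  nxt-< = next-<

  -- The colour is read off the least bag, which is `nxt i`. The last clause keeps the set out of
  -- white edges: a vertex of `D i` or `Far i` is never white for `nxt i`.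
  Coloured : ℕ → List V → Set
  Coloured i S = Any (λ x → bag x ≡ nxt i) S × All (Ok i) S × Any (λ x → D i x ⊎ Far i x) S

  module _ {i : ℕ} (i<N : i < N) {f S : List V} (uf : Unique f) (uS : Unique S) (∣S∣ : length S ≡ ℓ) (S⊆f : ∀ {x} → x ∈ S → x ∈ f) where

    -- If `S` misses `D i`, then it consists of all the `ℓ` vertices of `f` outside `D i`, so it
    -- inherits the vertices in `U (nxt i)` and `Far i` that such an edge must have.
    gadget⇒coloured : Gadget i f → Coloured i S
    gadget⇒coloured (ok , le , extra) with Any.any? (D? i) S
    ... | yes p = Any.map proj₁ p , All.tabulate (All.lookup ok ∘ S⊆f) , Any.map inj₁ p
    ... | no ¬p with extra
    ...   | inj₁ lt = contradiction (Any.map (λ {x} → decidable-stable (D? i x))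
                        (unique-⊆⇒escape (¬? ∘ D? i) uS S⊆f (subst (_ <_) (sym ∣S∣) lt))) ¬p
    ...   | inj₂ (u , far) = lose (inS (find u) (λ ux dx → U∌D {nxt i} {i} ux dx)) (proj₁ (proj₂ (proj₂ (find u)))) ,
              All.tabulate (All.lookup ok ∘ S⊆f) , lose (inS (find far) (λ fx dx → proj₁ fx (proj₁ dx))) (inj₂ (proj₂ (proj₂ (find far))))
      where
      inS : ∀ {P : V → Set} → (p : ∃ λ x → x ∈ f × P x) → (∀ {x} → P x → ¬ D i x) → proj₁ p ∈ S
      inS (x , x∈ , px) notD = unique-⊆⇒exhaust (¬? ∘ D? i) _≟ᶠ_ uf uS S⊆f (Allₚ.¬Any⇒All¬ S ¬p)
        (≤-trans le (≤-reflexive (sym ∣S∣))) x∈ (notD px)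

  -- The ports of gadget `i` cannot be excluded here, since they contain enough vertices of `D i`.
  -- In a given cycle they are ruled out by `no-rowPort` and `apex-once`.
  coloured⇒gadget : ∀ {i} → i < N → {f S : List V} → Unique S → length S ≡ ℓ → (∀ {x} → x ∈ S → x ∈ f) → Coloured i S → Unique f →
                    Edge f → Gadget i f ⊎ (∃ λ r → r < h × RowPort i r f) ⊎ (∃ λ c → ColPort i c f)
  coloured⇒gadget {i} i<N {f} {S} uS ∣S∣ S⊆f (inBag , ok , odd) uf (i′ , i′<N , e) = go e
    where
    x = proj₁ (find inBag)
    x∈ = proj₁ (proj₂ (find inBag))
    bagx : bag x ≡ nxt i
    bagx = proj₂ (proj₂ (find inBag))
    y = proj₁ (find odd)
    y∈ = proj₁ (proj₂ (find odd))
    oddy : D i y ⊎ Far i y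
    oddy = proj₂ (proj₂ (find odd))
    nxt≢ : ∀ j → nxt j ≢ j
    nxt≢ = next≢ 2≤N
    same : ∀ {j} → bag x ≡ nxt j → j ≡ i
    same eq = next-injective N (trans (sym eq) bagx)
    y∉U : ¬ U (nxt i) y
    y∉U (b , h≤) = [ (λ (_ , r<) → <⇒≱ r< h≤) , (λ (≢ , _) → ≢ b) ]′ oddy
    y∉bag : bag y ≢ nxt (nxt i)
    y∉bag b = [ (λ (b′ , _) → nxt≢ (nxt i) (trans (sym b) b′)) , (λ (_ , ≢) → ≢ b) ]′ oddy
    notU : ∀ {z} → z ∈ S → ¬ U i z
    notU z∈ = proj₂ (proj₂ (All.lookup ok z∈))
    go : EdgeAt i′ f → Gadget i f ⊎ (∃ λ r → r < h × RowPort i r f) ⊎ (∃ λ c → ColPort i c f)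
    go (white (w , z)) = ⊥-elim (split (All.lookup w (S⊆f x∈)))
      where
      ownBag : i′ ≡ nxt i → ⊥
      ownBag refl = [ y∉U , [ (λ (b , _) → y∉bag b) , (λ (b , _) → y∉bag b) ]′ ]′ (All.lookup w (S⊆f y∈))
      nextBag : i′ ≡ i → ⊥
      nextBag refl = [ (λ noD → [ notU y∈ , [ y∉U , All.lookup noD (S⊆f y∈) ]′ ]′ (All.lookup w (S⊆f y∈)))
                     , (λ lt → let (u , u∈ , uu) = find (unique-⊆⇒escape (¬? ∘ U? i) uS S⊆f (subst (_ <_) (sym ∣S∣) lt)) in
                               notU u∈ (decidable-stable (U? i u) uu)) ]′ z
      split : WhiteVertex i′ x → ⊥
      split (inj₁ (b , _))        = ownBag (trans (sym b) bagx)
      split (inj₂ (inj₁ (b , _))) = nextBag (same b)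
      split (inj₂ (inj₂ (b , _))) = nextBag (same b)
    -- `S` is coloured by `i` and by `i′`; both colours are determined by the least bag in `S`.
    go (gadget g) with gadget⇒coloured i′<N uf uS ∣S∣ S⊆f g
    ... | inBag′ , ok′ , _ = inj₁ (subst (λ j → Gadget j f) (next-injective N (≤-antisym le le′)) g)
      where
      le : nxt i′ ≤ nxt i
      le = subst (nxt i′ ≤_) bagx (proj₁ (All.lookup ok′ x∈))
      le′ : nxt i ≤ nxt i′
      le′ = let (x′ , x′∈ , b′) = find inBag′ in subst (nxt i ≤_) b′ (proj₁ (All.lookup ok x′∈))
    go (rowPort {r} r<h p@(all , _)) with All.lookup all (S⊆f x∈)
    ... | inj₂ (b , _) with refl ← same b = inj₂ (inj₁ (r , r<h , p))
    ... | inj₁ (b , _) with refl ← trans (sym b) bagx =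
            ⊥-elim ([ (λ (b , lt) → y∉U (b , <⇒≤ lt)) , (λ (b , _) → y∉bag b) ]′ (All.lookup all (S⊆f y∈)))
    go (colPort {c} _ p@(all , _)) with All.lookup all (S⊆f x∈)
    ... | inj₁ b = ⊥-elim (<-irrefl (trans (sym bagx) b) (nxt-< i<N))
    ... | inj₂ (_ , inj₁ (b , _)) with refl ← same b = inj₂ (inj₂ (c , p))
    ... | inj₂ (_ , inj₂ (b , _)) with refl ← trans (sym b) bagx = ⊥-elim (split (All.lookup all (S⊆f y∈)))
      where
      split : ¬ ColVertex (nxt i) c y
      split (inj₁ b)                    = <-irrefl b (proj₁ (proj₂ (All.lookup ok y∈)))
      split (inj₂ (_ , inj₁ (b , _)))   = y∉bag b
      split (inj₂ (_ , inj₂ (b , r)))   = y∉U (b , ≤-reflexive (sym r))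

  apex-edge : ∀ {f} → apex ∈ f → Edge f → ∃ λ i → i < N × ∃ λ c → c < suc h × ColPort i c f
  apex-edge {f} a∈ (i , i<N , e) = i , i<N , go e
    where
    noBag : ∀ {j} → j < N → bag apex ≢ j
    noBag j<N eq = <-irrefl (trans (sym eq) bag-apex) j<N
    go : EdgeAt i f → ∃ λ c → c < suc h × ColPort i c f
    go (white (w , _))     = ⊥-elim ([ noBag i<N ∘ proj₁ , [ noBag (nxt-< i<N) ∘ proj₁ , noBag (nxt-< i<N) ∘ proj₁ ]′ ]′ (All.lookup w a∈))
    go (gadget (ok , _))   = ⊥-elim (<-irrefl bag-apex (proj₁ (proj₂ (All.lookup ok a∈))))
    go (rowPort _ (w , _)) = ⊥-elim ([ noBag i<N ∘ proj₁ , noBag (nxt-< i<N) ∘ proj₁ ]′ (All.lookup w a∈))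
    go (colPort c< p)      = _ , c< , p

  col-unique : ∀ {i c i′ c′ x} → Col i c x → Col i′ c′ x → i ≡ i′ × c ≡ c′
  col-unique (c , inj₁ (b , _))  (c′ , inj₁ (b′ , _))  = next-injective N (trans (sym b) b′) , trans (sym c) c′
  col-unique (c , inj₂ (b , _))  (c′ , inj₂ (b′ , _))  = trans (sym b) b′ , trans (sym c) c′
  col-unique (c , inj₁ (_ , r<)) (c′ , inj₂ (_ , r))   = ⊥-elim (<-irrefl r r<)
  col-unique (c , inj₂ (_ , r))  (c′ , inj₁ (_ , r<))  = ⊥-elim (<-irrefl r r<)

  at-unique : ∀ {j r c x y} → j < N → At j r c x → At j r c y → x ≡ y
  at-unique j<N (b , r , c) (b′ , r′ , c′) = coords (subst (_< N) (sym b) j<N) (trans b (sym b′)) (trans r (sym r′)) (trans c (sym c′))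

  col-contained : ∀ {i c f g} → i < N → All (ColVertex i c) f → ColPort i c g → ∀ {x} → x ∈ f → x ∈ g
  col-contained {i} {c} {f} {g} i<N all (_ , a , full , port) {x} x∈ = go (All.lookup all x∈)
    where
    found : ∀ {j r} → j < N → At j r c x → Any (At j r c) g → x ∈ g
    found j<N at p = let (y , y∈ , at′) = find p in subst (_∈ g) (at-unique j<N at′ at) y∈
    go : ColVertex i c x → x ∈ g
    go (inj₁ b) = let (y , y∈ , b′) = find a in subst (_∈ g) (trans (bag≡N⇒apex b′) (sym (bag≡N⇒apex b))) y∈
    go (inj₂ (c≡ , inj₁ (b , r<))) = found (nxt-< i<N) (b , refl , c≡) (All.lookup full (∈-upTo⁺ r<))
    go (inj₂ (c≡ , inj₂ (b , r≡))) = found i<N (b , r≡ , c≡) port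

  k : ℕ
  k = d + ℓ

  module InCycle (q s : ℕ) {{_ : NonZero s}} (s≡ : s ≡ q * d) (2≤q : 2 ≤ q) (v : Fin s → Fin n) (inj : Injective _≡_ _≡_ v)
                 (edge : ∀ {t} → t < q → Edge (elements (cycleEdge k d v t))) (spanning : ∀ x → ∃ λ i → v i ≡ x) where
    open Windows ℓ d 2≤ℓ ℓ<d q s s≡ 2≤q v inj

    F : ℕ → List V
    F t = elements (E t)

    instance
      d≢0 : NonZero d
      d≢0 = >-nonZero (≤-<-trans z≤n ℓ<d)

    cover : ∀ x → ∃ λ t → t < q × x ∈ F t
    cover x = let (i , vi) = spanning x ; (t , t< , x∈) = covered i in t , t< , ∈-elements⁺ (subst (_∈ₛ E t) vi x∈)

    t₀ : ℕ
    t₀ = proj₁ (cover apex)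
    t₀< : t₀ < q
    t₀< = proj₁ (proj₂ (cover apex))

    port : ∃ λ i → i < N × ∃ λ c → c < suc h × ColPort i c (F t₀)
    port = apex-edge (proj₂ (proj₂ (cover apex))) (edge t₀<)

    i c : ℕ
    i = proj₁ port
    c = proj₁ (proj₂ (proj₂ port))
    i<N : i < N
    i<N = proj₁ (proj₂ port)
    c< : c < suc h
    c< = proj₁ (proj₂ (proj₂ (proj₂ port)))
    colPort₀ : ColPort i c (F t₀)
    colPort₀ = proj₂ (proj₂ (proj₂ (proj₂ port)))

    twice : ∀ {t x} → t < q → t ≢ t₀ → x ∈ F t₀ → x ∈ F t → ∃ λ y → y ≢ x × y ∈ F t₀ × y ∈ F t
    twice t< t≢ x∈ x∈′ = let (y , y≢ , y∈ , y∈′) = meet-twice t₀< t< (t≢ ∘ sym) (∈-elements⁻ x∈) (∈-elements⁻ x∈′) in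
      y , y≢ , ∈-elements⁺ y∈ , ∈-elements⁺ y∈′

    -- A second column edge would share with the first a vertex other than the apex. That vertex
    -- determines the gadget and the column, so the second edge would contain all of the first.
    apex-once : ∀ {t} → t < q → t ≢ t₀ → apex ∉ F t
    apex-once {t} t< t≢ a∈ with apex-edge a∈ (edge t<) | twice t< t≢ (proj₂ (proj₂ (cover apex))) a∈
    ... | i′ , i′< , c′ , c′< , p | y , y≢ , y∈ , y∈′ with All.lookup (proj₁ colPort₀) y∈ | All.lookup (proj₁ p) y∈′
    ...   | inj₁ b | _ = y≢ (bag≡N⇒apex b)
    ...   | _ | inj₁ b = y≢ (bag≡N⇒apex b)
    ...   | inj₂ y₁ | inj₂ y₂ with col-unique y₁ y₂
    ...     | refl , refl = let (x , x∈ , x∉) = private-vertex t₀< t< (t≢ ∘ sym) in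
                x∉ (∈-elements⁻ (col-contained i<N (proj₁ colPort₀) p (∈-elements⁺ x∈)))

    -- A row and a column share a single vertex, while two edges of the cycle never do.
    no-rowPort : ∀ {t r} → t < q → t ≢ t₀ → r < h → ¬ RowPort i r (F t)
    no-rowPort {t} {r} t< t≢ r<h (all , full)
      with find (All.lookup (proj₁ (proj₂ (proj₂ colPort₀))) (∈-upTo⁺ r<h)) | find (All.lookup full (∈-upTo⁺ c<))
    ... | x , x∈ , atx | x′ , x∈′ , atx′ with at-unique (nxt-< i<N) atx atx′
    ...   | refl with twice t< t≢ x∈ x∈′
    ...     | y , y≢ , y∈ , y∈′ with All.lookup (proj₁ colPort₀) y∈ | All.lookup all y∈′
    ...       | inj₁ b | inj₁ (b′ , _) = <-irrefl (trans (sym b′) b) i<N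
    ...       | inj₁ b | inj₂ (b′ , _) = <-irrefl (trans (sym b′) b) (nxt-< i<N)
    ...       | inj₂ (_ , inj₁ (b , _)) | inj₁ (b′ , _) = next≢ 2≤N i (trans (sym b) b′)
    ...       | inj₂ (_ , inj₂ (_ , r≡)) | inj₁ (_ , lt) = <-irrefl (sym r≡) lt
    ...       | inj₂ (_ , inj₂ (b , _)) | inj₂ (b′ , _) = next≢ 2≤N i (trans (sym b′) b)
    ...       | inj₂ (c≡ , inj₁ _) | inj₂ (b′ , r≡) = y≢ (at-unique (nxt-< i<N) (b′ , r≡ , c≡) atx)

    enter : ∀ {t S} → t < q → t ≢ t₀ → Unique S → length S ≡ ℓ → (∀ {x} → x ∈ S → x ∈ F t) → Coloured i S → Gadget i (F t)
    enter {t} t< t≢ uS ∣S∣ S⊆ col with coloured⇒gadget i<N uS ∣S∣ S⊆ col (elements-unique (E t)) (edge t<)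
    ... | inj₁ g = g
    ... | inj₂ (inj₁ (r , r< , p)) = ⊥-elim (no-rowPort t< t≢ r< p)
    ... | inj₂ (inj₂ (c′ , p)) = ⊥-elim (apex-once t< t≢ (let (a , a∈ , b) = find (proj₁ (proj₂ p)) in subst (_∈ F t) (bag≡N⇒apex b) a∈))

    S : ℕ → List V
    S = shared

    S⊆F : ∀ t {x} → x ∈ S t → x ∈ F t
    S⊆F t = ∈-elements⁺ ∘ shared⊆right t
    S⊆F′ : ∀ t {x} → x ∈ S (next q t) → x ∈ F t
    S⊆F′ t = ∈-elements⁺ ∘ shared⊆left t

    forth : ∀ {t} → t < q → t ≢ t₀ → next q t ≢ t₀ → Gadget i (F t) → Gadget i (F (next q t))
    forth {t} t< t≢ t≢′ g = enter (next-< t<) t≢′ (shared-unique (next-< t<)) (length-shared (next q t)) (S⊆F (next q t))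
      (gadget⇒coloured i<N (elements-unique (E t)) (shared-unique (next-< t<)) (length-shared (next q t)) (S⊆F′ t) g)

    back : ∀ {t} → t < q → t ≢ t₀ → next q t ≢ t₀ → Gadget i (F (next q t)) → Gadget i (F t)
    back {t} t< t≢ t≢′ g = enter t< t≢ (shared-unique (next-< t<)) (length-shared (next q t)) (S⊆F′ t)
      (gadget⇒coloured i<N (elements-unique (E (next q t))) (shared-unique (next-< t<)) (length-shared (next q t)) (S⊆F (next q t)) g)

    open Spread q (λ t → Gadget i (F t)) t₀ forth back

    all-D⇒coloured : ∀ {T} → length T ≡ ℓ → All (D i) T → Coloured i T
    all-D⇒coloured {[]} eq _ = ⊥-elim (<⇒≢ (≤-trans (s≤s z≤n) 2≤ℓ) eq)
    all-D⇒coloured {x ∷ T} eq ds@(dx ∷ _) = here (proj₁ dx) ,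
      All.map (λ {x} (b , r<) → ≤-reflexive (sym b) , subst (_< N) (sym b) (nxt-< i<N) , λ (_ , h≤) → <⇒≱ r< h≤) ds , here (inj₁ dx)

    -- The overlaps of edge `t₀` with its two neighbours are disjoint and avoid the apex. The only
    -- other vertex of the column edge outside `D i` is its white port, so one of the overlaps lies
    -- in `D i`.
    start : ∃ λ t → t < q × t ≢ t₀ × Gadget i (F t)
    start with All.all? (D? i) (S (next q t₀)) | previous t₀<
    ... | yes ds | _ = next q t₀ , next-< t₀< , next≢ 2≤q t₀ ,
            enter (next-< t₀<) (next≢ 2≤q t₀) (shared-unique (next-< t₀<)) (length-shared (next q t₀)) (S⊆F (next q t₀)) (all-D⇒coloured (length-shared (next q t₀)) ds)
    ... | no ¬ds | p , p< , np with find (Allₚ.¬All⇒Any¬ (D? i) _ ¬ds)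
    ...   | x , x∈ , ¬dx = p , p< , p≢ , enter p< p≢ (shared-unique t₀<) (length-shared t₀) inF (all-D⇒coloured (length-shared t₀) (All.tabulate inD))
      where
      p≢ : p ≢ t₀
      p≢ eq = next≢ 2≤q p (trans np (sym eq))
      inF : ∀ {z} → z ∈ S t₀ → z ∈ F p
      inF {z} z∈ = S⊆F′ p (subst (λ t → z ∈ S t) (sym np) z∈)
      inCol : ∀ {t z} → z ∈ F t₀ → t < q → t ≢ t₀ → z ∈ F t → Col i c z
      inCol {t} z∈ t< t≢ z∈′ with All.lookup (proj₁ colPort₀) z∈
      ... | inj₂ col = col
      ... | inj₁ b = ⊥-elim (apex-once t< t≢ (subst (_∈ F t) (bag≡N⇒apex b) z∈′))
      colx : Col i c x
      colx = inCol (S⊆F′ t₀ x∈) (next-< t₀<) (next≢ 2≤q t₀) (S⊆F (next q t₀) x∈)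
      inD : ∀ {z} → z ∈ S t₀ → D i z
      inD {z} z∈ with inCol (S⊆F t₀ z∈) p< p≢ (inF z∈) | colx
      ... | _ , inj₁ dz | _ = dz
      ... | cz , inj₂ (bz , rz) | cx , inj₁ dx = ⊥-elim (¬dx dx)
      ... | cz , inj₂ (bz , rz) | cx , inj₂ (bx , rx) = ⊥-elim (shared-disjoint t₀ (next q t₀) t₀< (next-< t₀<) (next≢ 2≤q t₀ ∘ sym) z∈
              (subst (_∈ S (next q t₀)) (at-unique i<N (bx , rx , cx) (bz , rz , cz)) x∈))

    impossible : ⊥
    -- The witness is a vertex of `U i` in row `h + 1`. The column edge uses only row `h` of `U i`,
    -- and gadget edges of `i` avoid `U i`.
    impossible with vertex i<N R> (s≤s (z≤n {h}))
    ... | w , bw , rw , _ with cover w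
    ...   | t , t< , w∈ with t ≟ t₀
    ...     | yes t≡ = notCol (All.lookup (proj₁ colPort₀) (subst (λ t → w ∈ F t) t≡ w∈))
      where
      notCol : ¬ ColVertex i c w
      notCol (inj₁ b)                  = <-irrefl (trans (sym bw) b) i<N
      notCol (inj₂ (_ , inj₁ (_ , r<))) = <⇒≱ r< (≤-trans (n≤1+n h) (≤-reflexive (sym rw)))
      notCol (inj₂ (_ , inj₂ (_ , r)))  = 1+n≢n (trans (sym rw) r)
    ...     | no t≢ = let (s₀ , s< , s≢ , g) = start in
              proj₂ (proj₂ (All.lookup (proj₁ (spread s< s≢ t< t≢ g)) w∈)) (bw , ≤-trans (n≤1+n h) (≤-reflexive (sym rw)))

  nonHamiltonian : ¬ Hamiltonian ℓ (graph k)
  nonHamiltonian (cyc , contained , spanning) = InCycle.impossible q s {{Cycle.nonZero cyc}} s≡ 2≤q v (Cycle.distinct cyc) edge spanning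
    where
    s = Cycle.s cyc
    v = Cycle.v cyc
    q = Cycle.edgeCount cyc
    k∸ℓ≡d : k ∸ ℓ ≡ d
    k∸ℓ≡d = m+n∸n≡m d ℓ
    s≡ : s ≡ q * d
    s≡ = trans (_∣_.equality (Cycle.k∸ℓ∣s cyc)) (cong (q *_) k∸ℓ≡d)
    -- A cycle with a single edge would have `d < k` vertices, against `k ≤ s`.
    2≤q : 2 ≤ q
    2≤q = ≮⇒≥ λ q<2 → <⇒≱ (m<m+n d (≤-trans (s≤s z≤n) 2≤ℓ)) (≤-trans (Cycle.k≤s cyc) (≤-trans (≤-reflexive s≡)
            (≤-trans (*-monoˡ-≤ d (s≤s⁻¹ q<2)) (≤-reflexive (*-identityˡ d)))))
    edge : ∀ {t} → t < q → Edge (elements (cycleEdge k d {{Cycle.nonZero cyc}} v t))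
    edge {t} t< = proj₂ (∈-graph⁻ {k} (subst₂ (λ D T → cycleEdge k D {{Cycle.nonZero cyc}} v T ∈ edges (graph k)) k∸ℓ≡d (toℕ-fromℕ< t<) (contained (fromℕ< t<))))

-- White walks

module _ {A B : Set} where

  concatMap-unique : (F : A → List B) {is : List A} → Unique is → (∀ {i} → i ∈ is → Unique (F i)) →
                     (∀ {i j x} → i ∈ is → j ∈ is → x ∈ F i → x ∈ F j → i ≡ j) → Unique (concatMap F is)
  concatMap-unique F []       uF disj = []
  concatMap-unique F {i ∷ is} (i∉ ∷ u) uF disj = Uniqueₚ.++⁺ (uF (here refl)) (concatMap-unique F u (uF ∘ there) (λ p q → disj (there p) (there q)))
    λ (x∈ , x∈′) → let (j , j∈ , x∈j) = find (∈-concatMap⁻ F {xs = is} x∈′) in All.lookup i∉ j∈ (disj (here refl) (there j∈) x∈ x∈j)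

  concatMap-cong-↭ : {F G : A → List B} → (∀ i → F i ↭ G i) → ∀ is → concatMap F is ↭ concatMap G is
  concatMap-cong-↭ eq []       = ↭-refl
  concatMap-cong-↭ eq (i ∷ is) = ↭ₚ.++⁺ (eq i) (concatMap-cong-↭ eq is)

  concatMap-++-↭ : (F G : A → List B) → ∀ is → concatMap F is ++ concatMap G is ↭ concatMap (λ i → F i ++ G i) is
  concatMap-++-↭ F G []       = ↭-refl
  concatMap-++-↭ F G (i ∷ is) = begin
    (F i ++ concatMap F is) ++ G i ++ concatMap G is  ≡⟨ ++-assoc (F i) _ _ ⟩
    F i ++ concatMap F is ++ G i ++ concatMap G is    ↭⟨ ↭ₚ.++⁺ˡ (F i) (↭ₚ.shifts (concatMap F is) (G i)) ⟩
    F i ++ G i ++ concatMap F is ++ concatMap G is    ≡⟨ sym (++-assoc (F i) (G i) _) ⟩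
    (F i ++ G i) ++ concatMap F is ++ concatMap G is  ↭⟨ ↭ₚ.++⁺ˡ (F i ++ G i) (concatMap-++-↭ F G is) ⟩
    (F i ++ G i) ++ concatMap (λ j → F j ++ G j) is   ∎
    where open PermutationReasoning

  concatMap-++ : (F : A → List B) → ∀ is js → concatMap F (is ++ js) ≡ concatMap F is ++ concatMap F js
  concatMap-++ F []       js = refl
  concatMap-++ F (i ∷ is) js = trans (cong (F i ++_) (concatMap-++ F is js)) (sym (++-assoc (F i) _ _))

  concatMap-↭ : (F : A → List B) {is js : List A} → is ↭ js → concatMap F is ↭ concatMap F js
  concatMap-↭ F _↭_.refl        = ↭-refl
  concatMap-↭ F (prep i p)      = ↭ₚ.++⁺ˡ (F i) (concatMap-↭ F p)
  concatMap-↭ F (swap i j p)    = ↭-trans (↭ₚ.++⁺ˡ (F i) (↭ₚ.++⁺ˡ (F j) (concatMap-↭ F p))) (↭ₚ.shifts (F i) (F j))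
  concatMap-↭ F (_↭_.trans p q) = ↭-trans (concatMap-↭ F p) (concatMap-↭ F q)

module Orbits (N : ℕ) where

  iter : ℕ → ℕ → ℕ
  iter zero    i = i
  iter (suc m) i = iter m (next N i)

  orbit : ℕ → ℕ → List ℕ
  orbit zero    i = []
  orbit (suc m) i = i ∷ orbit m (next N i)

  iter-+ : ∀ a b i → iter (a + b) i ≡ iter b (iter a i)
  iter-+ zero    b i = refl
  iter-+ (suc a) b i = iter-+ a b (next N i)

  orbit-+ : ∀ a b i → orbit (a + b) i ≡ orbit a i ++ orbit b (iter a i)
  orbit-+ zero    b i = refl
  orbit-+ (suc a) b i = cong (i ∷_) (orbit-+ a b (next N i))

  iter-next : ∀ m i → iter (suc m) i ≡ next N (iter m i)
  iter-next zero    i = refl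
  iter-next (suc m) i = iter-next m (next N i)

  iter-< : ∀ m {i} → i + m < N → iter m i ≡ i + m
  iter-< zero    {i} lt = sym (+-identityʳ i)
  iter-< (suc m) {i} lt = trans (cong (iter m) (next-suc (≤-<-trans (s≤s (m≤m+n i m)) lt′))) (trans (iter-< m lt′) (sym (+-suc i m)))
    where
    lt′ : suc i + m < N
    lt′ = subst (_< N) (+-suc i m) lt

  iter-wrap : ∀ m {i} → i + suc m ≡ N → iter (suc m) i ≡ 0
  iter-wrap zero    {i} eq = next-last (trans (+-comm 1 i) eq)
  iter-wrap (suc m) {i} eq = trans (cong (iter (suc m)) (next-suc (≤-trans (s≤s (≤-reflexive refl))
      (subst (suc (suc i) ≤_) eq (≤-trans (s≤s (s≤s (m≤m+n i m))) (≤-reflexive (sym (trans (+-suc i (suc m)) (cong suc (+-suc i m)))))))))) (iter-wrap m (trans (sym (+-suc i (suc m))) eq))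

  wrap : ∀ {i} → i < N → iter (N ∸ i) i ≡ 0
  wrap {i} i<N with N ∸ i in eq
  ... | zero  = contradiction (m∸n≡0⇒m≤n eq) (<⇒≱ i<N)
  ... | suc m = iter-wrap m (trans (cong (i +_) (sym eq)) (m+[n∸m]≡n (<⇒≤ i<N)))

  N≡ : ∀ {i} → i < N → (N ∸ i) + i ≡ N
  N≡ i<N = m∸n+n≡m (<⇒≤ i<N)

  iter-N : ∀ {i} → i < N → iter N i ≡ i
  iter-N {i} i<N = trans (cong (λ m → iter m i) (sym (N≡ i<N))) (trans (iter-+ (N ∸ i) i i) (trans (cong (iter i) (wrap i<N)) (iter-< i i<N)))

  orbit-N : ∀ {i} → i < N → orbit N i ↭ orbit N 0
  orbit-N {i} i<N = begin
    orbit N i                                     ≡⟨ trans (cong (λ m → orbit m i) (sym (N≡ i<N))) (orbit-+ (N ∸ i) i i) ⟩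
    orbit (N ∸ i) i ++ orbit i (iter (N ∸ i) i)   ≡⟨ cong (λ j → orbit (N ∸ i) i ++ orbit i j) (wrap i<N) ⟩
    orbit (N ∸ i) i ++ orbit i 0                  ↭⟨ ↭ₚ.++-comm (orbit (N ∸ i) i) (orbit i 0) ⟩
    orbit i 0 ++ orbit (N ∸ i) i                  ≡⟨ cong (λ j → orbit i 0 ++ orbit (N ∸ i) j) (sym (iter-< i i<N)) ⟩
    orbit i 0 ++ orbit (N ∸ i) (iter i 0)         ≡⟨ trans (sym (orbit-+ i (N ∸ i) 0)) (cong (λ m → orbit m 0) (m+[n∸m]≡n (<⇒≤ i<N))) ⟩
    orbit N 0                                     ∎
    where open PermutationReasoning

  orbit-upTo : ∀ m i → i + m ≤ N → orbit m i ≡ applyUpTo (i +_) m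
  orbit-upTo zero          i le = refl
  orbit-upTo (suc zero)    i le = cong (_∷ []) (sym (+-identityʳ i))
  orbit-upTo (suc (suc m)) i le = cong₂ _∷_ (sym (+-identityʳ i))
    (trans (cong (orbit (suc m)) (next-suc (≤-trans (s≤s (≤-trans (s≤s (m≤m+n i m)) (≤-reflexive (sym (+-suc i m))))) le′)))
    (trans (orbit-upTo (suc m) (suc i) le′) (applyUpTo-cong (λ j → sym (+-suc i j)) (suc m))))
    where
    le′ : suc i + suc m ≤ N
    le′ = subst (_≤ N) (+-suc i (suc m)) le

  orbit-all : orbit N 0 ≡ upTo N
  orbit-all = orbit-upTo N 0 ≤-refl

  reach : ∀ {i j} → i < N → j < N → ∃ λ a → a < N × iter a i ≡ j
  reach {i} {j} i<N j<N with i ≤? j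
  ... | yes i≤j = j ∸ i , ≤-<-trans (m∸n≤m j i) j<N , trans (iter-< (j ∸ i) (subst (_< N) (sym (m+[n∸m]≡n i≤j)) j<N)) (m+[n∸m]≡n i≤j)
  ... | no i≰j = (N ∸ i) + j , subst ((N ∸ i) + j <_) (N≡ i<N) (+-monoʳ-< (N ∸ i) (≰⇒> i≰j)) ,
                 trans (iter-+ (N ∸ i) j i) (trans (cong (iter j) (wrap i<N)) (iter-< j j<N))

  iter-bound : ∀ m {i} → i < N → iter m i < N
  iter-bound zero    i<N = i<N
  iter-bound (suc m) i<N = iter-bound m (next-< i<N)

module WhiteWalk {n N h R : ℕ} (L : Layout n N h R) (ℓ c : ℕ) (2≤ℓ : 2 ≤ ℓ) (2≤N : 2 ≤ N)
                 (E : List (Fin n) → Set) (edge⇒E : ∀ {f} → Construction.Edge L ℓ f → E f) where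
  open Construction L ℓ
  open Orbits N
  1≤ℓ : 1 ≤ ℓ
  1≤ℓ = ≤-trans (s≤s z≤n) 2≤ℓ
  open Paths {V} ℓ c 1≤ℓ E

  -- Both alternatives for a white edge pass to sublists, so the whole list may be tested instead of
  -- its windows.
  dense-white : ∀ {i} → i < N → ∀ xs → All (WhiteVertex i) xs → (All (¬_ ∘ D i) xs ⊎ count (¬? ∘ U? i) xs < ℓ) → Dense xs
  dense-white i<N []       _         _ = tt
  dense-white {i} i<N (x ∷ xs) ws@(_ ∷ ws′) z = (λ _ → edge⇒E (i , i<N , white (Allₚ.take⁺ k ws , head z))) , dense-white i<N xs ws′ (tail z)
    where
    head : (All (¬_ ∘ D i) (x ∷ xs) ⊎ count (¬? ∘ U? i) (x ∷ xs) < ℓ) → All (¬_ ∘ D i) (take k (x ∷ xs)) ⊎ count (¬? ∘ U? i) (take k (x ∷ xs)) < ℓ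
    head (inj₁ all) = inj₁ (Allₚ.take⁺ k all)
    head (inj₂ lt)  = inj₂ (≤-<-trans (count-take (¬? ∘ U? i) k (x ∷ xs)) lt)
    tail : (All (¬_ ∘ D i) (x ∷ xs) ⊎ count (¬? ∘ U? i) (x ∷ xs) < ℓ) → All (¬_ ∘ D i) xs ⊎ count (¬? ∘ U? i) xs < ℓ
    tail (inj₁ (_ ∷ all)) = inj₁ all
    tail (inj₂ lt)        = inj₂ (≤-<-trans (≤-trans (m≤n+m _ _) (≤-reflexive (sym (count-++ (¬? ∘ U? i) (x ∷ []) xs)))) lt)

  -- The `k` vertices of a single white part at either end are the overlap that `dense-glue`
  -- requires.
  record Run (i j : ℕ) (xs : List V) : Set where
    field
      dense          : Dense xs
      {front rest}   : List V
      {initial back} : List V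
      starts         : xs ≡ front ++ rest
      ends           : xs ≡ initial ++ back
      ∣front∣        : length front ≡ k
      ∣back∣         : length back ≡ k
      frontU         : All (U i) front
      backU          : All (U j) back

  -- Across the seam only `back` and `front` are seen. They lie in the same white part or in
  -- consecutive ones and contain no gadget vertex.
  join : ∀ {i j j′ l xs ys} → j < N → (j′ ≡ j ⊎ j′ ≡ nxt j) → Run i j xs → Run j′ l ys → Run i l (xs ++ ys)
  join {i} {j} {j′} {l} {xs} j<N adj r s = record
    { dense   = subst Dense (sym (cong₂ _++_ r.ends s.starts))
                  (subst Dense (sym (++-assoc r.initial r.back (s.front ++ s.rest)))
                    (dense-glue r.initial r.back (s.front ++ s.rest) (≤-reflexive (sym r.∣back∣)) (subst Dense r.ends r.dense)
                      (dense-glue r.back s.front s.rest (≤-reflexive (sym s.∣front∣)) middle (subst Dense s.starts s.dense))))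
    ; starts  = trans (cong (_++ _) r.starts) (++-assoc r.front r.rest _)
    ; initial = xs ++ s.initial
    ; ends    = trans (cong (xs ++_) s.ends) (sym (++-assoc xs s.initial s.back))
    ; ∣front∣ = r.∣front∣ ; ∣back∣ = s.∣back∣ ; frontU = r.frontU ; backU = s.backU }
    where
    module r = Run r
    module s = Run s
    entering : ∀ {x} → U j′ x → WhiteVertex j x
    entering {x} u = [ (λ eq → inj₁ (subst (λ m → U m x) eq u)) , (λ eq → inj₂ (inj₁ (subst (λ m → U m x) eq u))) ]′ adj
    middle : Dense (r.back ++ s.front)
    middle = dense-white j<N _ (Allₚ.++⁺ (All.map inj₁ r.backU) (All.map entering s.frontU))
               (inj₁ (Allₚ.++⁺ (All.map (U∌D {j} {j}) r.backU) (All.map (U∌D {j′} {j}) s.frontU)))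

  run-plain : ∀ {i xs} → i < N → All (U i) xs → k ≤ length xs → Run i i xs
  run-plain {i} {xs} i<N us le = record
    { dense   = dense-white i<N xs (All.map inj₁ us) (inj₁ (All.map (U∌D {i} {i}) us))
    ; starts  = sym (take++drop≡id k xs)
    ; ends    = sym (take++drop≡id (length xs ∸ k) xs)
    ; ∣front∣ = length-take-≤ k xs le
    ; ∣back∣  = trans (length-drop (length xs ∸ k) xs) (m∸[m∸n]≡n le)
    ; frontU  = Allₚ.take⁺ k us
    ; backU   = Allₚ.drop⁺ (length xs ∸ k) us }

  -- One gadget vertex follows each `k` white ones, so a window contains at most one of them, and
  -- `1 < ℓ`.
  interleave : List V → List V → List V
  interleave us []       = us
  interleave us (g ∷ gs) = take k us ++ g ∷ interleave (drop k us) gs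

  interleave-↭ : ∀ us gs → interleave us gs ↭ us ++ gs
  interleave-↭ us []       = ↭-reflexive (sym (++-identityʳ us))
  interleave-↭ us (g ∷ gs) = begin
    take k us ++ g ∷ interleave (drop k us) gs   ↭⟨ ↭ₚ.++⁺ˡ (take k us) (prep g (interleave-↭ (drop k us) gs)) ⟩
    take k us ++ g ∷ drop k us ++ gs             ↭⟨ ↭ₚ.++⁺ˡ (take k us) (↭-sym (↭ₚ.shift g (drop k us) gs)) ⟩
    take k us ++ drop k us ++ g ∷ gs             ≡⟨ sym (++-assoc (take k us) (drop k us) (g ∷ gs)) ⟩
    (take k us ++ drop k us) ++ g ∷ gs           ≡⟨ cong (_++ g ∷ gs) (take++drop≡id k us) ⟩
    us ++ g ∷ gs                                 ∎
    where open PermutationReasoning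

  run-interleave : ∀ {i} → i < N → ∀ us gs → All (U i) us → All (D i) gs → suc (length gs) * k ≤ length us → Run i i (interleave us gs)
  run-interleave i<N us [] all _ le = run-plain i<N all (≤-trans (≤-reflexive (sym (*-identityˡ k))) le)
  run-interleave {i} i<N us (g ∷ gs) all (dg ∷ ds) le = record
    { dense   = subst Dense (++-assoc (take k us) (g ∷ []) _) (subst (λ ys → Dense ((take k us ++ g ∷ []) ++ ys)) (sym r.starts)
                  (dense-glue (take k us ++ g ∷ []) r.front r.rest (≤-reflexive (sym r.∣front∣)) first (subst Dense r.starts r.dense)))
    ; starts  = refl
    ; initial = take k us ++ g ∷ r.initial
    ; ends    = trans (cong (λ ys → take k us ++ g ∷ ys) r.ends) (sym (++-assoc (take k us) (g ∷ r.initial) r.back))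
    ; ∣front∣ = length-take-≤ k us (≤-trans (m≤m+n k _) le)
    ; ∣back∣  = r.∣back∣ ; frontU = Allₚ.take⁺ k all ; backU = r.backU }
    where
    rec : Run i i (interleave (drop k us) gs)
    rec = run-interleave i<N (drop k us) gs (Allₚ.drop⁺ k all) ds
      (subst (suc (length gs) * k ≤_) (sym (length-drop k us)) (≤-trans (≤-reflexive (sym (m+n∸m≡n k (suc (length gs) * k)))) (∸-monoˡ-≤ k le)))
    module r = Run rec
    first : Dense ((take k us ++ g ∷ []) ++ r.front)
    first = dense-white i<N _ (Allₚ.++⁺ (Allₚ.++⁺ (All.map inj₁ (Allₚ.take⁺ k all)) (inj₂ (inj₂ dg) ∷ [])) (All.map inj₁ r.frontU)) (inj₂ few)
      where
      none : ∀ {ys} → All (U i) ys → count (¬? ∘ U? i) ys ≡ 0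
      none us = count-none (¬? ∘ U? i) (All.map (λ u ¬u → ¬u u) us)
      few : count (¬? ∘ U? i) ((take k us ++ g ∷ []) ++ r.front) < ℓ
      few = ≤-<-trans (≤-reflexive (trans (count-++ (¬? ∘ U? i) (take k us ++ g ∷ []) r.front)
              (trans (cong₂ _+_ (trans (count-++ (¬? ∘ U? i) (take k us) (g ∷ [])) (cong (_+ count (¬? ∘ U? i) (g ∷ [])) (none (Allₚ.take⁺ k all)))) (none r.frontU)) (+-identityʳ _))))
              (≤-<-trans (length-filter (¬? ∘ U? i) (g ∷ [])) 2≤ℓ)

  run-orbit : (F : ℕ → List V) → (∀ {i} → i < N → Run i i (F i)) → ∀ m {i} → i < N → Run i (iter m i) (concatMap F (orbit (suc m) i))
  run-orbit F run zero    {i} i<N = subst (Run i i) (sym (++-identityʳ (F i))) (run i<N)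
  run-orbit F run (suc m) i<N = join i<N (inj₂ refl) (run i<N) (run-orbit F run m (next-< i<N))

  whiteEnd-count : ∀ {α T} → length T ≡ ℓ → WhiteEnd α T → count (¬? ∘ U? α) T < ℓ
  whiteEnd-count {α} {T} len (_ , u) = subst (count (¬? ∘ U? α) T <_) len (count-not-all (¬? ∘ U? α) (Any.map (λ u ¬u → ¬u u) u))

  -- The walk first goes from the block of T to the block of S taking only k vertices of each block on its way (light), and then
  -- once around the whole ring taking everything that is left.
  module Fill (used : List V) (apex∈ : apex ∈ used)
              (roomy : ∀ {i} → i < N → suc (suc (count (D? i) (allFin n))) * k + length used ≤ count (U? i) (allFin n)) where

    used? : Decidable (λ x → ¬ (x ∈ used))
    used? x = ¬? (Any.any? (x ≟ᶠ_) used)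

    remaining : List V
    remaining = filter used? (allFin n)

    remaining-unique : Unique remaining
    remaining-unique = Uniqueₚ.filter⁺ used? (Uniqueₚ.allFin⁺ n)

    Us Ds light heavy : ℕ → List V
    Us i    = filter (U? i) remaining
    Ds i    = filter (D? i) remaining
    light i = take k (Us i)
    heavy i = interleave (drop k (Us i)) (Ds i)

    Us⊆U : ∀ i → All (U i) (Us i)
    Us⊆U i = Allₚ.all-filter (U? i) remaining

    ∣Ds∣ : ∀ i → length (Ds i) ≤ count (D? i) (allFin n)
    ∣Ds∣ i = unique-⊆⇒length≤ (Uniqueₚ.filter⁺ (D? i) remaining-unique)
      λ {x} x∈ → ∈-filter⁺ (D? i) (∈-allFin x) (proj₂ (∈-filter⁻ (D? i) {xs = remaining} x∈))

    ∣Us∣ : ∀ {i} → i < N → suc (suc (length (Ds i))) * k ≤ length (Us i)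
    ∣Us∣ {i} i<N = ≤-trans (*-monoˡ-≤ k (s≤s (s≤s (∣Ds∣ i)))) (+-cancelʳ-≤ (length used) _ _ (≤-trans (roomy i<N)
      (≤-trans (unique-⊆⇒length≤ {ys = Us i ++ used} (Uniqueₚ.filter⁺ (U? i) (Uniqueₚ.allFin⁺ n)) place) (≤-reflexive (length-++ (Us i))))))
      where
      place : ∀ {x} → x ∈ filter (U? i) (allFin n) → x ∈ Us i ++ used
      place {x} x∈ with Any.any? (x ≟ᶠ_) used
      ... | yes p = ∈-++⁺ʳ (Us i) p
      ... | no ¬p = ∈-++⁺ˡ (∈-filter⁺ (U? i) (∈-filter⁺ used? (∈-allFin x) ¬p) (proj₂ (∈-filter⁻ (U? i) {xs = allFin n} x∈)))

    run-light : ∀ {i} → i < N → Run i i (light i)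
    run-light {i} i<N = run-plain i<N (Allₚ.take⁺ k (Us⊆U i)) (≤-reflexive (sym (length-take-≤ k (Us i) (≤-trans (m≤m+n k _) (∣Us∣ i<N)))))

    run-heavy : ∀ {i} → i < N → Run i i (heavy i)
    run-heavy {i} i<N = run-interleave i<N (drop k (Us i)) (Ds i) (Allₚ.drop⁺ k (Us⊆U i)) (Allₚ.all-filter (D? i) remaining)
      (subst (suc (length (Ds i)) * k ≤_) (sym (length-drop k (Us i)))
        (≤-trans (≤-reflexive (sym (m+n∸m≡n k (suc (length (Ds i)) * k)))) (∸-monoˡ-≤ k (∣Us∣ i<N))))

    block : ℕ → List V
    block i = light i ++ heavy i

    run-block : ∀ {i} → i < N → Run i i (block i)
    run-block i<N = join i<N (inj₁ refl) (run-light i<N) (run-heavy i<N)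

    block-↭ : ∀ i → block i ↭ Us i ++ Ds i
    block-↭ i = ↭-trans (↭ₚ.++⁺ˡ (light i) (interleave-↭ (drop k (Us i)) (Ds i)))
      (↭-reflexive (trans (sym (++-assoc (light i) (drop k (Us i)) (Ds i))) (cong (_++ Ds i) (take++drop≡id k (Us i)))))

    remaining-↭ : concatMap (λ i → Us i ++ Ds i) (upTo N) ↭ remaining
    remaining-↭ = unique-set⇒↭ (concatMap-unique _ (Uniqueₚ.upTo⁺ N) (λ {i} _ → uniqueBlock i) (λ _ _ → sameBlock)) remaining-unique sound complete
      where
      inBlock : ∀ {x} i → x ∈ Us i ++ Ds i → x ∈ remaining × (U i x ⊎ D i x)
      inBlock i x∈ with ∈-++⁻ (Us i) x∈
      ... | inj₁ p = let (r , u) = ∈-filter⁻ (U? i) {xs = remaining} p in r , inj₁ u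
      ... | inj₂ p = let (r , u) = ∈-filter⁻ (D? i) {xs = remaining} p in r , inj₂ u
      uniqueBlock : ∀ i → Unique (Us i ++ Ds i)
      uniqueBlock i = Uniqueₚ.++⁺ (Uniqueₚ.filter⁺ (U? i) remaining-unique) (Uniqueₚ.filter⁺ (D? i) remaining-unique)
        λ (p , q) → U∌D {i} {i} (proj₂ (∈-filter⁻ (U? i) {xs = remaining} p)) (proj₂ (∈-filter⁻ (D? i) {xs = remaining} q))
      sameBlock : ∀ {i j x} → x ∈ Us i ++ Ds i → x ∈ Us j ++ Ds j → i ≡ j
      sameBlock {i} {j} p q with proj₂ (inBlock i p) | proj₂ (inBlock j q)
      ... | inj₁ (b , _) | inj₁ (b′ , _) = trans (sym b) b′
      ... | inj₁ u | inj₂ v = ⊥-elim (U∌D {i} {j} u v)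
      ... | inj₂ v | inj₁ u = ⊥-elim (U∌D {j} {i} u v)
      ... | inj₂ (b , _) | inj₂ (b′ , _) = next-injective N (trans (sym b) b′)
      sound : ∀ {x} → x ∈ concatMap (λ i → Us i ++ Ds i) (upTo N) → x ∈ remaining
      sound x∈ = let (i , _ , x∈i) = find (∈-concatMap⁻ (λ i → Us i ++ Ds i) {xs = upTo N} x∈) in proj₁ (inBlock i x∈i)
      complete : ∀ {x} → x ∈ remaining → x ∈ concatMap (λ i → Us i ++ Ds i) (upTo N)
      complete {x} x∈ with row x <? h
      ... | no r≮ = ∈-concatMap⁺ (λ i → Us i ++ Ds i) (lose (∈-upTo⁺ bag<) (∈-++⁺ˡ (∈-filter⁺ (U? (bag x)) x∈ (refl , ≮⇒≥ r≮))))
        where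
        bag< : bag x < N
        bag< = bag≢apex λ { refl → proj₂ (∈-filter⁻ used? {xs = allFin n} x∈) apex∈ }
      ... | yes r< with previous {N} {bag x} (bag≢apex λ { refl → proj₂ (∈-filter⁻ used? {xs = allFin n} x∈) apex∈ })
      ...   | i , i< , ni = ∈-concatMap⁺ (λ i → Us i ++ Ds i) (lose (∈-upTo⁺ i<) (∈-++⁺ʳ (Us i) (∈-filter⁺ (D? i) x∈ (sym ni , r<))))

    fill : ∀ {α β} → α < N → β < N → ∃ λ M → M ↭ remaining × Run α β M
    fill {α} {β} α<N β<N with reach (next-< β<N) α<N
    -- Read from `s`, the bag after `β`, the ring is `pre`, up to the bag before `α`, and then `js`,
    -- from `α` to `β`. The bags of `js` are passed twice, those of `pre` once.
    ... | a , a<N , refl = concatMap light js ++ concatMap block pre ++ concatMap heavy js , perm , run a refl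
      where
      s = next N β
      s<N : s < N
      s<N = next-< β<N
      b = N ∸ suc a
      a+b : a + suc b ≡ N
      a+b = trans (+-suc a b) (m+[n∸m]≡n a<N)
      pre = orbit a s
      js = orbit (suc b) (iter a s)
      ring : orbit N s ≡ pre ++ js
      ring = trans (cong (λ m → orbit m s) (sym a+b)) (orbit-+ a (suc b) s)
      last≡ : iter b (iter a s) ≡ β
      last≡ = next-injective N (trans (sym (iter-next b (iter a s))) (trans (sym (iter-+ a (suc b) s)) (trans (cong (λ m → iter m s) a+b) (iter-N s<N))))
      α′<N : iter a s < N
      α′<N = iter-bound a s<N
      lightRun : Run (iter a s) β (concatMap light js)
      lightRun = subst (λ j → Run (iter a s) j (concatMap light js)) last≡ (run-orbit light run-light b α′<N)
      heavyRun : Run (iter a s) β (concatMap heavy js)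
      heavyRun = subst (λ j → Run (iter a s) j (concatMap heavy js)) last≡ (run-orbit heavy run-heavy b α′<N)
      -- If `α` is the bag after `β`, then `pre` is empty and the two passes through `js` join
      -- directly; a `Run` is never empty.
      run : ∀ m → m ≡ a → Run (iter a s) β (concatMap light js ++ concatMap block (orbit m s) ++ concatMap heavy js)
      run zero refl    = join β<N (inj₂ refl) lightRun heavyRun
      run (suc m) refl = join β<N (inj₂ refl) lightRun (join (iter-bound m s<N) (inj₂ (iter-next m s)) (run-orbit block run-block m s<N) heavyRun)
      perm : concatMap light js ++ concatMap block pre ++ concatMap heavy js ↭ remaining
      perm = begin
        concatMap light js ++ concatMap block pre ++ concatMap heavy js   ↭⟨ ↭ₚ.shifts (concatMap light js) (concatMap block pre) ⟩
        concatMap block pre ++ concatMap light js ++ concatMap heavy js   ↭⟨ ↭ₚ.++⁺ˡ (concatMap block pre) (concatMap-++-↭ light heavy js) ⟩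
        concatMap block pre ++ concatMap block js                         ≡⟨ sym (concatMap-++ block pre js) ⟩
        concatMap block (pre ++ js)                                       ≡⟨ cong (concatMap block) (sym ring) ⟩
        concatMap block (orbit N s)                                       ↭⟨ concatMap-↭ block (orbit-N s<N) ⟩
        concatMap block (orbit N 0)                                       ≡⟨ cong (concatMap block) orbit-all ⟩
        concatMap block (upTo N)                                          ↭⟨ concatMap-cong-↭ block-↭ (upTo N) ⟩
        concatMap (λ i → Us i ++ Ds i) (upTo N)                           ↭⟨ remaining-↭ ⟩
        remaining                                                         ∎
        where open PermutationReasoning

    -- One vertex of `U α` in `T` leaves fewer than `ℓ` vertices of `T` outside `U α`, and the
    -- adjoining end of the walk adds none; the same holds for `S` and `β`.
    fill-ends : ∀ {α β S T} → α < N → β < N → length S ≡ ℓ → length T ≡ ℓ → WhiteEnd α T → WhiteEnd β S →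
                ∃ λ M → M ↭ remaining × Dense (T ++ M ++ S)
    fill-ends {α} {β} {S} {T} α<N β<N ∣S∣ ∣T∣ endT endS with fill α<N β<N
    ... | M , perm , r = M , perm , subst (λ xs → Dense (T ++ xs ++ S)) (sym r.starts)
          (subst (λ xs → Dense (T ++ xs)) (sym (++-assoc r.front r.rest S))
            (dense-glue T r.front (r.rest ++ S) (≤-reflexive (sym r.∣front∣)) leaving
              (subst Dense (trans (cong (_++ S) r.starts) (++-assoc r.front r.rest S)) arriving)))
      where
      module r = Run r
      no-others : ∀ {γ ys} → All (U γ) ys → count (¬? ∘ U? γ) ys ≡ 0
      no-others {γ} us = count-none (¬? ∘ U? γ) (All.map (λ u ¬u → ¬u u) us)
      leaving : Dense (T ++ r.front)
      leaving = dense-white α<N _ (Allₚ.++⁺ (proj₁ endT) (All.map inj₁ r.frontU)) (inj₂ (subst (_< ℓ)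
        (sym (trans (count-++ (¬? ∘ U? α) T r.front) (trans (cong (count (¬? ∘ U? α) T +_) (no-others r.frontU)) (+-identityʳ _)))) (whiteEnd-count ∣T∣ endT)))
      ending : Dense (r.back ++ S)
      ending = dense-white β<N _ (Allₚ.++⁺ (All.map inj₁ r.backU) (proj₁ endS)) (inj₂ (subst (_< ℓ)
        (sym (trans (count-++ (¬? ∘ U? β) r.back S) (cong (_+ count (¬? ∘ U? β) S) (no-others r.backU)))) (whiteEnd-count ∣S∣ endS)))
      arriving : Dense (M ++ S)
      arriving = subst (λ xs → Dense (xs ++ S)) (sym r.ends) (subst Dense (sym (++-assoc r.initial r.back S))
        (dense-glue r.initial r.back S (≤-reflexive (sym r.∣back∣)) (subst Dense r.ends r.dense) ending))

-- Concentrated sets and the ends of an edge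

module Badness {n N h R : ℕ} (L : Layout n N h R) (ℓ c : ℕ) where
  open Construction L ℓ

  Near Close : ℕ → V → Set
  Near j x  = bag x ≡ j ⊎ bag x ≡ nxt j
  Close j x = bag x ≡ N ⊎ Near j x

  near? : ∀ j → Decidable (Near j)
  near? j x = (bag x ≟ j) ⊎-dec (bag x ≟ nxt j)

  close? : ∀ j → Decidable (Close j)
  close? j x = (bag x ≟ N) ⊎-dec near? j x

  -- The last bag is included because it precedes the first one in the ring, and so is not far from it.
  NearTwo : ℕ → ℕ → V → Set
  NearTwo a y x = Near a x ⊎ Near y x ⊎ suc (bag x) ≡ N

  nearTwo? : ∀ a y → Decidable (NearTwo a y)
  nearTwo? a y x = near? a x ⊎-dec (near? y x ⊎-dec (suc (bag x) ≟ N))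

  -- A concentrated set has at most `ℓ - 1` vertices outside a place given by one parameter `j`. A
  -- local set is confined to a bounded place given by two parameters, and `n ^ 2 ≤ n ^ ℓ`.
  Concentrated Local Bad : List V → Set
  Concentrated f = ∃ λ j → j < N × ℓ + c < count (close? j) f
  Local f        = ∃ λ a → a < N × ∃ λ y → y < N × All (NearTwo a y) f
  Bad f          = Concentrated f ⊎ Local f

  bad? : ∀ f → Dec (Bad f)
  bad? f = anyUpTo? (λ j → ℓ + c <? count (close? j) f) N ⊎-dec
           anyUpTo? (λ a → anyUpTo? (λ y → All.all? (nearTwo? a y) f) N) N

  count-all : ∀ {P : V → Set} (P? : Decidable P) {f} → All P f → count P? f ≡ length f
  count-all P? ps = cong length (filter-all P? ps)

  count-⊆ : ∀ {P Q : V → Set} (P? : Decidable P) (Q? : Decidable Q) → (∀ {x} → P x → Q x) → ∀ f → count P? f ≤ count Q? f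
  count-⊆ P? Q? P⇒Q []       = z≤n
  count-⊆ P? Q? P⇒Q (x ∷ f) with P? x | Q? x
  ... | yes p | yes q = s≤s (count-⊆ P? Q? P⇒Q f)
  ... | yes p | no ¬q = contradiction (P⇒Q p) ¬q
  ... | no _  | yes q = m≤n⇒m≤1+n (count-⊆ P? Q? P⇒Q f)
  ... | no _  | no _  = count-⊆ P? Q? P⇒Q f

  count-complement : ∀ {P : V → Set} (P? : Decidable P) f → count P? f + count (¬? ∘ P?) f ≡ length f
  count-complement P? []       = refl
  count-complement P? (x ∷ f) with P? x
  ... | yes _ = cong suc (count-complement P? f)
  ... | no _  = trans (+-suc _ _) (cong suc (count-complement P? f))

  edge⇒bad : 1 ≤ ℓ → 2 ≤ N → ∀ {f} → Unique f → length f ≡ ℓ + c + ℓ → Edge f → Bad f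
  edge⇒bad 1≤ℓ 2≤N {f} uf ∣f∣ (i , i<N , edge) = inj₁ (go edge)
    where
    everything : ∀ j → All (Close j) f → ℓ + c < count (close? j) f
    everything j all = ≤-trans (m<m+n (ℓ + c) 1≤ℓ) (≤-reflexive (trans (sym ∣f∣) (sym (count-all (close? j) all))))
    most : ∀ j → count (¬? ∘ close? j) f < ℓ → ℓ + c < count (close? j) f
    most j lt = +-cancelʳ-≤ ℓ _ _ (≤-trans (s≤s (≤-reflexive (sym (trans (count-complement (close? j) f) ∣f∣))))
      (≤-trans (≤-reflexive (sym (+-suc _ _))) (+-monoʳ-≤ _ lt)))
    go : EdgeAt i f → Concentrated f
    go (white (w , _)) = i , i<N , everything i (All.map (λ { (inj₁ (b , _)) → inj₂ (inj₁ b) ; (inj₂ (inj₁ (b , _))) → inj₂ (inj₂ b) ; (inj₂ (inj₂ (b , _))) → inj₂ (inj₂ b) }) w)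
    go (rowPort _ (w , _)) = i , i<N , everything i (All.map (λ { (inj₁ (b , _)) → inj₂ (inj₁ b) ; (inj₂ (b , _)) → inj₂ (inj₂ b) }) w)
    go (colPort _ (w , _)) = i , i<N , everything i (All.map (λ { (inj₁ b) → inj₁ b ; (inj₂ (_ , inj₁ (b , _))) → inj₂ (inj₂ b) ; (inj₂ (_ , inj₂ (b , _))) → inj₂ (inj₁ b) }) w)
    go (gadget (_ , le , extra)) = nxt i , next-< i<N , most (nxt i) (few extra)
      where
      far⇒¬D : ∀ {x} → ¬ Close (nxt i) x → ¬ D i x
      far⇒¬D ¬close (b , _) = ¬close (inj₂ (inj₁ b))
      few : (count (¬? ∘ D? i) f < ℓ ⊎ (Any (U (nxt i)) f × Any (Far i) f)) → count (¬? ∘ close? (nxt i)) f < ℓ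
      few (inj₁ lt) = ≤-<-trans (count-⊆ (¬? ∘ close? (nxt i)) (¬? ∘ D? i) far⇒¬D f) lt
      -- Up to `ℓ` vertices may lie outside `D i`, but the vertex in `U (nxt i)` is one of these and
      -- is close, so fewer than `ℓ` are not close.
      few (inj₂ (u , _)) with find u
      ... | x , x∈ , (b , h≤) = ≤-trans (unique-⊆⇒length≤ {xs = x ∷ filter (¬? ∘ close? (nxt i)) f} {filter (¬? ∘ D? i) f}
              (Allₚ.¬Any⇒All¬ _ (λ x∈′ → proj₂ (∈-filter⁻ (¬? ∘ close? (nxt i)) {xs = f} x∈′) (inj₂ (inj₁ b))) ∷ Uniqueₚ.filter⁺ (¬? ∘ close? (nxt i)) uf)
              λ { (here refl) → ∈-filter⁺ (¬? ∘ D? i) x∈ (λ (_ , r<) → <⇒≱ r< h≤)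
                ; (there y∈) → let (y∈f , ¬close) = ∈-filter⁻ (¬? ∘ close? (nxt i)) {xs = f} y∈ in ∈-filter⁺ (¬? ∘ D? i) y∈f (far⇒¬D ¬close) }) le

split-ends : ∀ {A : Set} (ℓ m : ℕ) (xs : List A) → 1 ≤ ℓ → length xs ≡ ℓ + m + ℓ →
             ∃ λ x → ∃ λ L → ∃ λ I → ∃ λ z → ∃ λ S → xs ≡ (x ∷ L) ++ I ++ z ∷ S × length (x ∷ L) ≡ ℓ × length I ≡ m × length (z ∷ S) ≡ ℓ
split-ends ℓ m xs 1≤ℓ len with take ℓ xs in eqL | drop m (drop ℓ xs) in eqS
... | [] | _ = contradiction (≤-trans 1≤ℓ (≤-reflexive (trans (sym (length-take-≤ ℓ xs ℓ≤)) (cong length eqL)))) λ ()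
  where
  ℓ≤ : ℓ ≤ length xs
  ℓ≤ = ≤-trans (m≤n+m ℓ (ℓ + m)) (≤-reflexive (sym len))
... | _ ∷ _ | [] = contradiction (≤-trans 1≤ℓ (≤-reflexive (trans (sym ∣S∣) (cong length eqS)))) λ ()
  where
  ∣S∣ : length (drop m (drop ℓ xs)) ≡ ℓ
  ∣S∣ = trans (length-drop m (drop ℓ xs)) (trans (cong (_∸ m) (trans (length-drop ℓ xs) (trans (cong (_∸ ℓ) (trans len (+-assoc ℓ m ℓ))) (m+n∸m≡n ℓ (m + ℓ))))) (m+n∸m≡n m ℓ))
... | x ∷ L′ | z ∷ S = x , L′ , take m (drop ℓ xs) , z , S ,
      trans (sym (take++drop≡id ℓ xs)) (cong₂ _++_ eqL (trans (sym (take++drop≡id m (drop ℓ xs))) (cong (take m (drop ℓ xs) ++_) eqS))) ,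
      trans (cong length (sym eqL)) (length-take-≤ ℓ xs (≤-trans (m≤n+m ℓ (ℓ + m)) (≤-reflexive (sym len)))) ,
      length-take-≤ m (drop ℓ xs) (≤-trans (m≤m+n m ℓ) (≤-reflexive (sym rest))) ,
      trans (cong length (sym eqS)) (trans (length-drop m (drop ℓ xs)) (trans (cong (_∸ m) rest) (m+n∸m≡n m ℓ)))
  where
  rest : length (drop ℓ xs) ≡ m + ℓ
  rest = trans (length-drop ℓ xs) (trans (cong (_∸ ℓ) (trans len (+-assoc ℓ m ℓ))) (m+n∸m≡n ℓ (m + ℓ)))

-- Choosing disjoint `ℓ`-subsets of different colours

module Selecting {n N h R : ℕ} (L : Layout n N h R) (ℓ : ℕ) (2≤N : 2 ≤ N) where
  open Construction L ℓ

  End : ℕ → List V → Set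
  End i S = WhiteEnd (nxt i) S ⊎ GadgetEnd i S

  -- The clause `bag x ≢ i` says more than the bound on bags only at the seam, where `i` is the last
  -- bag and `nxt i` is 0.
  Leading : ℕ → List V → Set
  Leading i S = All (λ x → nxt i ≤ bag x × bag x < N × bag x ≢ i) S × Any (λ x → bag x ≡ nxt i) S

  leading-Ok : ∀ {i x} → nxt i ≤ bag x × bag x < N × bag x ≢ i → Ok i x
  leading-Ok (le , lt , ≢i) = le , lt , ≢i ∘ proj₁

  -- Without a vertex of `D i`, the vertex in bag `nxt i` is in `U (nxt i)`. If some vertex is far,
  -- this is a gadget end; otherwise `S` lies in two consecutive bags outside `D i`, where every
  -- vertex is white for `nxt i`.
  classify : ∀ {i S} → Leading i S → End i S
  classify {i} {S} (all , first) with Any.any? (D? i) S | Any.any? (Far? i) S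
  ... | yes d | _ = inj₂ (All.map leading-Ok all , inj₁ d)
  ... | no ¬d | far with find first
  ...   | x , x∈ , b with row x <? h
  ...     | yes r< = contradiction (lose x∈ (b , r<)) ¬d
  ...     | no r≮ with far
  ...       | yes f = inj₂ (All.map leading-Ok all , inj₂ (lose x∈ (b , ≮⇒≥ r≮) , f))
  ...       | no ¬f = inj₁ (All.tabulate here-white , lose x∈ (b , ≮⇒≥ r≮))
    where
    here-white : ∀ {y} → y ∈ S → WhiteVertex (nxt i) y
    here-white {y} y∈ with bag y ≟ nxt i | bag y ≟ nxt (nxt i) | row y <? h
    ... | yes b | _     | yes r< = contradiction (lose y∈ (b , r<)) ¬d
    ... | yes b | _     | no r≮  = inj₁ (b , ≮⇒≥ r≮)
    ... | no _  | yes b | no r≮  = inj₂ (inj₁ (b , ≮⇒≥ r≮))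
    ... | no _  | yes b | yes r< = inj₂ (inj₂ (b , r<))
    ... | no ≢  | no ≢′ | _      = contradiction (lose y∈ (≢ , ≢′)) ¬f

  record Selection (m : ℕ) (xs : List V) : Set where
    field
      x₁        : V
      L′ I S′   : List V
      split     : xs ≡ (x₁ ∷ L′) ++ I ++ S′
      ∣L∣       : length (x₁ ∷ L′) ≡ ℓ
      ∣I∣       : length I ≡ m
      ∣S′∣      : length S′ ≡ ℓ
      i i′      : ℕ
      i<N       : i < N
      i′<N      : i′ < N
      i≢i′      : i ≢ i′
      bag-x₁    : bag x₁ ≡ nxt i
      leadingL  : Leading i (x₁ ∷ L′)
      leadingS′ : Leading i′ S′
      above     : ∀ {x} → x ∈ xs → nxt i ≤ bag x × bag x < N

  next-cases : ∀ i → (suc i ≡ N × nxt i ≡ 0) ⊎ nxt i ≡ suc i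
  next-cases i with suc i ≟ N
  ... | yes eq = inj₁ (eq , refl)
  ... | no _   = inj₂ refl

  sorted-++ : ∀ (xs : List V) {ys} → AllPairs (λ x y → bag x ≤ bag y) (xs ++ ys) → ∀ {x y} → x ∈ xs → y ∈ ys → bag x ≤ bag y
  sorted-++ (x ∷ xs) (p ∷ s) (here refl) y∈ = All.lookup p (∈-++⁺ʳ xs y∈)
  sorted-++ (x ∷ xs) (p ∷ s) (there x∈)  y∈ = sorted-++ xs s x∈ y∈

  module _ (m : ℕ) (x₁ : V) (L′ I : List V) (z : V) (S₀ : List V) where
    private
      L₁ = x₁ ∷ L′
      S′ = z ∷ S₀
      xs = L₁ ++ I ++ S′

    selection : All (λ x → bag x < N) xs → AllPairs (λ x y → bag x ≤ bag y) xs →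
                length L₁ ≡ ℓ → length I ≡ m → length S′ ≡ ℓ →
                (∀ {j} → j < N → count (λ x → bag x ≟ j) xs ≤ ℓ + m) → Selection m xs
    selection bags sorted ∣L∣ ∣I∣ ∣S′∣ bound with previous (All.lookup bags {x₁} (here refl)) | previous (All.lookup bags {z} (∈-++⁺ʳ L₁ (∈-++⁺ʳ I (here refl))))
    ... | i , i<N , ni | i′ , i′<N , ni′ = record
        { x₁ = x₁ ; L′ = L′ ; I = I ; S′ = S′ ; split = refl ; ∣L∣ = ∣L∣ ; ∣I∣ = ∣I∣ ; ∣S′∣ = ∣S′∣ ; i<N = i<N ; i′<N = i′<N
        ; i≢i′ = λ { refl → x₁≢z (trans (sym ni) ni′) } ; bag-x₁ = sym ni
        ; leadingL = All.tabulate (λ w∈ → let (a , b) = above (∈-++⁺ˡ w∈) in a , b , notL w∈) , here (sym ni)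
        ; leadingS′ = All.tabulate (λ w∈ → subst (_≤ _) (sym ni′) (z≤ w∈) , All.lookup bags (inS w∈) , notS w∈) , here (sym ni′)
        ; above = above }
      where
      inS : ∀ {x} → x ∈ S′ → x ∈ xs
      inS x∈ = ∈-++⁺ʳ L₁ (∈-++⁺ʳ I x∈)
      x₁≤ : ∀ {x} → x ∈ xs → bag x₁ ≤ bag x
      x₁≤ (here refl) = ≤-refl
      x₁≤ (there x∈) = All.lookup (AllPairs.head sorted) x∈
      above : ∀ {x} → x ∈ xs → nxt i ≤ bag x × bag x < N
      above x∈ = subst (_≤ _) (sym ni) (x₁≤ x∈) , All.lookup bags x∈
      sorted′ : AllPairs (λ x y → bag x ≤ bag y) ((L₁ ++ I) ++ S′)
      sorted′ = subst (AllPairs _) (sym (++-assoc L₁ I S′)) sorted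
      drop-sorted : ∀ (xs : List V) {ys} → AllPairs (λ x y → bag x ≤ bag y) (xs ++ ys) → AllPairs (λ x y → bag x ≤ bag y) ys
      drop-sorted []       s       = s
      drop-sorted (x ∷ xs) (_ ∷ s) = drop-sorted xs s
      z≤ : ∀ {x} → x ∈ S′ → bag z ≤ bag x
      z≤ (here refl) = ≤-refl
      z≤ (there x∈) = All.lookup (AllPairs.head (drop-sorted (L₁ ++ I) sorted′)) x∈
      too-many : ∀ {j} → j < N → ∀ as ys bs → xs ≡ as ++ ys ++ bs → ℓ + m < length ys → All (λ x → bag x ≡ j) ys → ⊥
      too-many {j} j<N as ys bs eq lt all = <⇒≱ lt (≤-trans (≤-trans (≤-reflexive (sym (cong length (filter-all j? all))))
        (≤-trans (m≤m+n _ (count j? bs)) (≤-trans (≤-reflexive (sym (count-++ j? ys bs))) (≤-trans (m≤n+m _ (count j? as)) (≤-reflexive (trans (sym (count-++ j? as (ys ++ bs))) (cong (count j?) (sym eq)))))))) (bound j<N))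
        where
        j? = λ x → bag x ≟ j
      -- Otherwise the sorted order puts `L₁`, `I` and `z` into one bag, which is one vertex more
      -- than `bound` allows.
      x₁≢z : bag x₁ ≢ bag z
      x₁≢z eq = too-many (All.lookup bags (here refl)) [] ((L₁ ++ I) ++ z ∷ []) S₀ (trans (sym (++-assoc L₁ I S′)) (sym (++-assoc (L₁ ++ I) (z ∷ []) S₀)))
        (≤-reflexive (sym (trans (length-++ (L₁ ++ I)) (trans (+-comm _ 1) (cong suc (trans (length-++ L₁) (cong₂ _+_ ∣L∣ ∣I∣)))))))
        (Allₚ.++⁺ (All.tabulate λ {w} w∈ → ≤-antisym (≤-trans (sorted-++ (L₁ ++ I) sorted′ w∈ (here refl)) (≤-reflexive (sym eq)))
          (x₁≤ (subst (w ∈_) (++-assoc L₁ I S′) (∈-++⁺ˡ w∈)))) (sym eq ∷ []))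
      notL : ∀ {w} → w ∈ L₁ → bag w ≢ i
      notL {w} w∈ refl with next-cases i
      ... | inj₂ ns = <⇒≱ (≤-reflexive (sym (trans (sym ni) ns))) (x₁≤ (∈-++⁺ˡ w∈))
      -- Here `i` is the last bag, so `w` and everything after it, including `I` and `S′`, is in
      -- that bag: at least `ℓ + m + 1` vertices.
      ... | inj₁ (N≡ , _) with ∈-∃++ w∈
      ...   | as , bs , L≡ = too-many i<N as ys [] whole enough (All.tabulate λ v∈ →
                ≤-antisym (s≤s⁻¹ (subst (bag _ <_) (sym N≡) (All.lookup bags (subst (_ ∈_) (sym whole) (∈-++⁺ʳ as (∈-++⁺ˡ v∈)))))) (after v∈))
        where
        ys = (w ∷ bs) ++ I ++ S′
        whole : xs ≡ as ++ ys ++ []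
        whole = trans (cong (_++ I ++ S′) L≡) (trans (++-assoc as (w ∷ bs) (I ++ S′)) (cong (as ++_) (sym (++-identityʳ ys))))
        enough : ℓ + m < length ys
        enough = s≤s (≤-trans (≤-reflexive (sym (trans (length-++ I) (trans (cong₂ _+_ ∣I∣ ∣S′∣) (+-comm m ℓ)))))
                   (≤-trans (m≤n+m _ (length bs)) (≤-reflexive (sym (length-++ bs)))))
        after : ∀ {v} → v ∈ ys → bag w ≤ bag v
        after (here refl) = ≤-refl
        after (there v∈) = All.lookup (AllPairs.head (drop-sorted as (subst (AllPairs _) (trans whole (cong (as ++_) (++-identityʳ ys))) sorted))) v∈
      notS : ∀ {w} → w ∈ S′ → bag w ≢ i′
      notS {w} w∈ refl with next-cases i′
      ... | inj₂ ns = <⇒≱ (≤-reflexive (sym (trans (sym ni′) ns))) (z≤ w∈)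
      -- Here `z` is in bag 0, and then so is `x₁`, which precedes it.
      ... | inj₁ (_ , n0) = x₁≢z (≤-antisym (x₁≤ (inS (here refl))) (≤-trans (≤-reflexive (trans (sym ni′) n0)) z≤n))

  select : ∀ m (xs : List V) → 1 ≤ ℓ → length xs ≡ ℓ + m + ℓ → All (λ x → bag x < N) xs → AllPairs (λ x y → bag x ≤ bag y) xs →
           (∀ {j} → j < N → count (λ x → bag x ≟ j) xs ≤ ℓ + m) → Selection m xs
  select m xs 1≤ℓ len bags sorted bound with split-ends ℓ m xs 1≤ℓ len
  ... | x , L′ , I , z , S , refl , ∣L∣ , ∣I∣ , ∣S∣ = selection m x L′ I z S bags sorted ∣L∣ ∣I∣ ∣S∣ bound

-- Closing a cycle through a new edge

module Closing {n N h R : ℕ} (L : Layout n N h R) (ℓ c : ℕ) (2≤ℓ : 2 ≤ ℓ) (1≤c : 1 ≤ c) (k≡ : ℓ + c + ℓ ≡ suc (suc h))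
               (2≤N : 2 ≤ N) (h<R : suc (suc (suc (suc (h + h)))) < R)
               (roomy : ∀ {i} → i < N → suc (suc (count (Construction.D? L ℓ i) (allFin n))) * (ℓ + c + ℓ) +
                                        (ℓ + c + ℓ + ((ℓ + c + (ℓ + c)) + (ℓ + c + (ℓ + c)))) ≤ count (Construction.U? L ℓ i) (allFin n))
               (e₀ : Subset n) (∣e₀∣ : ∣ e₀ ∣ ≡ ℓ + c + ℓ) where
  open Construction L ℓ

  e : List V
  e = elements e₀

  E : List V → Set
  E f = Edge f ⊎ setOf f ≡ e₀

  E-↭ : ∀ {f g} → f ↭ g → E f → E g
  E-↭ p (inj₁ edge) = inj₁ (edge-↭ p edge)
  E-↭ p (inj₂ eq)   = inj₂ (trans (sym (setOf-resp-↭ p)) eq)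

  open WhiteWalk L ℓ c 2≤ℓ 2≤N E inj₁
  open Paths {V} ℓ c 1≤ℓ E
  open Reversal E-↭

  ∣e∣ : length e ≡ k
  ∣e∣ = trans (length-elements e₀) ∣e₀∣

  -- A continuation of one end of the new edge to a white end. The zone `Z` serves to keep the two
  -- tails disjoint; a tail has at most two edges, hence the bound `d + d`.
  record Tail (Z : V → Set) (S : List V) : Set where
    field
      {α}      : ℕ
      {added}  : List V
      {T}      : List V
      α<N      : α < N
      path     : Path S added T
      whiteEnd : WhiteEnd α T
      unique   : Unique added
      zone     : All Z added
      fresh    : ∀ {x} → x ∈ added → x ∉ e
      short    : length added ≤ d + d

  module _ {q : ℕ} {{_ : NonZero n}} {{_ : NonZero (k ∸ ℓ)}} (n≡ : n ≡ q * d) (k≤n : k ≤ n) where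

    -- The cycle runs backwards through the first tail, crosses the new edge, follows the second
    -- tail, and returns by a white walk through all remaining vertices. As white walks cannot visit
    -- the apex, it must be in the edge or in a tail.
    assemble : ∀ {Z Z′ S I S′} → (∀ {x} → Z x → Z′ x → ⊥) → length I ≡ c → (S ++ I ++ S′ ↭ e) →
               (t : Tail Z S) (t′ : Tail Z′ S′) → apex ∈ e ++ Tail.added t ++ Tail.added t′ →
               ∀ (e₀∉ : e₀ ∉ edges (graph k)) → Hamiltonian ℓ (addEdge (graph k) e₀ ∣e₀∣ e₀∉)
    assemble {Z} {Z′} {S} {I} {S′} disjoint ∣I∣ split t t′ apex∈ e₀∉ = fromOrder (addEdge (graph k) e₀ ∣e₀∣ e₀∉)
      (subst (λ D → ∃ λ w → Injective _≡_ _≡_ (Vec.lookup w) × (∀ (r : Fin q) → cycleEdge k D (Vec.lookup w) (toℕ r) ∈ es)) (sym k∸ℓ≡d)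
        (closedPath⇒order q n≡ k≤n (whole ++ₚ dense⇒path (q ∸ m) t′.T M t.T (end-length t′.path) (end-length t.path) ∣MT∣ (proj₂ (proj₂ filled)))
          cyclic ∣ws∣ uws))
      where
      module t = Tail t
      module t′ = Tail t′
      es = e₀ ∷ edges (graph k)
      k∸ℓ≡d : k ∸ ℓ ≡ d
      k∸ℓ≡d = m+n∸n≡m d ℓ
      open Saturation n k ℓ q k≤n (trans n≡ (cong (q *_) (sym k∸ℓ≡d))) using (fromOrder)
      open CyclesFromPaths ℓ c 1≤ℓ E es (λ u len → [ (λ edge → there (∈-graph⁺ u len edge)) , here ]′) using (closedPath⇒order)
      used : List V
      used = e ++ t.added ++ t′.added
      used-unique : Unique used
      used-unique = Uniqueₚ.++⁺ (elements-unique e₀)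
        (Uniqueₚ.++⁺ t.unique t′.unique λ (p , p′) → disjoint (All.lookup t.zone p) (All.lookup t′.zone p′))
        λ (p , p′) → [ (λ r → t.fresh r p) , (λ r → t′.fresh r p) ]′ (∈-++⁻ t.added p′)
      short : ∀ {i} → i < N → suc (suc (count (D? i) (allFin n))) * k + length used ≤ count (U? i) (allFin n)
      short {i} i<N = ≤-trans (+-monoʳ-≤ (suc (suc (count (D? i) (allFin n))) * k) (≤-trans (≤-reflexive (trans (length-++ e) (cong₂ _+_ ∣e∣ (length-++ t.added))))
        (+-monoʳ-≤ k (+-mono-≤ t.short t′.short)))) (roomy i<N)
      open Fill used apex∈ short
      filled = fill-ends t′.α<N t.α<N (end-length t.path) (end-length t′.path) t′.whiteEnd t.whiteEnd
      M = proj₁ filled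
      reversed = path-reverse t.path
      ys = proj₁ reversed
      X = ys ++ (I ++ S′ ++ []) ++ t′.added
      crossing : E (S ++ I ++ S′)
      crossing = inj₂ (trans (setOf-resp-↭ split) (setOf-elements e₀))
      whole : Path t.T X t′.T
      whole = proj₁ (proj₂ reversed) ++ₚ (step (start-length t.path) ∣I∣ crossing (done (start-length t′.path)) ++ₚ t′.path)
      m = proj₁ (path-length whole)
      ∣X∣ : length X ≡ m * d
      ∣X∣ = proj₂ (path-length whole)
      ws : List V
      ws = t.T ++ X ++ M
      arrange : ws ↭ used ++ remaining
      arrange = begin
        t.T ++ X ++ M                                    ≡⟨ cong (λ zs → t.T ++ (ys ++ (I ++ zs) ++ t′.added) ++ M) (++-identityʳ S′) ⟩
        t.T ++ (ys ++ (I ++ S′) ++ t′.added) ++ M        ≡⟨ trans (cong (t.T ++_) (++-assoc ys _ M)) (sym (++-assoc t.T ys _)) ⟩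
        (t.T ++ ys) ++ ((I ++ S′) ++ t′.added) ++ M      ↭⟨ ↭ₚ.++⁺ʳ _ (↭-sym (proj₂ (proj₂ reversed))) ⟩
        (S ++ t.added) ++ ((I ++ S′) ++ t′.added) ++ M   ≡⟨ trans (++-assoc S t.added _) (cong (λ zs → S ++ t.added ++ zs) (++-assoc (I ++ S′) t′.added M)) ⟩
        S ++ t.added ++ (I ++ S′) ++ t′.added ++ M       ↭⟨ ↭ₚ.++⁺ˡ S (↭ₚ.shifts t.added (I ++ S′)) ⟩
        S ++ (I ++ S′) ++ t.added ++ t′.added ++ M       ≡⟨ trans (sym (++-assoc S (I ++ S′) _)) (cong ((S ++ I ++ S′) ++_) (sym (++-assoc t.added t′.added M))) ⟩
        (S ++ I ++ S′) ++ (t.added ++ t′.added) ++ M     ↭⟨ ↭ₚ.++⁺ split (↭ₚ.++⁺ˡ (t.added ++ t′.added) (proj₁ (proj₂ filled))) ⟩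
        e ++ (t.added ++ t′.added) ++ remaining          ≡⟨ sym (++-assoc e (t.added ++ t′.added) remaining) ⟩
        used ++ remaining                                ∎
        where open PermutationReasoning
      all-unique : Unique (used ++ remaining)
      all-unique = Uniqueₚ.++⁺ used-unique remaining-unique λ (p , p′) → proj₂ (∈-filter⁻ used? {xs = allFin n} p′) p
      place : ∀ {x} → x ∈ allFin n → x ∈ used ++ remaining
      place {x} _ with Any.any? (x ≟ᶠ_) used
      ... | yes p = ∈-++⁺ˡ p
      ... | no ¬p = ∈-++⁺ʳ used (∈-filter⁺ used? (∈-allFin x) ¬p)
      uws : Unique ws
      uws = Unique-resp-↭ (↭-sym arrange) all-unique
      ∣ws∣ : length ws ≡ n
      ∣ws∣ = trans (↭ₚ.↭-length arrange) (trans (↭ₚ.↭-length (unique-set⇒↭ all-unique (Uniqueₚ.allFin⁺ n) (λ {x} _ → ∈-allFin x) place)) (length-tabulate id))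
      cyclic : t.T ++ X ++ M ++ t.T ≡ ws ++ t.T
      cyclic = trans (cong (t.T ++_) (sym (++-assoc X M t.T))) (sym (++-assoc t.T (X ++ M) t.T))
      -- The white walk has no prescribed length; it closes up properly because `d` divides both `n`
      -- and the length of the path through the new edge.
      ∣MT∣ : length (M ++ t.T) ≡ (q ∸ m) * d
      ∣MT∣ = begin
        length (M ++ t.T)                     ≡⟨ trans (length-++ M) (+-comm (length M) (length t.T)) ⟩
        length t.T + length M                 ≡⟨ sym (m+n∸m≡n (m * d) _) ⟩
        m * d + (length t.T + length M) ∸ m * d  ≡⟨ cong (_∸ m * d) (trans (sym total) n≡) ⟩
        q * d ∸ m * d                         ≡⟨ sym (*-distribʳ-∸ d q m) ⟩
        (q ∸ m) * d                           ∎
        where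
        open ≡-Reasoning
        total : n ≡ m * d + (length t.T + length M)
        total = trans (sym ∣ws∣) (trans (length-++ t.T) (trans (cong (length t.T +_) (trans (length-++ X) (cong (_+ length M) ∣X∣))) (rearrange (length t.T) (m * d) (length M))))
          where
          rearrange : ∀ a b c → a + (b + c) ≡ b + (a + c)
          rearrange = solve-∀

  3≤h : 3 ≤ h
  3≤h = s≤s⁻¹ (s≤s⁻¹ (subst (5 ≤_) k≡ (+-mono-≤ (+-mono-≤ 2≤ℓ 1≤c) 2≤ℓ)))

  c+2≤h : c + 2 ≤ h
  c+2≤h = s≤s⁻¹ (s≤s⁻¹ (≤-trans (≤-reflexive (solver c)) (≤-trans (+-mono-≤ (+-monoˡ-≤ c 2≤ℓ) 2≤ℓ) (≤-reflexive k≡))))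
    where
    solver : ∀ c → suc (suc (c + 2)) ≡ 2 + c + 2
    solver = solve-∀

  h<R′ : h < R
  h<R′ = ≤-<-trans (≤-trans (m≤m+n h h) (m≤n+m (h + h) 4)) h<R

  -- Tails through a row or a column of a gadget

  rowCells : ℕ → ℕ → List V
  rowCells i r = map (vtx (nxt i) r) (upTo (suc h))

  module _ {i r : ℕ} (i<N : i < N) (r<h : r < h) where

    ∈-rowCells⁻ : ∀ {x} → x ∈ rowCells i r → ∃ λ s → s < suc h × x ≡ vtx (nxt i) r s × At (nxt i) r s x
    ∈-rowCells⁻ x∈ with ∈-map⁻ _ x∈
    ... | s , s∈ , refl = s , ∈-upTo⁻ s∈ , refl , vtx-At (next-< i<N) (<-trans r<h h<R′) (∈-upTo⁻ s∈)

    rowCells-D : All (D i) (rowCells i r)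
    rowCells-D = All.tabulate λ x∈ → let (s , s< , _ , (b , r≡ , _)) = ∈-rowCells⁻ x∈ in b , subst (_< h) (sym r≡) r<h

    rowCells-unique : Unique (rowCells i r)
    rowCells-unique = unique-map _ (λ s∈ s∈′ eq → trans (sym (col≡ (∈-upTo⁻ s∈))) (trans (cong col eq) (col≡ (∈-upTo⁻ s∈′)))) (Uniqueₚ.upTo⁺ (suc h))
      where
      col≡ : ∀ {s} → s < suc h → col (vtx (nxt i) r s) ≡ s
      col≡ s< = proj₂ (proj₂ (vtx-At (next-< i<N) (<-trans r<h h<R′) s<))

  ∣rowCells∣ : ∀ i r → length (rowCells i r) ≡ suc h
  ∣rowCells∣ i r = trans (length-map (vtx (nxt i) r) (upTo (suc h))) (length-upTo (suc h))

  grid : ℕ → List V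
  grid i = concatMap (rowCells i) (upTo h)

  ∣grid∣ : ∀ i → length (grid i) ≡ h * suc h
  ∣grid∣ i = trans (go (upTo h)) (cong (_* suc h) (length-upTo h))
    where
    go : ∀ rs → length (concatMap (rowCells i) rs) ≡ length rs * suc h
    go []       = refl
    go (r ∷ rs) = trans (length-++ (rowCells i r)) (cong₂ _+_ (∣rowCells∣ i r) (go rs))

  grid-D : ∀ {i} → i < N → All (D i) (grid i)
  grid-D {i} i<N = All.tabulate λ x∈ → let (r , r∈ , x∈r) = find (∈-concatMap⁻ (rowCells i) {xs = upTo h} x∈) in
    All.lookup (rowCells-D i<N (∈-upTo⁻ r∈)) x∈r

  grid-unique : ∀ {i} → i < N → Unique (grid i)
  grid-unique {i} i<N = concatMap-unique (rowCells i) (Uniqueₚ.upTo⁺ h) (λ r∈ → rowCells-unique i<N (∈-upTo⁻ r∈)) λ r∈ r∈′ x∈ x∈′ →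
    let (_ , _ , _ , (_ , r≡ , _)) = ∈-rowCells⁻ i<N (∈-upTo⁻ r∈) x∈ ; (_ , _ , _ , (_ , r≡′ , _)) = ∈-rowCells⁻ i<N (∈-upTo⁻ r∈′) x∈′ in trans (sym r≡) r≡′

  D⇒Ok : ∀ {i x} → i < N → D i x → Ok i x
  D⇒Ok i<N (b , r<) = ≤-reflexive (sym b) , subst (_< N) (sym b) (next-< i<N) , λ (_ , h≤) → <⇒≱ r< h≤

  gadgetEdge : ∀ {i S xs} → i < N → length S ≡ ℓ → GadgetEnd i S → All (D i) xs → Edge (S ++ xs)
  gadgetEdge {i} {S} {xs} i<N ∣S∣ (ok , kind) ds = i , i<N , gadget (Allₚ.++⁺ ok (All.map (D⇒Ok i<N) ds) , subst (_≤ ℓ) (sym few) le , extra kind)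
    where
    few : count (¬? ∘ D? i) (S ++ xs) ≡ count (¬? ∘ D? i) S
    few = trans (count-++ (¬? ∘ D? i) S xs) (trans (cong (count (¬? ∘ D? i) S +_) (count-none (¬? ∘ D? i) (All.map (λ p ¬p → ¬p p) ds))) (+-identityʳ _))
    le : count (¬? ∘ D? i) S ≤ ℓ
    le = subst (count (¬? ∘ D? i) S ≤_) ∣S∣ (length-filter (¬? ∘ D? i) S)
    extra : Any (D i) S ⊎ (Any (U (nxt i)) S × Any (Far i) S) → count (¬? ∘ D? i) (S ++ xs) < ℓ ⊎ (Any (U (nxt i)) (S ++ xs) × Any (Far i) (S ++ xs))
    extra (inj₁ p)       = inj₁ (subst₂ _<_ (sym few) ∣S∣ (count-not-all (¬? ∘ D? i) (Any.map (λ p ¬p → ¬p p) p)))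
    extra (inj₂ (u , f)) = inj₂ (Anyₚ.++⁺ˡ u , Anyₚ.++⁺ˡ f)

  white-tail : ∀ {α S} → α < N → length S ≡ ℓ → WhiteEnd α S → Tail (λ _ → ⊥) S
  white-tail α<N ∣S∣ end = record
    { α<N = α<N ; path = done ∣S∣ ; whiteEnd = end ; unique = [] ; zone = [] ; fresh = λ () ; short = z≤n }

  module _ {i : ℕ} (i<N : i < N) {S : List V} (∣S∣ : length S ≡ ℓ) (end : GadgetEnd i S) where

    -- The number of cells needed is at most `c + 2 * k`, which by `c + 2 ≤ h` is at most
    -- `3 * h + 2`. The grid has `h * suc h` cells, enough because `3 ≤ h`.
    middle : ∀ line → length line ≡ k → ∃ λ mid → length mid ≡ c × Unique mid × (∀ {z} → z ∈ mid → z ∈ grid i × z ∉ e ++ line)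
    middle line ∣line∣ = pick-outside _≟ᶠ_ (e ++ line) (grid-unique i<N) c enough
      where
      enough : c + length (e ++ line) ≤ length (grid i)
      enough = ≤-trans (≤-reflexive (cong (c +_) (trans (length-++ e) (cong₂ _+_ (trans ∣e∣ k≡) (trans ∣line∣ k≡)))))
               (≤-trans (≤-trans (≤-reflexive (solver₃ c h)) (+-monoˡ-≤ (h + 2 + h) c+2≤h)) (≤-trans (quadratic (h ∸ 3) (m+[n∸m]≡n 3≤h)) (≤-reflexive (sym (∣grid∣ i)))))
        where
        solver₃ : ∀ c h → c + (suc (suc h) + suc (suc h)) ≡ c + 2 + (h + 2 + h)
        solver₃ = solve-∀
        quadratic : ∀ x → 3 + x ≡ h → h + (h + 2 + h) ≤ h * suc h
        quadratic x refl = ≤-trans (m≤m+n _ (1 + 4 * x + x * x)) (≤-reflexive (solver₄ x))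
          where
          solver₄ : ∀ x → 3 + x + (3 + x + 2 + (3 + x)) + (1 + 4 * x + x * x) ≡ (3 + x) * suc (3 + x)
          solver₄ = solve-∀

    -- Two edges lead out of the gadget: a gadget edge from `S` through `mid` to the first `ℓ`
    -- vertices of `line`, and then the port edge `line` itself, whose last `ℓ` vertices form the
    -- white end.
    line-tail : ∀ {Z : V → Set} (line : List V) → length line ≡ k → Edge line → All (D i) (take ℓ line) → WhiteEnd i (drop d line) →
                Unique line → All Z line → (∀ {x} → D i x → Z x) → (∀ {x} → x ∈ line → x ∉ e) →
                (∃ λ mid → length mid ≡ c × Unique mid × (∀ {z} → z ∈ mid → z ∈ grid i × z ∉ e ++ line)) →
                Σ (Tail Z S) λ t → ∀ {x} → x ∈ line → x ∈ Tail.added t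
    line-tail {Z} line ∣line∣ edge starts whiteEnd uline zline D⇒Z fresh (mid , ∣mid∣ , umid , picked) = record
      { α<N = i<N ; added = mid ++ line
      ; path = subst (λ zs → Path S zs (drop d line)) added≡
          (step {I = mid} {T = X} ∣S∣ ∣mid∣ (inj₁ (gadgetEdge i<N ∣S∣ end (Allₚ.++⁺ midD starts)))
            (step {I = Y} {T = drop d line} ∣X∣ ∣Y∣ (inj₁ (subst Edge (sym line≡) edge)) (done ∣T∣)))
      ; whiteEnd = whiteEnd
      ; unique = Uniqueₚ.++⁺ umid uline λ (p , q) → proj₂ (picked p) (∈-++⁺ʳ e q)
      ; zone = Allₚ.++⁺ (All.map D⇒Z midD) zline
      ; fresh = λ x∈ → [ (λ p x∈e → proj₂ (picked p) (∈-++⁺ˡ x∈e)) , fresh ]′ (∈-++⁻ mid x∈)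
      ; short = ≤-reflexive (trans (length-++ mid) (trans (cong₂ _+_ ∣mid∣ ∣line∣) (solver₂ ℓ c))) } , ∈-++⁺ʳ mid
      where
      solver₂ : ∀ l c → c + (l + c + l) ≡ l + c + (l + c)
      solver₂ = solve-∀
      midD : All (D i) mid
      midD = All.tabulate λ z∈ → All.lookup (grid-D i<N) (proj₁ (picked z∈))
      X = take ℓ line
      Y = take c (drop ℓ line)
      T′ = drop c (drop ℓ line)
      T≡ : T′ ≡ drop d line
      T≡ = Listₚ.drop-drop ℓ c line
      line≡ : X ++ Y ++ drop d line ≡ line
      line≡ = trans (cong (λ zs → X ++ Y ++ zs) (sym T≡)) (trans (cong (X ++_) (take++drop≡id c (drop ℓ line))) (take++drop≡id ℓ line))
      added≡ : mid ++ X ++ Y ++ drop d line ++ [] ≡ mid ++ line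
      added≡ = cong (mid ++_) (trans (cong (λ zs → X ++ Y ++ zs) (++-identityʳ (drop d line))) line≡)
      ∣X∣ : length X ≡ ℓ
      ∣X∣ = length-take-≤ ℓ line (≤-trans (m≤n+m ℓ d) (≤-reflexive (sym ∣line∣)))
      ∣Y∣ : length Y ≡ c
      ∣Y∣ = length-take-≤ c (drop ℓ line) (≤-trans (≤-trans (m≤m+n c ℓ) (≤-reflexive (sym (trans (cong (_∸ ℓ) (+-assoc ℓ c ℓ)) (m+n∸m≡n ℓ (c + ℓ))))))
              (≤-reflexive (sym (trans (length-drop ℓ line) (cong (_∸ ℓ) ∣line∣)))))
      ∣T∣ : length (drop d line) ≡ ℓ
      ∣T∣ = trans (length-drop d line) (trans (cong (_∸ d) ∣line∣) (m+n∸m≡n d ℓ))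

    drop-last : ∀ m (xs : List V) {x} → m ≤ length xs → x ∈ drop m (xs ++ x ∷ [])
    drop-last m xs {x} le = subst (x ∈_) (sym (drop-++-≤ m xs (x ∷ []) le)) (∈-++⁺ʳ (drop m xs) (here refl))

    d<k : d ≤ suc h
    d<k = s≤s⁻¹ (≤-trans (≤-trans (≤-reflexive (+-comm 1 d)) (+-monoʳ-≤ d 1≤ℓ)) (≤-reflexive k≡))

    -- These are `h + 3 = k + 1` vertices, so one of them is outside `e`.
    plains : List V
    plains = map (λ j → vtx i (suc h + j) 0) (upTo (suc (suc (suc h))))

    plainAt : ∀ {j} → j < suc (suc (suc h)) → At i (suc h + j) 0 (vtx i (suc h + j) 0)
    plainAt {j} j< = vtx-At i<N (<-≤-trans (s≤s (+-monoʳ-≤ (suc h) (s≤s⁻¹ j<))) (≤-trans (≤-reflexive doubled) (<⇒≤ h<R))) (s≤s z≤n)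
      where
      doubled : suc (suc h + suc (suc h)) ≡ suc (suc (suc (suc (h + h))))
      doubled = cong (2 +_) (trans (+-suc h (suc h)) (cong (1 +_) (+-suc h h)))

    plain-outside : ∃ λ u → u ∉ e × Plain i u
    plain-outside with pick-outside _≟ᶠ_ e plains-unique 1 (≤-reflexive (trans (cong suc (trans ∣e∣ k≡))
                         (sym (trans (length-map _ (upTo (suc (suc (suc h))))) (length-upTo (suc (suc (suc h))))))))
      where
      plains-unique : Unique plains
      plains-unique = unique-map _ (λ j∈ j∈′ eq → +-cancelˡ-≡ (suc h) _ _
        (trans (sym (proj₁ (proj₂ (plainAt (∈-upTo⁻ j∈))))) (trans (cong row eq) (proj₁ (proj₂ (plainAt (∈-upTo⁻ j∈′))))))) (Uniqueₚ.upTo⁺ (suc (suc (suc h))))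
    ... | u ∷ [] , _ , _ , p with ∈-map⁻ _ (proj₁ (p (here refl)))
    ...   | j , j∈ , eq = u , proj₂ (p (here refl)) , trans (cong bag eq) (proj₁ (plainAt (∈-upTo⁻ j∈))) ,
              subst (h <_) (sym (trans (cong row eq) (proj₁ (proj₂ (plainAt (∈-upTo⁻ j∈)))))) (s≤s (m≤m+n h j))

    row-tail : ∀ {r} → r < h → (∀ {x} → x ∈ e → D i x → row x ≢ r) → (∃ λ u → u ∉ e × Plain i u) → Tail (λ x → D i x ⊎ U i x) S
    row-tail {r} r<h clean (u , u∉e , uPlain) = proj₁ (line-tail line ∣line∣ (i , i<N , rowPort r<h (rowVertices , full))
        (subst (All (D i)) (sym (take-++-≤ ℓ cells (u ∷ []) ℓ≤)) (Allₚ.take⁺ ℓ cellsD))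
        (Allₚ.drop⁺ d (Allₚ.++⁺ (All.map (inj₂ ∘ inj₂) cellsD) (inj₁ uU ∷ [])) , lose (drop-last d cells (subst (d ≤_) (sym (∣rowCells∣ i r)) d<k)) uU)
        (Uniqueₚ.++⁺ (rowCells-unique i<N r<h) ([] ∷ []) (λ { (p , here refl) → U∌D {i} {i} uU (All.lookup cellsD p) }))
        (Allₚ.++⁺ (All.map inj₁ cellsD) (inj₂ uU ∷ [])) inj₁ fresh (middle line ∣line∣))
      where
      cells = rowCells i r
      cellsD : All (D i) cells
      cellsD = rowCells-D i<N r<h
      uU : U i u
      uU = proj₁ uPlain , <⇒≤ (proj₂ uPlain)
      line = cells ++ u ∷ []
      ∣line∣ : length line ≡ k
      ∣line∣ = trans (length-++ cells) (trans (cong (_+ 1) (∣rowCells∣ i r)) (trans (+-comm (suc h) 1) (sym k≡)))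
      ℓ≤ : ℓ ≤ length cells
      ℓ≤ = ≤-trans (m≤m+n ℓ c) (subst (d ≤_) (sym (∣rowCells∣ i r)) d<k)
      rowVertices : All (RowVertex i r) line
      rowVertices = Allₚ.++⁺ (All.tabulate λ x∈ → let (_ , _ , _ , (b , r≡ , _)) = ∈-rowCells⁻ i<N r<h x∈ in inj₂ (b , r≡)) (inj₁ uPlain ∷ [])
      full : All (λ s → Any (At (nxt i) r s) line) (upTo (suc h))
      full = All.tabulate λ s∈ → lose (∈-++⁺ˡ (∈-map⁺ (vtx (nxt i) r) s∈)) (vtx-At (next-< i<N) (<-trans r<h h<R′) (∈-upTo⁻ s∈))
      fresh : ∀ {x} → x ∈ line → x ∉ e
      fresh x∈ x∈e = [ (λ p → let (_ , _ , _ , (_ , r≡ , _)) = ∈-rowCells⁻ i<N r<h p in clean x∈e (All.lookup cellsD p) r≡)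
                     , (λ { (here eq) → u∉e (subst (_∈ e) eq x∈e) }) ]′ (∈-++⁻ cells x∈)

    column-tail : ∀ {s} → s < suc h → apex ∉ e → (∀ {x} → x ∈ e → bag x ≡ i ⊎ bag x ≡ nxt i → col x ≢ s) →
                  Σ (Tail (λ x → bag x ≡ N ⊎ D i x ⊎ U i x) S) λ t → apex ∈ Tail.added t
    column-tail {s} s< apex∉ clean = proj₁ built , proj₂ built (∈-++⁺ʳ X (here refl))
      where
      cells = map (λ r → vtx (nxt i) r s) (upTo h)
      port = vtx i h s
      portAt : At i h s port
      portAt = vtx-At i<N h<R′ s<
      portU : U i port
      portU = proj₁ portAt , ≤-reflexive (sym (proj₁ (proj₂ portAt)))
      cellAt : ∀ {r} → r < h → At (nxt i) r s (vtx (nxt i) r s)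
      cellAt r< = vtx-At (next-< i<N) (<-trans r< h<R′) s<
      ∈-cells : ∀ {x} → x ∈ cells → ∃ λ r → r < h × At (nxt i) r s x
      ∈-cells x∈ with ∈-map⁻ _ x∈
      ... | r , r∈ , refl = r , ∈-upTo⁻ r∈ , cellAt (∈-upTo⁻ r∈)
      cellsD : All (D i) cells
      cellsD = All.tabulate λ x∈ → let (r , r< , (b , r≡ , _)) = ∈-cells x∈ in b , subst (_< h) (sym r≡) r<
      ucells : Unique cells
      ucells = unique-map _ (λ r∈ r∈′ eq → trans (sym (proj₁ (proj₂ (cellAt (∈-upTo⁻ r∈))))) (trans (cong row eq) (proj₁ (proj₂ (cellAt (∈-upTo⁻ r∈′)))))) (Uniqueₚ.upTo⁺ h)
      ∣cells∣ : length cells ≡ h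
      ∣cells∣ = trans (length-map _ (upTo h)) (length-upTo h)
      X = take ℓ cells
      Y = drop ℓ cells
      -- The apex follows the first `ℓ` cells, hence is private to this edge since `1 ≤ c`. The port
      -- comes last, so that the final `ℓ` vertices contain a vertex of `U i`.
      line = X ++ apex ∷ Y ++ port ∷ []
      line↭ : line ↭ apex ∷ port ∷ cells
      line↭ = begin
        X ++ apex ∷ Y ++ port ∷ []     ↭⟨ ↭ₚ.shift apex X (Y ++ port ∷ []) ⟩
        apex ∷ X ++ Y ++ port ∷ []     ≡⟨ cong (apex ∷_) (trans (sym (++-assoc X Y (port ∷ []))) (cong (_++ port ∷ []) (take++drop≡id ℓ cells))) ⟩
        apex ∷ cells ++ port ∷ []      ↭⟨ prep apex (↭ₚ.++-comm cells (port ∷ [])) ⟩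
        apex ∷ port ∷ cells            ∎
        where open PermutationReasoning
      ∣line∣ : length line ≡ k
      ∣line∣ = trans (↭ₚ.↭-length line↭) (trans (cong (2 +_) ∣cells∣) (sym k≡))
      ℓ≤ : ℓ ≤ length cells
      ℓ≤ = ≤-trans (+-cancelʳ-≤ 2 ℓ h (≤-trans (+-monoʳ-≤ ℓ (≤-trans 2≤ℓ (m≤n+m ℓ c))) (≤-reflexive (trans (sym (+-assoc ℓ c ℓ)) (trans k≡ (+-comm 2 h)))))) (≤-reflexive (sym ∣cells∣))
      ∣X∣ : length X ≡ ℓ
      ∣X∣ = length-take-≤ ℓ cells ℓ≤
      take≡ : take ℓ line ≡ X
      take≡ = trans (cong (λ m → take m line) (sym ∣X∣)) (take-length-++ X (apex ∷ Y ++ port ∷ []))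
      c′ = c ∸ 1
      c≡ : suc c′ ≡ c
      c≡ = m+[n∸m]≡n 1≤c
      drop≡ : drop d line ≡ drop c′ (Y ++ port ∷ [])
      drop≡ = trans (sym (Listₚ.drop-drop ℓ c line)) (trans (cong (drop c) (trans (cong (λ m → drop m line) (sym ∣X∣)) (drop-length-++ X _)))
              (cong (λ m → drop m (apex ∷ Y ++ port ∷ [])) (sym c≡)))
      c′≤ : c′ ≤ length Y
      c′≤ = ≤-trans (+-cancelˡ-≤ ℓ c′ (h ∸ ℓ) (≤-trans (+-cancelʳ-≤ 2 (ℓ + c′) h (≤-trans (+-monoʳ-≤ (ℓ + c′) 2≤ℓ)
              (≤-trans (+-monoˡ-≤ ℓ (+-monoʳ-≤ ℓ (m∸n≤m c 1))) (≤-reflexive (trans k≡ (+-comm 2 h)))))) (≤-reflexive (sym (m+[n∸m]≡n (subst (ℓ ≤_) ∣cells∣ ℓ≤))))))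
            (≤-reflexive (sym (trans (length-drop ℓ cells) (cong (_∸ ℓ) ∣cells∣))))
      colVertices : All (ColVertex i s) line
      colVertices = ↭ₚ.All-resp-↭ (↭-sym line↭) (inj₁ bag-apex ∷ inj₂ (proj₂ (proj₂ portAt) , inj₂ (proj₁ portAt , proj₁ (proj₂ portAt))) ∷
        All.tabulate λ x∈ → let (r , r< , (b , r≡ , c≡)) = ∈-cells x∈ in inj₂ (c≡ , inj₁ (b , subst (_< h) (sym r≡) r<)))
      inLine : ∀ {x} → x ∈ apex ∷ port ∷ cells → x ∈ line
      inLine = ↭ₚ.∈-resp-↭ (↭-sym line↭)
      edge : Edge line
      edge = i , i<N , colPort s< (colVertices , lose (inLine (here refl)) bag-apex ,
        All.tabulate (λ r∈ → lose (inLine (there (there (∈-map⁺ _ r∈)))) (cellAt (∈-upTo⁻ r∈))) , lose (inLine (there (here refl))) portAt)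
      apex∉cells : apex ∉ port ∷ cells
      apex∉cells (here eq) = <-irrefl (trans (sym (proj₁ portAt)) (trans (cong bag (sym eq)) bag-apex)) i<N
      apex∉cells (there p) = <-irrefl (trans (sym (proj₁ (All.lookup cellsD p))) bag-apex) (next-< i<N)
      uline : Unique line
      uline = Unique-resp-↭ (↭-sym line↭) (Allₚ.¬Any⇒All¬ (port ∷ cells) apex∉cells ∷
        Allₚ.¬Any⇒All¬ cells (λ p → U∌D {i} {i} portU (All.lookup cellsD p)) ∷ ucells)
      zline : All (λ x → bag x ≡ N ⊎ D i x ⊎ U i x) line
      zline = ↭ₚ.All-resp-↭ (↭-sym line↭) (inj₁ bag-apex ∷ inj₂ (inj₂ portU) ∷ All.map (inj₂ ∘ inj₁) cellsD)
      fresh : ∀ {x} → x ∈ line → x ∉ e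
      fresh x∈ x∈e with ↭ₚ.∈-resp-↭ line↭ x∈
      ... | here refl = apex∉ x∈e
      ... | there (here refl) = clean x∈e (inj₁ (proj₁ portAt)) (proj₂ (proj₂ portAt))
      ... | there (there p) = let (r , r< , (b , _ , c≡)) = ∈-cells p in clean x∈e (inj₂ b) c≡
      built = line-tail line ∣line∣ edge (subst (All (D i)) (sym take≡) (Allₚ.take⁺ ℓ cellsD))
        (subst (WhiteEnd i) (sym drop≡) (Allₚ.drop⁺ c′ (Allₚ.++⁺ (All.map (inj₂ ∘ inj₂) (Allₚ.drop⁺ ℓ cellsD)) (inj₁ portU ∷ [])) , lose (drop-last c′ Y c′≤) portU))
        uline zline (inj₂ ∘ inj₁) fresh (middle line ∣line∣)

  -- Case analysis on a missing edge that is not bad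

  open Badness L ℓ c
  open Selecting L ℓ 2≤N

  module Good {q : ℕ} {{_ : NonZero n}} {{_ : NonZero (k ∸ ℓ)}} (n≡ : n ≡ q * d) (k≤n : k ≤ n)
              (good : ¬ Bad e) (e₀∉ : e₀ ∉ edges (graph k)) where

    Goal : Set
    Goal = Hamiltonian ℓ (addEdge (graph k) e₀ ∣e₀∣ e₀∉)

    spread-out : ∀ {j} → j < N → count (close? j) e ≤ d
    spread-out j<N = ≮⇒≥ λ lt → good (inj₁ (_ , j<N , lt))

    RowZone ColZone : ℕ → V → Set
    RowZone i x = D i x ⊎ U i x
    ColZone i x = bag x ≡ N ⊎ D i x ⊎ U i x

    disjoint-gadgets : ∀ {i i′ x} → i ≢ i′ → RowZone i x → RowZone i′ x → ⊥
    disjoint-gadgets i≢ (inj₁ (b , _)) (inj₁ (b′ , _)) = i≢ (next-injective N (trans (sym b) b′))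
    disjoint-gadgets i≢ (inj₁ (_ , r<)) (inj₂ (_ , h≤)) = <⇒≱ r< h≤
    disjoint-gadgets i≢ (inj₂ (_ , h≤)) (inj₁ (_ , r<)) = <⇒≱ r< h≤
    disjoint-gadgets i≢ (inj₂ (b , _)) (inj₂ (b′ , _)) = i≢ (trans (sym b) b′)

    disjoint-zones : ∀ {i i′ x} → i < N → i ≢ i′ → RowZone i x → ColZone i′ x → ⊥
    disjoint-zones i< i≢ z (inj₂ z′) = disjoint-gadgets i≢ z z′
    disjoint-zones i< i≢ (inj₁ (b , _)) (inj₁ b′) = <-irrefl (trans (sym b) b′) (next-< i<)
    disjoint-zones i< i≢ (inj₂ (b , _)) (inj₁ b′) = <-irrefl (trans (sym b) b′) i<

    module _ {i : ℕ} (i<N : i < N) {S : List V} (∣S∣ : length S ≡ ℓ) (end : GadgetEnd i S) where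

      columnTail : apex ∉ e → Σ (Tail (ColZone i) S) λ t → apex ∈ Tail.added t
      -- A column with its port touches the bags `i` and `nxt i`. They contain at most `d ≤ h`
      -- vertices of `e`, fewer than the `h + 1` columns.
      columnTail apex∉ with fresh-key (near? i) col e (suc h) (≤-<-trans (count-⊆ (near? i) (close? i) inj₂ e) (≤-<-trans (spread-out i<N) d<))
        where
        d< : d < suc h
        d< = s≤s⁻¹ (≤-trans (≤-reflexive (+-comm 2 d)) (≤-trans (+-monoʳ-≤ d 2≤ℓ) (≤-reflexive k≡)))
      ... | s , s< , clean = column-tail i<N ∣S∣ end s< apex∉ clean

      rowTail : count (D? i) e < h → Tail (RowZone i) S
      -- Only the cells of the row must avoid `e` here, since the white vertex is chosen separately;
      -- so it suffices to count `e` in `D i` against the `h` rows.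
      rowTail lt with fresh-key (D? i) row e h lt
      ... | r , r< , clean = row-tail i<N ∣S∣ end r< clean (plain-outside i<N ∣S∣ end)

    whiteTail : ∀ {i S} → i < N → length S ≡ ℓ → WhiteEnd (nxt i) S → Tail (λ _ → ⊥) S
    whiteTail i<N = white-tail (next-< i<N)

    ∈-right : ∀ {x : V} (as : List V) {bs cs : List V} → x ∈ cs → x ∈ as ++ bs ++ cs
    ∈-right as {bs} p = ∈-++⁺ʳ as (∈-++⁺ʳ bs p)

    sorted-bags : ∀ {xs : List V} → All (_≢ apex) xs → AllPairs (λ x y → toℕ x < toℕ y) xs → AllPairs (λ x y → bag x ≤ bag y) xs
    sorted-bags []       []      = []
    sorted-bags (≢ ∷ ≢s) (p ∷ s) = All.map (bag-mono ≢) p ∷ sorted-bags ≢s s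

    module WithoutApex (apex∉ : apex ∉ e) where

      finish-row-column : ∀ {i i′ S I S′} → i < N → i′ < N → i ≢ i′ → length S ≡ ℓ → length S′ ≡ ℓ → length I ≡ c → S ++ I ++ S′ ↭ e →
                          GadgetEnd i S → GadgetEnd i′ S′ → count (D? i) e < h → Goal
      finish-row-column {i} i< i′< i≢ ∣S∣ ∣S′∣ ∣I∣ perm g g′ lt =
        let (t′ , apex∈) = columnTail i′< ∣S′∣ g′ apex∉ ; t = rowTail i< ∣S∣ g lt in
        assemble {q = q} n≡ k≤n (disjoint-zones i< i≢) ∣I∣ perm t t′ (∈-right e {Tail.added t} apex∈) e₀∉

      finish-white-column : ∀ {i i′ S I S′} → i < N → i′ < N → length S ≡ ℓ → length S′ ≡ ℓ → length I ≡ c → S ++ I ++ S′ ↭ e →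
                            WhiteEnd (nxt i) S → GadgetEnd i′ S′ → Goal
      finish-white-column i< i′< ∣S∣ ∣S′∣ ∣I∣ perm w g′ =
        let (t′ , apex∈) = columnTail i′< ∣S′∣ g′ apex∉ ; t = whiteTail i< ∣S∣ w in
        assemble {q = q} n≡ k≤n (λ ()) ∣I∣ perm t t′ (∈-right e {Tail.added t} apex∈) e₀∉

      -- Two gadgets with `h` vertices of `e` each would give `2 * h ≤ k = h + 2`, against `3 ≤ h`.
      -- So one end can use a row, and the other uses a column.
      not-both : ∀ {i i′} → i ≢ i′ → ¬ (count (D? i) e < h) → count (D? i′) e < h
      not-both {i} {i′} i≢ ≮ = ≰⇒> λ h≤ → <⇒≱ (subst (_< h + h) (sym (trans ∣e∣ k≡)) (≤-trans (≤-reflexive (+-comm 3 h)) (+-monoʳ-≤ h 3≤h))) (≤-trans (+-mono-≤ (≮⇒≥ ≮) h≤)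
          (≤-trans (≤-reflexive (sym (length-++ (filter (D? i) e)))) (unique-⊆⇒length≤ {ys = e}
            (Uniqueₚ.++⁺ (Uniqueₚ.filter⁺ (D? i) (elements-unique e₀)) (Uniqueₚ.filter⁺ (D? i′) (elements-unique e₀))
              λ (p , p′) → i≢ (next-injective N (trans (sym (proj₁ (proj₂ (∈-filter⁻ (D? i) {xs = e} p)))) (proj₁ (proj₂ (∈-filter⁻ (D? i′) {xs = e} p′))))))
            λ x∈ → [ (λ p → proj₁ (∈-filter⁻ (D? i) {xs = e} p)) , (λ p → proj₁ (∈-filter⁻ (D? i′) {xs = e} p)) ]′ (∈-++⁻ (filter (D? i) e) x∈))))

      bags : All (λ x → bag x < N) e
      bags = All.tabulate λ x∈ → bag≢apex λ { refl → apex∉ x∈ }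

      chosen : Selection c e
      chosen = select c e (≤-trans (s≤s z≤n) 2≤ℓ) ∣e∣ bags (sorted-bags (All.tabulate λ { x∈ refl → apex∉ x∈ }) (elements-sorted e₀))
        λ {j} j< → ≤-trans (count-⊆ (λ x → bag x ≟ j) (close? j) (inj₂ ∘ inj₁) e) (spread-out j<)

      module _ (selected : Selection c e) where
        open Selection selected

        perm : (x₁ ∷ L′) ++ I ++ S′ ↭ e
        perm = ↭-reflexive (sym split)

        near′ : ∀ {j x} → WhiteVertex j x → Near j x
        near′ (inj₁ (b , _))        = inj₁ b
        near′ (inj₂ (inj₁ (b , _))) = inj₂ b
        near′ (inj₂ (inj₂ (b , _))) = inj₂ b

        widen : ∀ {a y x} → NearTwo a a x → NearTwo a y x
        widen (inj₁ p)        = inj₁ p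
        widen (inj₂ (inj₁ p)) = inj₁ p
        widen (inj₂ (inj₂ p)) = inj₂ (inj₂ p)

        not-local : WhiteEnd (nxt i) (x₁ ∷ L′) → WhiteEnd (nxt i′) S′ → ¬ All (NearTwo (nxt i) (nxt i)) I
        not-local (w , _) (w′ , _) near = good (inj₂ (nxt i , next-< i<N , nxt i′ , next-< i′<N , ↭ₚ.All-resp-↭ perm
          (Allₚ.++⁺ (All.map (inj₁ ∘ near′) w) (Allₚ.++⁺ (All.map widen near) (All.map (inj₂ ∘ inj₁ ∘ near′) w′)))))

        -- A vertex y of the middle that is far from the first bag turns the first end into a gadget end.
        exchange : WhiteEnd (nxt i′) S′ → ∀ as y bs → I ≡ as ++ y ∷ bs → ¬ NearTwo (nxt i) (nxt i) y →
                   ∀ L″ → length (x₁ ∷ L″) ≡ ℓ → Leading i (x₁ ∷ L″) → (x₁ ∷ L″) ++ I ++ S′ ↭ e → Goal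
        exchange w′ as y bs I≡ ¬near [] len _ _ = contradiction 2≤ℓ (<⇒≱ (≤-reflexive (cong suc (sym len))))
        exchange w′ as y bs I≡ ¬near (x₂ ∷ L‴) len (lead , _) perm′ = finish-white-column i′<N i<N ∣S′∣ len ∣I′∣ perm″ w′
            (All.map leading-Ok (All.head lead ∷ lead-y ∷ All.tail (All.tail lead)) , kind (row x₁ <? h))
          where
          I′ = x₂ ∷ as ++ bs
          ∣I′∣ : length I′ ≡ c
          ∣I′∣ = trans (trans (sym (↭ₚ.↭-length (↭ₚ.shift x₂ as bs))) (trans (length-++ as) (sym (trans (cong length I≡) (length-++ as))))) ∣I∣
          perm″ : S′ ++ I′ ++ x₁ ∷ y ∷ L‴ ↭ e
          perm″ = ↭-trans (++-flip S′ I′ (x₁ ∷ y ∷ L‴)) (↭-trans (begin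
            x₁ ∷ y ∷ L‴ ++ (x₂ ∷ as ++ bs) ++ S′     ↭⟨ prep x₁ (prep y (↭ₚ.shift x₂ L‴ ((as ++ bs) ++ S′))) ⟩
            x₁ ∷ y ∷ x₂ ∷ L‴ ++ (as ++ bs) ++ S′     ↭⟨ prep x₁ (swap y x₂ ↭-refl) ⟩
            x₁ ∷ x₂ ∷ y ∷ L‴ ++ (as ++ bs) ++ S′     ↭⟨ prep x₁ (prep x₂ (↭-sym (↭ₚ.shift y L‴ ((as ++ bs) ++ S′)))) ⟩
            x₁ ∷ x₂ ∷ L‴ ++ (y ∷ as ++ bs) ++ S′     ↭⟨ prep x₁ (prep x₂ (↭ₚ.++⁺ˡ L‴ (↭ₚ.++⁺ʳ S′ (↭-sym (↭ₚ.shift y as bs))))) ⟩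
            x₁ ∷ x₂ ∷ L‴ ++ (as ++ y ∷ bs) ++ S′     ≡⟨ cong (λ zs → x₁ ∷ x₂ ∷ L‴ ++ zs ++ S′) (sym I≡) ⟩
            x₁ ∷ x₂ ∷ L‴ ++ I ++ S′                  ∎) perm′)
            where open PermutationReasoning
          y-above : nxt i ≤ bag y × bag y < N
          y-above = above (subst (y ∈_) (sym split) (∈-++⁺ʳ (x₁ ∷ L′) (∈-++⁺ˡ (subst (y ∈_) (sym I≡) (∈-++⁺ʳ as (here refl))))))
          -- Bag `i` could occur only at the seam, as the last bag, and `NearTwo` includes the last
          -- bag for this reason.
          lead-y : nxt i ≤ bag y × bag y < N × bag y ≢ i
          lead-y = proj₁ y-above , proj₂ y-above , λ b → [ (λ (N≡ , _) → ¬near (inj₂ (inj₂ (trans (cong suc b) N≡)))) ,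
                     (λ ns → <⇒≱ (≤-reflexive (trans (cong suc b) (sym ns))) (proj₁ y-above)) ]′ (next-cases i)
          far-y : Far i y
          far-y = (λ b → ¬near (inj₁ (inj₁ b))) , (λ b → ¬near (inj₁ (inj₂ b)))
          kind : Dec (row x₁ < h) → Any (D i) (x₁ ∷ y ∷ L‴) ⊎ (Any (U (nxt i)) (x₁ ∷ y ∷ L‴) × Any (Far i) (x₁ ∷ y ∷ L‴))
          kind (yes r<) = inj₁ (here (bag-x₁ , r<))
          kind (no r≮)  = inj₂ (here (bag-x₁ , ≮⇒≥ r≮) , there (here far-y))

        -- With two white ends the apex would remain uncovered. As `e` is not local, its middle has
        -- a vertex to be exchanged into the first end, which then leads to a column.
        swapped : WhiteEnd (nxt i) (x₁ ∷ L′) → WhiteEnd (nxt i′) S′ → Goal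
        swapped w w′ = let (y , y∈ , ¬near) = find (Allₚ.¬All⇒Any¬ (nearTwo? (nxt i) (nxt i)) I (not-local w w′)) ; (as , bs , I≡) = ∈-∃++ y∈ in
          exchange w′ as y bs I≡ ¬near L′ ∣L∣ leadingL perm

        both-gadgets : GadgetEnd i (x₁ ∷ L′) → GadgetEnd i′ S′ → Dec (count (D? i) e < h) → Goal
        both-gadgets g g′ (yes lt) = finish-row-column i<N i′<N i≢i′ ∣L∣ ∣S′∣ ∣I∣ perm g g′ lt
        both-gadgets g g′ (no ≮)   = finish-row-column i′<N i<N (i≢i′ ∘ sym) ∣S′∣ ∣L∣ ∣I∣ (↭-trans (++-flip S′ I (x₁ ∷ L′)) perm) g′ g (not-both i≢i′ ≮)

        by-ends : End i (x₁ ∷ L′) → End i′ S′ → Goal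
        by-ends (inj₁ w) (inj₁ w′) = swapped w w′
        by-ends (inj₁ w) (inj₂ g′) = finish-white-column i<N i′<N ∣L∣ ∣S′∣ ∣I∣ perm w g′
        by-ends (inj₂ g) (inj₁ w′) = finish-white-column i′<N i<N ∣S′∣ ∣L∣ ∣I∣ (↭-trans (++-flip S′ I (x₁ ∷ L′)) perm) w′ g
        by-ends (inj₂ g) (inj₂ g′) = both-gadgets g g′ (count (D? i) e <? h)

        result : Goal
        result = by-ends (classify leadingL) (classify leadingS′)

    -- The apex is already covered by `e`, so no column may be used: gadget ends leave through rows
    -- only, white ends directly. The apex takes one of the `c` private places of `e`, which leaves
    -- `c′` for the middle of `xs`.
    module WithApex (xs : List V) (e≡ : e ≡ apex ∷ xs) where

      apex∈ : apex ∈ e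
      apex∈ = subst (apex ∈_) (sym e≡) (here refl)

      apex∉xs : apex ∉ xs
      apex∉xs = Uniqueₚ.Unique[x∷xs]⇒x∉xs (subst Unique e≡ (elements-unique e₀))

      c′ : ℕ
      c′ = c ∸ 1

      c≡ : suc c′ ≡ c
      c≡ = m+[n∸m]≡n 1≤c

      ∣xs∣ : length xs ≡ ℓ + c′ + ℓ
      ∣xs∣ = suc-injective (trans (cong length (sym e≡)) (trans ∣e∣ (cong (_+ ℓ) (trans (cong (ℓ +_) (sym c≡)) (+-suc ℓ c′)))))

      bound : ∀ {P : V → Set} (P? : Decidable P) {j} → j < N → (∀ {x} → P x → Near j x) → count P? xs ≤ ℓ + c′
      bound P? {j} j<N near = s≤s⁻¹ (≤-trans (s≤s (count-⊆ P? (close? j) (inj₂ ∘ near) xs)) (≤-trans (≤-reflexive (sym (cong length (filter-accept (close? j) (inj₁ bag-apex)))))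
        (≤-trans (≤-reflexive (cong (count (close? j)) (sym e≡))) (≤-trans (spread-out j<N) (≤-reflexive (trans (cong (ℓ +_) (sym c≡)) (+-suc ℓ c′)))))))

      chosen : Selection c′ xs
      chosen = select c′ xs (≤-trans (s≤s z≤n) 2≤ℓ) ∣xs∣ (All.tabulate λ x∈ → bag≢apex λ { refl → apex∉xs x∈ })
        (sorted-bags (All.tabulate λ { x∈ refl → apex∉xs x∈ }) (AllPairs.tail (subst (AllPairs _) e≡ (elements-sorted e₀))))
        λ {j} j< → bound (λ x → bag x ≟ j) j< inj₁

      module _ (selected : Selection c′ xs) where
        open Selection selected

        perm : (x₁ ∷ L′) ++ (apex ∷ I) ++ S′ ↭ e
        perm = ↭-trans (↭ₚ.shift apex (x₁ ∷ L′) (I ++ S′)) (↭-reflexive (sym (trans e≡ (cong (apex ∷_) split))))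

        ∣aI∣ : length (apex ∷ I) ≡ c
        ∣aI∣ = trans (cong suc ∣I∣) c≡

        -- The apex counts as close to every bag, so at most `d - 1` other vertices are near, fewer
        -- than the `h` rows.
        few : ∀ {j} → j < N → count (D? j) e < h
        few {j} j<N = subst (λ ys → count (D? j) ys < h) (sym e≡) (≤-<-trans (≤-reflexive (cong length (filter-reject (D? j) not-apex)))
          (≤-<-trans (bound (D? j) (next-< j<N) (inj₁ ∘ proj₁)) small))
          where
          not-apex : ¬ D j apex
          not-apex (b , _) = <-irrefl (trans (sym b) bag-apex) (next-< j<N)
          small : ℓ + c′ < h
          small = +-cancelʳ-≤ 2 _ _ (≤-trans (+-monoʳ-≤ (suc (ℓ + c′)) 2≤ℓ) (≤-reflexive (trans (cong (_+ ℓ) (trans (sym (+-suc ℓ c′)) (cong (ℓ +_) c≡))) (trans k≡ (+-comm 2 h)))))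

        by-ends : End i (x₁ ∷ L′) → End i′ S′ → Goal
        by-ends (inj₁ w) (inj₁ w′) = assemble {q = q} n≡ k≤n (λ ()) ∣aI∣ perm (whiteTail i<N ∣L∣ w) (whiteTail i′<N ∣S′∣ w′) (∈-++⁺ˡ apex∈) e₀∉
        by-ends (inj₁ w) (inj₂ g′) = assemble {q = q} n≡ k≤n (λ ()) ∣aI∣ perm (whiteTail i<N ∣L∣ w) (rowTail i′<N ∣S′∣ g′ (few i′<N)) (∈-++⁺ˡ apex∈) e₀∉
        by-ends (inj₂ g) (inj₁ w′) = assemble {q = q} n≡ k≤n (λ _ ()) ∣aI∣ perm (rowTail i<N ∣L∣ g (few i<N)) (whiteTail i′<N ∣S′∣ w′) (∈-++⁺ˡ apex∈) e₀∉
        by-ends (inj₂ g) (inj₂ g′) = assemble {q = q} n≡ k≤n (disjoint-gadgets i≢i′) ∣aI∣ perm (rowTail i<N ∣L∣ g (few i<N)) (rowTail i′<N ∣S′∣ g′ (few i′<N)) (∈-++⁺ˡ apex∈) e₀∉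

        result : Goal
        result = by-ends (classify leadingL) (classify leadingS′)

    apex-head : (xs : List V) → AllPairs (λ x y → toℕ x < toℕ y) xs → apex ∈ xs → ∃ λ ys → xs ≡ apex ∷ ys
    apex-head (x ∷ xs) _            (here refl) = xs , refl
    apex-head (x ∷ xs) (before ∷ _) (there p) with x ≟ᶠ apex
    ... | yes refl = xs , refl
    ... | no x≢    = contradiction (All.lookup before p) (<-asym (apex-first x x≢))

    by-apex : Dec (apex ∈ e) → Goal
    by-apex (no apex∉) = WithoutApex.result apex∉ (WithoutApex.chosen apex∉)
    by-apex (yes apex∈) = let (xs , e≡) = apex-head e (elements-sorted e₀) apex∈ in WithApex.result xs e≡ (WithApex.chosen xs e≡)

    closes : Goal
    closes = by-apex (Any.any? (apex ≟ᶠ_) e)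

-- Counting

module _ {A : Set} where

  filter-complement-↭ : {P : A → Set} (P? : Decidable P) (xs : List A) → filter P? xs ++ filter (¬? ∘ P?) xs ↭ xs
  filter-complement-↭ P? []       = ↭-refl
  filter-complement-↭ P? (x ∷ xs) with P? x
  ... | yes _ = prep x (filter-complement-↭ P? xs)
  ... | no _  = ↭-trans (↭ₚ.shift x (filter P? xs) (filter (¬? ∘ P?) xs)) (prep x (filter-complement-↭ P? xs))

  count-⊎ : {P Q : A → Set} (P? : Decidable P) (Q? : Decidable Q) (xs : List A) →
            count (λ x → P? x ⊎-dec Q? x) xs ≤ count P? xs + count Q? xs
  count-⊎ P? Q? []       = z≤n
  count-⊎ P? Q? (x ∷ xs) with P? x | Q? x
  ... | yes _ | yes _ = s≤s (≤-trans (count-⊎ P? Q? xs) (+-monoʳ-≤ (count P? xs) (n≤1+n _)))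
  ... | yes _ | no _  = s≤s (count-⊎ P? Q? xs)
  ... | no _  | yes _ = ≤-trans (s≤s (count-⊎ P? Q? xs)) (≤-reflexive (sym (+-suc _ _)))
  ... | no _  | no _  = count-⊎ P? Q? xs

  tuples : ℕ → List A → List (List A)
  tuples zero    pool = [] ∷ []
  tuples (suc m) pool = concatMap (λ x → map (x ∷_) (tuples m pool)) pool

  ∈-tuples : ∀ {pool} (xs : List A) → All (_∈ pool) xs → xs ∈ tuples (length xs) pool
  ∈-tuples []       []         = here refl
  ∈-tuples {pool} (x ∷ xs) (x∈ ∷ all) = ∈-concatMap⁺ (λ y → map (y ∷_) (tuples (length xs) pool)) (lose x∈ (∈-map⁺ (x ∷_) (∈-tuples xs all)))

module _ {A B : Set} where

  length-concatMap-≤ : (F : A → List B) (b : ℕ) (xs : List A) → (∀ {x} → x ∈ xs → length (F x) ≤ b) → length (concatMap F xs) ≤ length xs * b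
  length-concatMap-≤ F b []       le = z≤n
  length-concatMap-≤ F b (x ∷ xs) le = ≤-trans (≤-reflexive (length-++ (F x))) (+-mono-≤ (le (here refl)) (length-concatMap-≤ F b xs (le ∘ there)))

length-tuples : ∀ {A : Set} m (pool : List A) → length (tuples m pool) ≤ length pool ^ m
length-tuples zero    pool = ≤-refl
length-tuples (suc m) pool = length-concatMap-≤ _ (length pool ^ m) pool λ {x} _ → ≤-trans (≤-reflexive (length-map (x ∷_) (tuples m pool))) (length-tuples m pool)

module Counting {n N h R : ℕ} (L : Layout n N h R) (ℓ c : ℕ) (2≤ℓ : 2 ≤ ℓ) (N≤n : N ≤ n) (b : ℕ) (1≤b : 1 ≤ b)
                (bagSize : ∀ {j} → j < N → count (λ x → Layout.bag L x ≟ j) (allFin n) ≤ b) where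
  open Construction L ℓ
  open Badness L ℓ c

  bagOf? : ∀ j → Decidable (λ x → bag x ≡ j)
  bagOf? j x = bag x ≟ j

  V* : List V
  V* = allFin n

  -- Five bags: two pairs of consecutive bags and the last one. This also bounds the two bags and
  -- the apex of `Close`.
  pool : ℕ
  pool = b * 5

  near-size : ∀ {j} → j < N → count (near? j) V* ≤ b + b
  near-size {j} j<N = ≤-trans (count-⊎ (bagOf? j) (bagOf? (nxt j)) V*) (+-mono-≤ (bagSize j<N) (bagSize (next-< j<N)))

  apex-size : count (bagOf? N) V* ≤ 1
  apex-size = unique-⊆⇒length≤ {ys = apex ∷ []} (Uniqueₚ.filter⁺ (bagOf? N) (Uniqueₚ.allFin⁺ n))
                λ x∈ → here (bag≡N⇒apex (proj₂ (∈-filter⁻ (bagOf? N) {xs = V*} x∈)))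

  close-size : ∀ {j} → j < N → count (close? j) V* ≤ pool
  close-size {j} j<N = ≤-trans (count-⊎ (bagOf? N) (near? j) V*) (≤-trans (+-mono-≤ (≤-trans apex-size 1≤b) (near-size j<N)) (≤-trans (m≤m+n _ (b + b)) (≤-reflexive (solver b))))
    where
    solver : ∀ b → b + (b + b) + (b + b) ≡ b * 5
    solver = solve-∀

  nearTwo-size : ∀ {a y} → a < N → y < N → count (nearTwo? a y) V* ≤ pool
  nearTwo-size {a} {y} a<N y<N = ≤-trans (count-⊎ (near? a) (λ x → near? y x ⊎-dec last? x) V*)
      (≤-trans (+-mono-≤ (near-size a<N) (≤-trans (count-⊎ (near? y) last? V*) (+-mono-≤ (near-size y<N) last-size))) (≤-reflexive (solver b)))
    where
    last? : Decidable (λ x → suc (bag x) ≡ N)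
    last? x = suc (bag x) ≟ N
    pred≡ : ∀ {m} → a < m → suc (m ∸ 1) ≡ m
    pred≡ {suc m} _ = refl
    last-size : count last? V* ≤ b
    last-size = ≤-trans (count-⊆ last? (bagOf? (N ∸ 1)) (λ {x} eq → cong (_∸ 1) eq) V*) (bagSize (≤-reflexive (pred≡ a<N)))
    solver : ∀ b → b + b + (b + b + b) ≡ b * 5
    solver = solve-∀

  -- Tuples overcount sets by repetitions and order, but only an upper bound of order `n ^ (ℓ ∸ 1)`
  -- is wanted.
  concentratedAt : ℕ → List (Subset n)
  concentratedAt j = concatMap (λ cs → map (λ rest → setOf (cs ++ rest)) (tuples (ℓ ∸ 1) V*)) (tuples (suc (ℓ + c)) (filter (close? j) V*))

  concentrated local : List (Subset n)
  concentrated = concatMap concentratedAt (upTo N)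
  local = concatMap (λ a → concatMap (λ y → map setOf (tuples (ℓ + c + ℓ) (filter (nearTwo? a y) V*))) (upTo N)) (upTo N)

  suc-ℓ∸1 : suc (ℓ ∸ 1) ≡ ℓ
  suc-ℓ∸1 = m+[n∸m]≡n (≤-trans (s≤s z≤n) 2≤ℓ)

  bad-listed : ∀ e → ∣ e ∣ ≡ ℓ + c + ℓ → Bad (elements e) → e ∈ concentrated ++ local
  bad-listed e ∣e∣ (inj₁ (j , j<N , many)) = ∈-++⁺ˡ (∈-concatMap⁺ _ (lose (∈-upTo⁺ j<N) (∈-concatMap⁺ _ (lose cs∈ (subst (_∈ map (λ rest → setOf (cs ++ rest)) (tuples (ℓ ∸ 1) V*)) set≡ (∈-map⁺ _ rest∈))))))
    where
    fs = filter (close? j) (elements e)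
    cs = take (suc (ℓ + c)) fs
    rest = drop (suc (ℓ + c)) fs ++ filter (¬? ∘ close? j) (elements e)
    perm : cs ++ rest ↭ elements e
    perm = ↭-trans (↭-reflexive (trans (sym (++-assoc cs _ _)) (cong (_++ filter (¬? ∘ close? j) (elements e)) (take++drop≡id (suc (ℓ + c)) fs)))) (filter-complement-↭ (close? j) (elements e))
    set≡ : setOf (cs ++ rest) ≡ e
    set≡ = trans (setOf-resp-↭ perm) (setOf-elements e)
    ∣cs∣ : length cs ≡ suc (ℓ + c)
    ∣cs∣ = length-take-≤ (suc (ℓ + c)) fs many
    ∣rest∣ : length rest ≡ ℓ ∸ 1
    ∣rest∣ = +-cancelˡ-≡ (suc (ℓ + c)) _ _ (trans (cong (_+ length rest) (sym ∣cs∣)) (trans (sym (length-++ cs)) (trans (↭ₚ.↭-length perm) (trans (length-elements e)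
               (trans ∣e∣ (trans (cong (ℓ + c +_) (sym suc-ℓ∸1)) (+-suc (ℓ + c) (ℓ ∸ 1))))))))
    cs∈ : cs ∈ tuples (suc (ℓ + c)) (filter (close? j) V*)
    cs∈ = subst (λ m → cs ∈ tuples m (filter (close? j) V*)) ∣cs∣ (∈-tuples cs (All.tabulate λ {x} x∈ → ∈-filter⁺ (close? j) (∈-allFin x) (proj₂ (∈-filter⁻ (close? j) {xs = elements e} (∈-take (suc (ℓ + c)) x∈)))))
    rest∈ : rest ∈ tuples (ℓ ∸ 1) V*
    rest∈ = subst (λ m → rest ∈ tuples m V*) ∣rest∣ (∈-tuples rest (All.universal ∈-allFin rest))
  bad-listed e ∣e∣ (inj₂ (a , a<N , y , y<N , all)) = ∈-++⁺ʳ concentrated (∈-concatMap⁺ _ (lose (∈-upTo⁺ a<N) (∈-concatMap⁺ _ (lose (∈-upTo⁺ y<N)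
      (subst (_∈ map setOf (tuples (ℓ + c + ℓ) (filter (nearTwo? a y) V*))) (setOf-elements e) (∈-map⁺ setOf
        (subst (λ m → elements e ∈ tuples m (filter (nearTwo? a y) V*)) (trans (length-elements e) ∣e∣)
          (∈-tuples (elements e) (All.map (λ {x} p → ∈-filter⁺ (nearTwo? a y) (∈-allFin x) p) all)))))))))

  bad-count : length (concentrated ++ local) ≤ (pool ^ suc (ℓ + c) + pool ^ (ℓ + c + ℓ)) * n ^ ℓ
  bad-count = ≤-trans (≤-reflexive (length-++ concentrated)) (≤-trans (+-mono-≤ (first (ℓ ∸ 1) suc-ℓ∸1) second) (≤-reflexive (sym (*-distribʳ-+ (n ^ ℓ) (pool ^ suc (ℓ + c)) _))))
    where
    ∣V*∣ : length V* ≡ n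
    ∣V*∣ = length-tabulate id
    first : ∀ l → suc l ≡ ℓ → length concentrated ≤ pool ^ suc (ℓ + c) * n ^ ℓ
    first l eq = ≤-trans (length-concatMap-≤ _ (pool ^ suc (ℓ + c) * n ^ l) (upTo N) each) (≤-trans (*-monoˡ-≤ _ (≤-trans (≤-reflexive (length-upTo N)) N≤n)) (≤-reflexive (trans (solver n (pool ^ suc (ℓ + c)) (n ^ l)) (cong (λ m → pool ^ suc (ℓ + c) * n ^ m) eq))))
      where
      solver : ∀ n x y → n * (x * y) ≡ x * (n * y)
      solver = solve-∀
      each : ∀ {j} → j ∈ upTo N → length (concentratedAt j) ≤ pool ^ suc (ℓ + c) * n ^ l
      each {j} j∈ = ≤-trans (length-concatMap-≤ _ (n ^ l) (tuples (suc (ℓ + c)) (filter (close? j) V*)) λ {cs} _ →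
          ≤-trans (≤-reflexive (length-map _ (tuples (ℓ ∸ 1) V*))) (≤-trans (length-tuples (ℓ ∸ 1) V*) (≤-reflexive (cong₂ _^_ ∣V*∣ (cong (_∸ 1) (sym eq))))))
        (*-monoˡ-≤ (n ^ l) (≤-trans (length-tuples (suc (ℓ + c)) (filter (close? j) V*)) (^-monoˡ-≤ (suc (ℓ + c)) (close-size (∈-upTo⁻ j∈)))))
    second : length local ≤ pool ^ (ℓ + c + ℓ) * n ^ ℓ
    second = ≤-trans (length-concatMap-≤ _ (n * pool ^ (ℓ + c + ℓ)) (upTo N) λ {a} a∈ →
        ≤-trans (length-concatMap-≤ _ (pool ^ (ℓ + c + ℓ)) (upTo N) λ {y} y∈ →
          ≤-trans (≤-reflexive (length-map setOf (tuples (ℓ + c + ℓ) (filter (nearTwo? a y) V*)))) (≤-trans (length-tuples (ℓ + c + ℓ) (filter (nearTwo? a y) V*)) (^-monoˡ-≤ (ℓ + c + ℓ) (nearTwo-size (∈-upTo⁻ a∈) (∈-upTo⁻ y∈)))))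
        (*-monoˡ-≤ _ (≤-trans (≤-reflexive (length-upTo N)) N≤n)))
      (≤-trans (*-monoˡ-≤ _ (≤-trans (≤-reflexive (length-upTo N)) N≤n)) (≤-trans (≤-reflexive (solver n (pool ^ (ℓ + c + ℓ)))) (*-monoʳ-≤ (pool ^ (ℓ + c + ℓ)) square)))
      where
      solver : ∀ n x → n * (n * x) ≡ x * (n * (n * 1))
      solver = solve-∀
      square : n ^ 2 ≤ n ^ ℓ
      square = ^-monoʳ-≤ n {{>-nonZero (≤-trans (s≤s z≤n) (toℕ<n apex))}} 2≤ℓ

  unique-bad-length : (es : List (Subset n)) → Unique es → All (λ e → ∣ e ∣ ≡ ℓ + c + ℓ) es → All (λ e → Bad (elements e)) es →
                      length es ≤ (pool ^ suc (ℓ + c) + pool ^ (ℓ + c + ℓ)) * n ^ ℓ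
  unique-bad-length es u sizes bads = ≤-trans (unique-⊆⇒length≤ u λ {e} e∈ → bad-listed e (All.lookup sizes e∈) (All.lookup bads e∈)) bad-count

  gadget-size : ∀ {i} → i < N → count (D? i) V* ≤ h * suc h
  gadget-size {i} i<N = subst₂ _≤_ (length-map key (filter (D? i) V*)) (length-upTo (h * suc h))
      (unique-⊆⇒length≤ (unique-map key injective (Uniqueₚ.filter⁺ (D? i) (Uniqueₚ.allFin⁺ n))) λ k∈ → let (x , x∈ , eq) = ∈-map⁻ key k∈ in
        subst (_∈ upTo (h * suc h)) (sym eq) (∈-upTo⁺ (digits-< (suc h) (proj₂ (inD x∈)) (column< x∈))))
    where
    key : V → ℕ
    key x = row x * suc h + col x
    inD : ∀ {x} → x ∈ filter (D? i) V* → D i x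
    inD x∈ = proj₂ (∈-filter⁻ (D? i) {xs = V*} x∈)
    bag< : ∀ {x} → x ∈ filter (D? i) V* → bag x < N
    bag< x∈ = subst (_< N) (sym (proj₁ (inD x∈))) (next-< i<N)
    column< : ∀ {x} → x ∈ filter (D? i) V* → col x < suc h
    column< x∈ = col< (bag< x∈)
    injective : ∀ {x y} → x ∈ filter (D? i) V* → y ∈ filter (D? i) V* → key x ≡ key y → x ≡ y
    injective {x} {y} x∈ y∈ eq with digits-unique (suc h) {row x} {row y} (column< x∈) (column< y∈) eq
    ... | r≡ , c≡ = coords (bag< x∈) (trans (proj₁ (inD x∈)) (sym (proj₁ (inD y∈)))) r≡ c≡

  -- Counting the cells of column 0 alone is enough, one for each row from `h` to `R - 1`.
  white-size : h ≤ R → ∀ {i} → i < N → R ∸ h ≤ count (U? i) V*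
  white-size h≤R {i} i<N = subst (_≤ count (U? i) V*) (trans (length-map cellAt (upTo (R ∸ h))) (length-upTo (R ∸ h)))
      (unique-⊆⇒length≤ (unique-map cellAt injective (Uniqueₚ.upTo⁺ (R ∸ h))) λ x∈ → let (j , j∈ , eq) = ∈-map⁻ cellAt x∈ in
        subst (_∈ filter (U? i) V*) (sym eq) (∈-filter⁺ (U? i) (∈-allFin _) (proj₁ (located j∈) , subst (h ≤_) (sym (proj₁ (proj₂ (located j∈)))) (m≤m+n h j))))
    where
    cellAt : ℕ → V
    cellAt j = vtx i (h + j) 0
    located : ∀ {j} → j ∈ upTo (R ∸ h) → At i (h + j) 0 (cellAt j)
    located {j} j∈ = vtx-At i<N (subst (_< R) (+-comm j h) (m≤o∸n⇒m+n≤o (suc j) h≤R (∈-upTo⁻ j∈))) (s≤s z≤n)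
    injective : ∀ {j j′} → j ∈ upTo (R ∸ h) → j′ ∈ upTo (R ∸ h) → cellAt j ≡ cellAt j′ → j ≡ j′
    injective j∈ j∈′ eq = +-cancelˡ-≡ h _ _ (trans (sym (proj₁ (proj₂ (located j∈)))) (trans (cong row eq) (proj₁ (proj₂ (located j∈′)))))

-- Choice of the bags

-- Vertex 0 is the apex; the others are cut into N bags of R (h + 1) consecutive vertices, the last bag taking the remainder.
module Standard (n′ N′ h R : ℕ) .{{_ : NonZero (R * suc h)}} where

  β N : ℕ
  β = R * suc h
  N = suc N′

  bagℕ offset : ℕ → ℕ
  bagℕ p   = p / β ⊓ N′
  offset p = p ∸ bagℕ p * β

  bag≤ : ∀ p → bagℕ p * β ≤ p
  bag≤ p = ≤-trans (*-monoˡ-≤ β (m⊓n≤m (p / β) N′)) (m/n*n≤m p β)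

  offset-unique : ∀ {p p′} → bagℕ p ≡ bagℕ p′ → offset p ≡ offset p′ → p ≡ p′
  offset-unique {p} {p′} eq eq′ = trans (sym (m∸n+n≡m (bag≤ p))) (trans (cong₂ _+_ eq′ (cong (_* β) eq)) (m∸n+n≡m (bag≤ p′)))

  division : ∀ d .{{_ : NonZero d}} j o → o < d → (j * d + o) / d ≡ j × (j * d + o) % d ≡ o
  division d j o o< = digits-unique d (m%n<n (j * d + o) d) o<
    (trans (+-comm ((j * d + o) / d * d) _) (sym (m≡m%n+[m/n]*n (j * d + o) d)))

  bag-digits : ∀ j o → j < N → o < β → bagℕ (j * β + o) ≡ j
  bag-digits j o j<N o< = trans (cong (_⊓ N′) (proj₁ (division β j o o<))) (m≤n⇒m⊓n≡m (s≤s⁻¹ j<N))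

  offset-digits : ∀ j o → j < N → o < β → offset (j * β + o) ≡ o
  offset-digits j o j<N o< = trans (cong (λ i → j * β + o ∸ i * β) (bag-digits j o j<N o<)) (m+n∸m≡n (j * β) o)

  module _ (N≤ : N * β ≤ n′) (n′< : n′ < suc N * β) where

    V : Set
    V = Fin (suc n′)

    bagV rowV colV : V → ℕ
    bagV zero    = N
    bagV (suc p) = bagℕ (toℕ p)
    rowV zero    = 0
    rowV (suc p) = offset (toℕ p) / suc h
    colV zero    = 0
    colV (suc p) = offset (toℕ p) % suc h

    bagℕ<N : ∀ p → bagℕ p < N
    bagℕ<N p = s≤s (m⊓n≤n (p / β) N′)

    layout : Layout (suc n′) N h R
    layout = record
      { apex = zero ; bag = bagV ; row = rowV ; col = colV ; bag-apex = refl
      ; bag≢apex = λ { {zero} ≢ → contradiction refl ≢ ; {suc p} _ → bagℕ<N (toℕ p) }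
      ; col< = λ { {zero} lt → contradiction lt (<-irrefl refl) ; {suc p} _ → m%n<n (offset (toℕ p)) (suc h) }
      ; coords = coords
      ; vertex = vertex
      ; apex-first = λ { zero ≢ → contradiction refl ≢ ; (suc p) _ → s≤s z≤n }
      ; bag-mono = λ { {zero} ≢ _ → contradiction refl ≢ ; {suc p} {zero} _ () ; {suc p} {suc p′} _ (s≤s lt) → ⊓-monoˡ-≤ N′ (/-monoˡ-≤ β (<⇒≤ lt)) }
      }
      where
      coords : ∀ {x y} → bagV x < N → bagV x ≡ bagV y → rowV x ≡ rowV y → colV x ≡ colV y → x ≡ y
      coords {zero} lt _ _ _ = contradiction lt (<-irrefl refl)
      coords {suc p} {zero} lt eq _ _ = contradiction lt (<-irrefl eq)
      coords {suc p} {suc p′} _ b r c = cong suc (toℕ-injective (offset-unique b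
        (trans (m≡m%n+[m/n]*n (offset (toℕ p)) (suc h)) (trans (cong₂ (λ a b → a + b * suc h) c r) (sym (m≡m%n+[m/n]*n (offset (toℕ p′)) (suc h)))))))
      vertex : ∀ {j r s} → j < N → r < R → s < suc h → ∃ λ x → bagV x ≡ j × rowV x ≡ r × colV x ≡ s
      vertex {j} {r} {s} j<N r<R s< = suc (fromℕ< p<) ,
          trans (cong bagℕ (toℕ-fromℕ< p<)) (bag-digits j o j<N o<) ,
          trans (cong (_/ suc h) offset≡) (proj₁ (division (suc h) r s s<)) ,
          trans (cong (_% suc h) offset≡) (proj₂ (division (suc h) r s s<))
        where
        o = r * suc h + s
        o< : o < β
        o< = digits-< (suc h) r<R s<
        p< : j * β + o < n′
        p< = <-≤-trans (digits-< β j<N o<) N≤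
        offset≡ : offset (toℕ (fromℕ< p<)) ≡ o
        offset≡ = trans (cong offset (toℕ-fromℕ< p<)) (offset-digits j o j<N o<)

    -- Below the last bag the offset is a remainder modulo `β`; in the last bag it is less than
    -- `2 * β` because `n′ < suc N * β`.
    offset-bound : ∀ {p} → p < n′ → offset p < β + β
    offset-bound {p} p<n′ = +-cancelʳ-< (bagℕ p * β) (offset p) (β + β) (subst (_< β + β + bagℕ p * β) (sym (m∸n+n≡m (bag≤ p))) below)
      where
      below : p < β + β + bagℕ p * β
      below with ⊓-sel (p / β) N′
      ... | inj₁ eq = subst (λ j → p < β + β + j * β) (sym eq) (<-≤-trans (subst (_< β + p / β * β) (sym (m≡m%n+[m/n]*n p β)) (+-monoˡ-< (p / β * β) (m%n<n p β))) (+-monoˡ-≤ (p / β * β) (m≤m+n β β)))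
      ... | inj₂ eq = subst (λ j → p < β + β + j * β) (sym eq) (<-trans p<n′ (subst (n′ <_) (sym (+-assoc β β (N′ * β))) n′<))

    bag-size : ∀ {j} → j < N → count (λ x → bagV x ≟ j) (allFin (suc n′)) ≤ β + β
    bag-size {j} j<N = subst₂ _≤_ (length-map key members) (length-upTo (β + β))
        (unique-⊆⇒length≤ (unique-map key injective (Uniqueₚ.filter⁺ inBag? (Uniqueₚ.allFin⁺ (suc n′)))) small)
      where
      inBag? : Decidable (λ x → bagV x ≡ j)
      inBag? x = bagV x ≟ j
      members = filter inBag? (allFin (suc n′))
      key : V → ℕ
      key zero    = 0
      key (suc p) = offset (toℕ p)
      inBag : ∀ {x} → x ∈ members → bagV x ≡ j
      inBag x∈ = proj₂ (∈-filter⁻ inBag? {xs = allFin (suc n′)} x∈)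
      injective : ∀ {x y} → x ∈ members → y ∈ members → key x ≡ key y → x ≡ y
      injective {zero}  x∈ _ _ = contradiction j<N (<-irrefl (sym (inBag x∈)))
      injective {suc p} {zero} _ y∈ _ = contradiction j<N (<-irrefl (sym (inBag y∈)))
      injective {suc p} {suc p′} x∈ y∈ eq = cong suc (toℕ-injective (offset-unique (trans (inBag x∈) (sym (inBag y∈))) eq))
      small : ∀ {o} → o ∈ map key members → o ∈ upTo (β + β)
      small o∈ with ∈-map⁻ key o∈
      ... | zero  , x∈ , refl = contradiction j<N (<-irrefl (sym (inBag x∈)))
      ... | suc p , _  , refl = ∈-upTo⁺ (offset-bound (toℕ<n p))

-- The saturated graph and its number of edges

module Bounding {n N h R : ℕ} (L : Layout n N h R) (ℓ c : ℕ) (2≤ℓ : 2 ≤ ℓ) (1≤c : 1 ≤ c) (k≡ : ℓ + c + ℓ ≡ suc (suc h)) (2≤N : 2 ≤ N) (N≤n : N ≤ n)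
                (h<R : suc (suc (suc (suc (h + h)))) < R)
                (room : suc (suc (h * suc h)) * (ℓ + c + ℓ) + (ℓ + c + ℓ + ((ℓ + c + (ℓ + c)) + (ℓ + c + (ℓ + c)))) ≤ R ∸ h)
                (b : ℕ) (1≤b : 1 ≤ b) (bagSize : ∀ {j} → j < N → count (λ x → Layout.bag L x ≟ j) (allFin n) ≤ b)
                {q : ℕ} {{_ : NonZero n}} {{_ : NonZero (ℓ + c + ℓ ∸ ℓ)}} (n≡ : n ≡ q * (ℓ + c + ℓ ∸ ℓ)) (k≤n : ℓ + c + ℓ ≤ n) where
  open Construction L ℓ
  open Badness L ℓ c
  open Counting L ℓ c 2≤ℓ N≤n b 1≤b bagSize

  k d : ℕ
  k = ℓ + c + ℓ
  d = ℓ + c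

  open Saturation n k ℓ q k≤n n≡

  h≤4+2h : h ≤ suc (suc (suc (suc (h + h))))
  h≤4+2h = ≤-trans (m≤m+n h h) (m≤n+m (h + h) 4)

  roomy : ∀ {i} → i < N → suc (suc (count (D? i) (allFin n))) * k + (k + ((d + d) + (d + d))) ≤ count (U? i) (allFin n)
  roomy i<N = ≤-trans (+-monoˡ-≤ _ (*-monoˡ-≤ k (s≤s (s≤s (gadget-size i<N))))) (≤-trans room (white-size (≤-trans h≤4+2h (<⇒≤ h<R)) i<N))

  saturated : Σ (KGraph n k) λ H → HamiltonianSaturated ℓ H × All (λ e → Bad (elements e)) (edges H)
  saturated = saturate (λ e → bad? (elements e)) (graph k)
    (NonHamiltonian.nonHamiltonian L ℓ d 2≤ℓ (m<m+n ℓ 1≤c) 2≤N (≤-<-trans (≤-trans (s≤s (m≤m+n h h)) (m≤n+m _ 3)) h<R))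
    (All.tabulate λ {e} e∈ → let (∣e∣ , edge) = ∈-graph⁻ {k} e∈ in
      edge⇒bad (≤-trans (s≤s z≤n) 2≤ℓ) 2≤N (elements-unique e) (trans (length-elements e) ∣e∣) edge)
    (λ e ∣e∣ e∉ good → Closing.Good.closes L ℓ c 2≤ℓ 1≤c k≡ 2≤N h<R roomy e ∣e∣ {q} (trans n≡ (cong (q *_) (m+n∸n≡m d ℓ))) k≤n good e∉)

  bounded : ∃ λ m → IsSat n k ℓ m × m ≤ ((b * 5) ^ suc d + (b * 5) ^ k) * n ^ ℓ
  bounded = let (H , sat , bads) = saturated ; (m , isSat , m≤) = isSat-≤ H sat in
    m , isSat , ≤-trans m≤ (unique-bad-length (edges H) (simple H) (uniform H) bads)

module UpperBound (ℓ c : ℕ) (2≤ℓ : 2 ≤ ℓ) (1≤c : 1 ≤ c) where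

  k d h : ℕ
  k = ℓ + c + ℓ
  d = ℓ + c
  h = k ∸ 2

  k≡ : k ≡ suc (suc h)
  k≡ = sym (m+[n∸m]≡n (≤-trans 2≤ℓ (m≤n+m ℓ (ℓ + c))))

  -- The white part of a bag must afford k vertices for the light passage, k vertices around each gadget vertex it absorbs,
  -- and the vertices of an edge and of the two tails (2d each) continuing it.
  room R β C n₀ : ℕ
  room = suc (suc (h * suc h)) * k + (k + ((d + d) + (d + d)))
  -- The first `h` rows form a gadget, and `room` further rows suffice for the white walk. The slack
  -- `5 + h` provides the rows of `plains`.
  R = h + (room + (5 + h))
  β = R * suc h
  -- Bags have at most `β + β` vertices, which enters through `pool`; `suc` makes the constant
  -- positive.
  C = suc (((β + β) * 5) ^ suc d + ((β + β) * 5) ^ k)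
  -- Besides the apex there are then at least `2 * β` vertices, enough for two bags.
  n₀ = suc (β + β)

  h<R : suc (suc (suc (suc (h + h)))) < R
  h<R = ≤-trans (≤-reflexive (rearrange h)) (+-monoʳ-≤ h (m≤n+m (5 + h) room))
    where
    rearrange : ∀ h → 5 + (h + h) ≡ h + (5 + h)
    rearrange = solve-∀

  room≤ : room ≤ R ∸ h
  room≤ = ≤-trans (m≤m+n room (5 + h)) (≤-reflexive (sym (m+n∸m≡n h (room + (5 + h)))))

  R≤β : R ≤ β
  R≤β = ≤-trans (≤-reflexive (sym (*-identityʳ R))) (*-monoʳ-≤ R (s≤s z≤n))

  k≤β : k ≤ β
  k≤β = ≤-trans (≤-reflexive k≡) (≤-trans (≤-trans (≤-trans (s≤s (s≤s (m≤m+n h h))) (m≤n+m _ 3)) h<R) R≤β)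

  1≤β : 1 ≤ β
  1≤β = ≤-trans (≤-trans (s≤s z≤n) h<R) R≤β

  instance
    k∸ℓ≢0 : NonZero (k ∸ ℓ)
    k∸ℓ≢0 = subst NonZero (sym (m+n∸n≡m d ℓ)) (>-nonZero (≤-trans 1≤c (m≤n+m c ℓ)))

    β≢0 : NonZero β
    β≢0 = >-nonZero 1≤β

  bounded : ∀ n → n₀ ≤ n → (k ∸ ℓ) ∣ n → ∃ λ m → IsSat n k ℓ m × m ≤ C * n ^ ℓ
  bounded (suc n′) (s≤s large) (divides q n≡) = weaken (((β + β) * 5) ^ suc d + ((β + β) * 5) ^ k) (suc n′ ^ ℓ) (Bounding.bounded (layout N≤ n′<) ℓ c 2≤ℓ 1≤c k≡ 2≤N N≤n h<R room≤ (β + β)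
      (≤-trans 1≤β (m≤m+n β β)) (bag-size N≤ n′<) {q} n≡ (≤-trans k≤β (≤-trans (m≤m+n β β) (m≤n⇒m≤1+n large))))
    where
    N N′ r : ℕ
    N = n′ / β
    N′ = N ∸ 1
    r = n′ % β
    open Standard n′ N′ h R using (layout; bag-size)
    1≤N : 1 ≤ N
    1≤N = m≥n⇒m/n>0 (≤-trans (m≤m+n β β) large)
    N≡ : suc N′ ≡ N
    N≡ = m+[n∸m]≡n 1≤N
    digits : n′ ≡ r + suc N′ * β
    digits = trans (m≡m%n+[m/n]*n n′ β) (cong (λ j → r + j * β) (sym N≡))
    N≤ : suc N′ * β ≤ n′
    N≤ = ≤-trans (m≤n+m (suc N′ * β) r) (≤-reflexive (sym digits))
    n′< : n′ < suc (suc N′) * β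
    n′< = subst (_< suc (suc N′) * β) (sym digits) (+-monoˡ-< (suc N′ * β) (m%n<n n′ β))
    2≤N : 2 ≤ suc N′
    2≤N = s≤s⁻¹ (*-cancelʳ-< β 2 (suc (suc N′)) (≤-<-trans (≤-trans (≤-reflexive (cong (β +_) (+-identityʳ β))) large) n′<))
    N≤n : suc N′ ≤ suc n′
    N≤n = ≤-trans (≤-trans (≤-reflexive (sym (*-identityʳ (suc N′)))) (*-monoʳ-≤ (suc N′) 1≤β)) (m≤n⇒m≤1+n N≤)
    weaken : ∀ x y → (∃ λ m → IsSat (suc n′) k ℓ m × m ≤ x * y) → ∃ λ m → IsSat (suc n′) k ℓ m × m ≤ suc x * y
    weaken x y (m , isSat , m≤) = m , isSat , ≤-trans m≤ (*-monoˡ-≤ y (n≤1+n x))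

theorem1p1 : ∀ (k ℓ : ℕ) → 2 ≤ ℓ → 2 * ℓ < k →
    ∃ λ (C : ℕ) → ∃ λ (n₀ : ℕ) → 0 < C ×
    (∀ (n : ℕ) → n₀ ≤ n → (k ∸ ℓ) ∣ n →
    ∃ λ (m : ℕ) → IsSat n k ℓ m × m ≤ C * n ^ exponent k ℓ)
theorem1p1 k ℓ 2≤ℓ 2ℓ<k = C , n₀ , s≤s z≤n , λ n n₀≤n div →
    let (m , isSat , m≤) = subst (λ k → (k ∸ ℓ) ∣ n → ∃ λ m → IsSat n k ℓ m × m ≤ C * n ^ ℓ) k≡ (bounded n n₀≤n) div in
    m , isSat , ≤-trans m≤ (*-monoʳ-≤ C (^-monoʳ-≤ n {{>-nonZero (≤-trans (s≤s z≤n) n₀≤n)}} ℓ≤exponent))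
  where
  c : ℕ
  c = k ∸ 2 * ℓ
  k≡ : ℓ + c + ℓ ≡ k
  k≡ = trans (solver ℓ c) (m+[n∸m]≡n (<⇒≤ 2ℓ<k))
    where
    solver : ∀ l c → l + c + l ≡ 2 * l + c
    solver = solve-∀
  open UpperBound ℓ c 2≤ℓ (m<n⇒0<n∸m 2ℓ<k) using (C; n₀; bounded)
  ℓ≤exponent : ℓ ≤ exponent k ℓ
  ℓ≤exponent = ≤-trans (m≤m⊔n ℓ _) (m≤m⊔n (ℓ ⊔ (k ∸ 2 * ℓ ∸ 1)) _)
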